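{- There is an absolute constant $c>0$ such that, for every integer $d\ge 1$, there is a constant $C_d>0$ for which every weakly $d$-degenerate ordered $3$-graph $H$ on $n$ vertices with $\chi_<(H)\le 3$ satisfies \[ r_<(H)\le 2^{C_d n^{2-c/d}}. \]
   Context: An ordered $k$-graph is a (finite) $k$-uniform hypergraph equipped with a linear order on its vertex set. An ordered $k$-graph $G$ contains an ordered copy of an ordered $k$-graph $H$ if there is an order-preserving injection $\phi\colon V(H)\to V(G)$ such that $\phi(e)\in E(G)$ for every $e\in E(H)$. For ordered $k$-graphs $G$ and $H$, the ordered Ramsey number $r_<(G,H)$ is the smallest integer $N$ such that every red-blue coloring of the edges of the naturally ordered complete $k$-graph on $[N]=\{1,\dots,N\}$ contains a blue ordered copy of $G$ or a red ordered copy of $H$. In the diagonal case, $r_<(H)=r_<(H,H)$. A vertex set is an interval if it consists of consecutive vertices in the underlying linear order. The interval chromatic number $\chi_<(H)$ of an ordered $k$-graph $H$ is the minimum number of intervals into which $V(H)$ can be partitioned so that every edge meets each interval in at most one vertex. An ordered $3$-graph $H$ on $n$ vertices is weakly $d$-degenerate if its vertices admit an ordering $u_1,\ldots,u_n$ (not necessarily related to the given linear order on $V(H)$) such that, for every $i$, \[ \bigl|\{e\in E(H): u_i\in e \text{ and } e\cap\{u_1,\ldots,u_{i-1}\}\ne\varnothing\}\bigr|\le d. \] -}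

module Defs where

open import Algebra.Definitions.RawSemiring as Semiring using ()
open import Data.Bool using (Bool; T; T?)
open import Data.Fin as Fin using (Fin)
open import Data.Fin.Permutation using (Permutation′; _⟨$⟩ʳ_)
open import Data.Fin.Properties using (any?)
open import Data.Fin.Subset using (Subset; inside; outside; ∣_∣; _∈_)
open import Data.Fin.Subset.Properties using (_∈?_)
open import Data.Integer using (+_; -[1+_])
open import Data.List using (List; []; _∷_; _++_; map; filter; length)
open import Data.Nat as ℕ using (ℕ; zero; suc; NonZero)
open import Data.Product using (∃-syntax; _×_; proj₁)
open import Data.Rational.Unnormalised as ℚ using (ℚᵘ; mkℚᵘ; _/_)
open import Data.Sum using (_⊎_)
open import Data.Vec as Vec using (tabulate)
open import Function.Definitions using (Injective; Surjective)
open import Relation.Binary.Core using (_Preserves_⟶_)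
open import Relation.Binary.Definitions using (DecidableEquality)
open import Relation.Binary.PropositionalEquality using (_≡_; refl)
open import Relation.Nullary using (yes; no; does; _×-dec_)
open import Relation.Nullary.Decidable using (toWitness; ⌊_⌋)
open import Relation.Unary using (Pred; Decidable)

IsLeast : ∀ {ℓ} → Pred ℕ ℓ → Pred ℕ ℓ
IsLeast P m = P m × (∀ {k} → P k → m ℕ.≤ k)

-- A finite linearly ordered vertex set is identified with Fin n and its
-- standard order.
record OrderedGraph (k n : ℕ) : Set where
  field
    edge?   : Subset n → Bool
    uniform : ∀ e → T (edge? e) → ∣ e ∣ ≡ k

_∈E_ : ∀ {k n} → Subset n → OrderedGraph k n → Set
e ∈E H = T (OrderedGraph.edge? H e)

image : ∀ {m n} → (Fin m → Fin n) → Subset m → Subset n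
image φ e = tabulate λ j → does (any? λ i → (i ∈? e) ×-dec (φ i Fin.≟ j))

Contains : ∀ {k m n} → OrderedGraph k n → OrderedGraph k m → Set
Contains {k} {m} {n} G H =
  ∃[ φ ] Injective _≡_ _≡_ φ × φ Preserves Fin._≤_ ⟶ Fin._≤_
       × (∀ (e : Subset m) → e ∈E H → image φ e ∈E G)

data Colour : Set where
  red blue : Colour

_≟ᶜ_ : DecidableEquality Colour
red  ≟ᶜ red  = yes refl
red  ≟ᶜ blue = no λ ()
blue ≟ᶜ red  = no λ ()
blue ≟ᶜ blue = yes refl

-- A colouring of the complete k-graph on Fin N is given by a total function
-- on subsets, of which only the values on k-element subsets are ever used.
colourClass : ∀ (k : ℕ) {N} → (Subset N → Colour) → Colour → OrderedGraph k N
colourClass k χ c = record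
  { edge?   = λ e → ⌊ (∣ e ∣ ℕ.≟ k) ×-dec (χ e ≟ᶜ c) ⌋
  ; uniform = λ e p →
      proj₁ (toWitness {a? = (∣ e ∣ ℕ.≟ k) ×-dec (χ e ≟ᶜ c)} p)
  }

Arrows : ∀ {k m n} → OrderedGraph k m → OrderedGraph k n → ℕ → Set
Arrows {k} G H N = ∀ (χ : Subset N → Colour) →
  Contains (colourClass k χ blue) G ⊎ Contains (colourClass k χ red) H

IsRamseyNumber : ∀ {k m n} → OrderedGraph k m → OrderedGraph k n → ℕ → Set
IsRamseyNumber G H = IsLeast (Arrows G H)

IsInterval : ∀ {n} → Pred (Fin n) _ → Set
IsInterval P = ∀ {i j l} → P i → P l → i Fin.≤ j → j Fin.≤ l → P j

-- The parts are the fibres of p; surjectivity makes them nonempty.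
IntervalColourable : ∀ {k n} → OrderedGraph k n → ℕ → Set
IntervalColourable {k} {n} H m =
  ∃[ p ] Surjective _≡_ _≡_ p
       × (∀ (c : Fin m) → IsInterval (λ (i : Fin n) → p i ≡ c))
       × (∀ e → e ∈E H → ∀ {i j} → i ∈ e → j ∈ e → p i ≡ p j → i ≡ j)

IsIntervalChromaticNumber : ∀ {k n} → OrderedGraph k n → ℕ → Set
IsIntervalChromaticNumber H = IsLeast (IntervalColourable H)

subsets : ∀ n → List (Subset n)
subsets zero    = Vec.[] ∷ []
subsets (suc n) =
  map (inside Vec.∷_) (subsets n) ++ map (outside Vec.∷_) (subsets n)

backDegree : ∀ {k n} → OrderedGraph k n → Permutation′ n → Fin n → ℕ
backDegree {n = n} H u i = length (filter
  (λ e → T? (OrderedGraph.edge? H e)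
         ×-dec ((u ⟨$⟩ʳ i) ∈? e)
         ×-dec any? (λ j → (j Fin.<? i) ×-dec ((u ⟨$⟩ʳ j) ∈? e)))
  (subsets n))

WeaklyDegenerate : ∀ {n} → ℕ → OrderedGraph 3 n → Set
WeaklyDegenerate {n} d H =
  ∃[ u ] (∀ (i : Fin n) → backDegree H u i ℕ.≤ d)

open Semiring ℚ.+-*-rawSemiring using (_^_)

-- C · n ^ (a / b) ≤ y for C, y ≥ 0 and b > 0, stated after raising both sides
-- to the power b and, if a is negative, multiplying them by n ^ (- a).
_·_^_≤_ : ℚᵘ → ℕ → ℚᵘ → ℚᵘ → Set
C · n ^ mkℚᵘ (+ a)    b-1 ≤ y =
  C ^ suc b-1 ℚ.* (+ n / 1) ^ a ℚ.≤ y ^ suc b-1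
C · n ^ mkℚᵘ -[1+ a ] b-1 ≤ y =
  C ^ suc b-1 ℚ.≤ y ^ suc b-1 ℚ.* (+ n / 1) ^ suc a

-- N ≤ 2 ^ (C · n ^ α) for C ≥ 0.  The exponent x = C · n ^ α is a real number,
-- and 2 ^ x is the infimum of 2 ^ (s / t) over the rationals s / t ≥ x;
-- N ≤ 2 ^ (s / t) is N ^ t ≤ 2 ^ s.  For n ≥ 1 the bound only weakens as C or α
-- grows, so positive real constants, where claimed to exist, may be taken
-- rational.
_≤2^[_·_^_] : ℕ → ℚᵘ → ℕ → ℚᵘ → Set
N ≤2^[ C · n ^ α ] = ∀ (s t : ℕ) .{{_ : NonZero t}} →
  C · n ^ α ≤ (+ s / t) → N ℕ.^ t ℕ.≤ 2 ℕ.^ s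

{-# OPTIONS --safe #-}

-- Reserve a block of M consecutive vertices for each vertex of H and embed H in blue, one vertex
-- at a time in the degenerate order. For a pair b < c of vertices still to be embedded, keep the
-- common blue link B of the images of those a with abc ∈ E(H), a graph between the blocks of b
-- and c; the invariant is that B has density at least w^(-j) on every pair of large sets, where
-- j ≤ d is the number of such a. Embedding b then shrinks the candidate sets of at most d
-- vertices c, and each set shrinks by at most w^d in total.
--
-- The invariant fails after embedding a vertex at x only if x is bad: on some large Y × Z nearly
-- all of B lies in the red link of x. Many bad x force a red complete tripartite 3-graph. Choose
-- n tuples of about 1/density vertices each, such that for many bad x and most z all B-edges
-- between z and the tuples are red and z has a B-neighbour in every tuple; one tuple costs only
-- a factor 1 - 1/u in z, where u² is about w. Intersecting over n
-- of the x, and then fixing one B-neighbour per tuple, costs 2^{n²/u}, against 2^{n u^{2d+O(1)}}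
-- for the choice of the tuples; u = n^{1/(5d)} balances the two up to constants in the exponent.
module Submission where

open import Defs
import Algebra.Definitions.RawSemiring as RawSemiring
open import Data.Bool using (Bool; true; false; _∧_; _∨_; not; T; T?; if_then_else_)
open import Data.Bool.ListAction using (all; any)
import Data.Bool.Properties as Bool
open import Data.Fin as Fin using (Fin; zero; suc; toℕ; fromℕ<; combine)
open import Data.Fin.Permutation using (Permutation′; _⟨$⟩ʳ_; _⟨$⟩ˡ_; inverseʳ; inverseˡ)
open import Data.Fin.Properties using (_≟_; toℕ-injective; toℕ<n; toℕ-fromℕ<; toℕ-combine; combine-monoˡ-<; all?; any?; pigeonhole; <-cmp; suc-injective)
open import Data.Fin.Subset using (Subset; inside; outside; _∪_; ⁅_⁆; ∣_∣) renaming (_∈_ to _∈ˢ_; _∉_ to _∉ˢ_)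
open import Data.Fin.Subset.Properties using (_∈?_; anySubset?; ⊆-antisym; ∪-comm; ∪-assoc; ∪-identityˡ; ∣⁅x⁆∣≡1; x∈p∪q⁻; x∈p∪q⁺; x∈⁅x⁆; x∈⁅y⁆⇒x≡y; q⊆p∪q)
open import Data.List using (List; []; _∷_; _++_; map; length; filter; allFin; tabulate)
open import Data.List.Membership.Propositional using (_∈_)
open import Data.List.Membership.Propositional.Properties using (∈-allFin; ∈-map⁺; ∈-map⁻; ∈-++⁺ˡ; ∈-++⁺ʳ)
open import Data.List.Properties using (length-tabulate; length-map; map-tabulate)
open import Data.List.Relation.Unary.All as All using (All; []; _∷_)
import Data.List.Relation.Unary.All.Properties as All
open import Data.List.Relation.Unary.AllPairs as AllPairs using (AllPairs; []; _∷_)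
import Data.List.Relation.Unary.AllPairs.Properties as AllPairs
open import Data.List.Relation.Unary.Any using (here; there)
open import Data.Nat as ℕ using (ℕ; zero; suc; pred; NonZero; _+_; _*_; _∸_; _^_; _≤_; _<_; _≤ᵇ_; _<ᵇ_; _≡ᵇ_; _<?_; _≤?_; z≤n; s≤s; >-nonZero)
open import Data.Nat.Properties hiding (_≟_; <-cmp; suc-injective)
open import Data.Nat.Tactic.RingSolver using (solve-∀)
open import Data.Product using (Σ; ∃-syntax; _×_; _,_; proj₁; proj₂)
open import Data.Sum using (_⊎_; inj₁; inj₂)
open import Data.Unit using (⊤; tt)
open import Data.Vec as Vec using (Vec; []; _∷_; toList; lookup)
open import Data.Vec.Properties using (length-toList; lookup∘tabulate; ≡-dec; []=⇒lookup; lookup⇒[]=)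
open import Function using (_∘_; id)
open import Function.Definitions using (Injective)
open import Relation.Binary.Core using (_Preserves_⟶_)
open import Relation.Binary.Definitions using (tri<; tri≈; tri>)
open import Relation.Binary.PropositionalEquality using (_≡_; _≢_; refl; sym; trans; cong; cong₂; subst; subst₂; module ≡-Reasoning)
open import Relation.Nullary using (contradiction; yes; no; does; Dec; ¬_; _×-dec_; _⊎-dec_; _→-dec_)
open import Relation.Nullary.Decidable using (map′; toWitness; fromWitness; dec-true; decidable-stable; ¬?)

-- Finite sums and counting

-- Why tuples rather than single vertices: a pair y, z is an edge of B only with density about
-- w^(-j). Fixing one vertex y at a time could leave each bad x with a set of z of density about
-- w^(-jn). Intersecting such sets over n of the x would then cost about w^(j n²), which for j > 0
-- is no better than 2^(n²). A tuple long enough to contain a B-neighbour of almost every z leaves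
-- each x with a set of density about 2^(-n/u), and n such sets can be intersected. The B-neighbour
-- in each tuple is fixed only afterwards and once for all x, because B does not depend on x.
--
-- Such a tuple must also avoid the blue link of x at almost every z. A union bound over its entries
-- works if, seen from z, the blue part of B has density below 1/(u × length). The length is about
-- u/density(B), so the blue part must be thinner than B by a factor of about u². This is the
-- density drop w that is allowed per embedded vertex.

𝟙 : Bool → ℕ
𝟙 true  = 1
𝟙 false = 0

∑ : {A : Set} → List A → (A → ℕ) → ℕ
∑ []       f = 0
∑ (x ∷ xs) f = f x + ∑ xs f

# : {A : Set} → List A → (A → Bool) → ℕ
# xs p = ∑ xs (𝟙 ∘ p)

∑∈ : {A : Set} → List A → (A → Bool) → (A → ℕ) → ℕ
∑∈ xs p f = ∑ xs (λ x → 𝟙 (p x) * f x)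

∧-intro : ∀ {a b} → a ≡ true → b ≡ true → a ∧ b ≡ true
∧-intro refl refl = refl

∧-elim : ∀ {a b} → a ∧ b ≡ true → a ≡ true × b ≡ true
∧-elim {true} {true} refl = refl , refl

true? : ∀ b → b ≡ true ⊎ b ≡ false
true? true  = inj₁ refl
true? false = inj₂ refl

not-true : ∀ {b} → not b ≡ true → b ≡ false
not-true {false} refl = refl

𝟙-mono : ∀ {a b} → (a ≡ true → b ≡ true) → 𝟙 a ≤ 𝟙 b
𝟙-mono {false}        h = z≤n
𝟙-mono {true} {true}  h = ≤-refl
𝟙-mono {true} {false} h with () ← h refl

𝟙-∧ : ∀ a b → 𝟙 (a ∧ b) ≡ 𝟙 a * 𝟙 b
𝟙-∧ true  b = sym (+-identityʳ (𝟙 b))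
𝟙-∧ false b = refl

module _ {A : Set} where

  ∑-mono : (xs : List A) {f g : A → ℕ} → (∀ x → f x ≤ g x) → ∑ xs f ≤ ∑ xs g
  ∑-mono []       h = z≤n
  ∑-mono (x ∷ xs) h = +-mono-≤ (h x) (∑-mono xs h)

  ∑-cong : (xs : List A) {f g : A → ℕ} → (∀ x → f x ≡ g x) → ∑ xs f ≡ ∑ xs g
  ∑-cong []       h = refl
  ∑-cong (x ∷ xs) h = cong₂ _+_ (h x) (∑-cong xs h)

  ∑-zero : (xs : List A) → ∑ xs (λ _ → 0) ≡ 0
  ∑-zero []       = refl
  ∑-zero (x ∷ xs) = ∑-zero xs

  ∑-+ : (xs : List A) (f g : A → ℕ) → ∑ xs (λ x → f x + g x) ≡ ∑ xs f + ∑ xs g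
  ∑-+ []       f g = refl
  ∑-+ (x ∷ xs) f g = trans (cong ((f x + g x) +_) (∑-+ xs f g))
                           (interchange (f x) (g x) (∑ xs f) (∑ xs g))
    where
    interchange : ∀ a b c d → a + b + (c + d) ≡ a + c + (b + d)
    interchange = solve-∀

  ∑-*ˡ : (xs : List A) (c : ℕ) (f : A → ℕ) → ∑ xs (λ x → c * f x) ≡ c * ∑ xs f
  ∑-*ˡ []       c f = sym (*-zeroʳ c)
  ∑-*ˡ (x ∷ xs) c f = trans (cong (c * f x +_) (∑-*ˡ xs c f))
                            (sym (*-distribˡ-+ c (f x) (∑ xs f)))

  ∑-*ʳ : (xs : List A) (c : ℕ) (f : A → ℕ) → ∑ xs (λ x → f x * c) ≡ ∑ xs f * c
  ∑-*ʳ xs c f = trans (∑-cong xs (λ x → *-comm (f x) c))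
                      (trans (∑-*ˡ xs c f) (*-comm c (∑ xs f)))

  ∑-++ : (xs ys : List A) (f : A → ℕ) → ∑ (xs ++ ys) f ≡ ∑ xs f + ∑ ys f
  ∑-++ []       ys f = refl
  ∑-++ (x ∷ xs) ys f = trans (cong (f x +_) (∑-++ xs ys f)) (sym (+-assoc (f x) _ _))

  ∑-map : {B : Set} (h : B → A) (xs : List B) (f : A → ℕ) → ∑ (map h xs) f ≡ ∑ xs (f ∘ h)
  ∑-map h []       f = refl
  ∑-map h (x ∷ xs) f = cong (f (h x) +_) (∑-map h xs f)

  #-mono : (xs : List A) {p q : A → Bool} →
    (∀ x → p x ≡ true → q x ≡ true) → # xs p ≤ # xs q
  #-mono xs h = ∑-mono xs (λ x → 𝟙-mono (h x))

  #-cong : (xs : List A) {p q : A → Bool} → (∀ x → p x ≡ q x) → # xs p ≡ # xs q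
  #-cong xs h = ∑-cong xs (λ x → cong 𝟙 (h x))

  #-true : (xs : List A) → # xs (λ _ → true) ≡ length xs
  #-true []       = refl
  #-true (x ∷ xs) = cong suc (#-true xs)

  #-split : (xs : List A) (p q : A → Bool) →
    # xs p ≡ # xs (λ x → p x ∧ q x) + # xs (λ x → p x ∧ not (q x))
  #-split xs p q = trans (∑-cong xs (λ x → split (p x) (q x))) (∑-+ xs _ _)
    where
    split : ∀ a b → 𝟙 a ≡ 𝟙 (a ∧ b) + 𝟙 (a ∧ not b)
    split true  true  = refl
    split true  false = refl
    split false b     = refl

  #-∧-∑ : (xs : List A) (p q : A → Bool) → # xs (λ x → p x ∧ q x) ≡ ∑∈ xs p (𝟙 ∘ q)
  #-∧-∑ xs p q = ∑-cong xs (λ x → 𝟙-∧ (p x) (q x))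

  ∑∈-mono : (xs : List A) (p : A → Bool) {f g : A → ℕ} →
    (∀ x → p x ≡ true → f x ≤ g x) → ∑∈ xs p f ≤ ∑∈ xs p g
  ∑∈-mono xs p {f} {g} h = ∑-mono xs step
    where
    step : ∀ x → 𝟙 (p x) * f x ≤ 𝟙 (p x) * g x
    step x with p x in eq
    ... | true  = *-monoʳ-≤ 1 (h x eq)
    ... | false = z≤n

  ∑∈-const : (xs : List A) (p : A → Bool) (c : ℕ) → ∑∈ xs p (λ _ → c) ≡ # xs p * c
  ∑∈-const xs p c = ∑-*ʳ xs c (𝟙 ∘ p)

  ∑∈-*ˡ : (xs : List A) (p : A → Bool) (c : ℕ) (f : A → ℕ) →
    ∑∈ xs p (λ x → c * f x) ≡ c * ∑∈ xs p f
  ∑∈-*ˡ xs p c f = trans (∑-cong xs (λ x → swap (𝟙 (p x)) c (f x))) (∑-*ˡ xs c _)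
    where
    swap : ∀ a b d → a * (b * d) ≡ b * (a * d)
    swap = solve-∀

  ∑∈-+ : (xs : List A) (p : A → Bool) (f g : A → ℕ) →
    ∑∈ xs p (λ x → f x + g x) ≡ ∑∈ xs p f + ∑∈ xs p g
  ∑∈-+ xs p f g = trans (∑-cong xs (λ x → *-distribˡ-+ (𝟙 (p x)) (f x) (g x))) (∑-+ xs _ _)

  #-≥-const : (xs : List A) (p : A → Bool) {c : ℕ} {f : A → ℕ} →
    (∀ x → p x ≡ true → c ≤ f x) → # xs p * c ≤ ∑∈ xs p f
  #-≥-const xs p h = ≤-trans (≤-reflexive (sym (∑∈-const xs p _))) (∑∈-mono xs p h)

  #-≤-const : (xs : List A) (p : A → Bool) {c : ℕ} {f : A → ℕ} →
    (∀ x → p x ≡ true → f x ≤ c) → ∑∈ xs p f ≤ # xs p * c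
  #-≤-const xs p h = ≤-trans (∑∈-mono xs p h) (≤-reflexive (∑∈-const xs p _))

  #-witness : (xs : List A) (p : A → Bool) → 0 < # xs p → ∃[ x ] p x ≡ true
  #-witness (x ∷ xs) p h with p x in eq
  ... | true  = x , eq
  ... | false = #-witness xs p h

  -- The first alternative absorbs an empty selection, for which there is no maximiser to return.
  argmax : (xs : List A) (q : A → Bool) (f : A → ℕ) →
    ∑∈ xs q f ≡ 0 ⊎ (∃[ y ] q y ≡ true × ∑∈ xs q f ≤ # xs q * f y)
  argmax []       q f = inj₁ refl
  argmax (x ∷ xs) q f with q x in eq | argmax xs q f
  ... | false | r      = r
  ... | true  | inj₁ e = inj₂ (x , eq , ≤-trans
          (≤-reflexive (trans (cong (f x + 0 +_) e) (trans (+-identityʳ _) (+-identityʳ _))))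
          (m≤m+n (f x) _))
  ... | true  | inj₂ (y , qy , h) with ≤-total (f x) (f y)
  ...   | inj₁ fx≤fy = inj₂ (y , qy , +-mono-≤ (≤-trans (≤-reflexive (+-identityʳ _)) fx≤fy) h)
  ...   | inj₂ fy≤fx = inj₂ (x , eq , +-mono-≤ (≤-reflexive (+-identityʳ _))
          (≤-trans h (*-monoʳ-≤ (# xs q) fy≤fx)))

∑-swap : {A B : Set} (xs : List A) (ys : List B) (f : A → B → ℕ) →
  ∑ xs (λ x → ∑ ys (f x)) ≡ ∑ ys (λ y → ∑ xs (λ x → f x y))
∑-swap []       ys f = sym (∑-zero ys)
∑-swap (x ∷ xs) ys f = trans (cong (∑ ys (f x) +_) (∑-swap xs ys f)) (sym (∑-+ ys (f x) _))

∑∈-swap : {A B : Set} (xs : List A) (ys : List B) (p : A → Bool) (q : B → Bool)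
  (f : A → B → ℕ) →
  ∑∈ xs p (λ x → ∑∈ ys q (f x)) ≡ ∑∈ ys q (λ y → ∑∈ xs p (λ x → f x y))
∑∈-swap xs ys p q f =
  trans (∑-cong xs (λ x → sym (∑-*ˡ ys (𝟙 (p x)) _)))
  (trans (∑-swap xs ys _)
  (∑-cong ys λ y → trans (∑-cong xs (λ x → swap (𝟙 (p x)) (𝟙 (q y)) (f x y)))
                         (∑-*ˡ xs (𝟙 (q y)) _)))
  where
  swap : ∀ a b d → a * (b * d) ≡ b * (a * d)
  swap = solve-∀

∑#-swap : {A B : Set} (xs : List A) (ys : List B) (p : A → Bool) (q : B → Bool)
  (r : A → B → Bool) →
  ∑∈ xs p (λ x → # ys (λ y → q y ∧ r x y)) ≡ ∑∈ ys q (λ y → # xs (λ x → p x ∧ r x y))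
∑#-swap xs ys p q r =
  trans (∑-cong xs (λ x → cong (𝟙 (p x) *_) (#-∧-∑ ys q (r x))))
  (trans (∑∈-swap xs ys p q _)
  (∑-cong ys (λ y → cong (𝟙 (q y) *_) (sym (#-∧-∑ xs p (λ x → r x y))))))

-- Averaging: the `y` of largest degree does at least as well as the mean. The degree bound is the
-- fraction `K / c`, and positivity excludes a vanishing sum. This one lemma selects the tuples, the
-- common vertices x, and the neighbours inside the tuples.
popular-neighbour : {A B : Set} (xs : List A) (ys : List B) (p : A → Bool) (q : B → Bool)
  (r : A → B → Bool) (K c : ℕ) → 0 < # xs p → 0 < K →
  (∀ x → p x ≡ true → K ≤ c * # ys (λ y → q y ∧ r x y)) →
  ∃[ y ] q y ≡ true × # xs p * K ≤ c * (# ys q * # xs (λ x → p x ∧ r x y))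
popular-neighbour xs ys p q r K c 0<p 0<K h = result (argmax ys q g)
  where
  g = λ y → # xs (λ x → p x ∧ r x y)
  total : # xs p * K ≤ c * ∑∈ ys q g
  total = ≤-trans (#-≥-const xs p h)
    (≤-reflexive (trans (∑∈-*ˡ xs p c _) (cong (c *_) (∑#-swap xs ys p q r))))
  result : ∑∈ ys q g ≡ 0 ⊎ (∃[ y ] q y ≡ true × ∑∈ ys q g ≤ # ys q * g y) →
    ∃[ y ] q y ≡ true × # xs p * K ≤ c * (# ys q * g y)
  result (inj₁ e) = contradiction
    (≤-trans (*-mono-≤ 0<p 0<K)
      (≤-trans total (≤-reflexive (trans (cong (c *_) e) (*-zeroʳ c))))) λ ()
  result (inj₂ (y , qy , le)) = y , qy , ≤-trans total (*-monoʳ-≤ c le)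

-- Powers and Bernoulli's inequality

^-distribʳ-* : ∀ m n k → (m * n) ^ k ≡ m ^ k * n ^ k
^-distribʳ-* m n zero    = refl
^-distribʳ-* m n (suc k) = trans (cong (m * n *_) (^-distribʳ-* m n k))
                                 (swap m n (m ^ k) (n ^ k))
  where
  swap : ∀ a b c d → a * b * (c * d) ≡ a * c * (b * d)
  swap = solve-∀

^-pos : ∀ {m} k → 0 < m → 0 < m ^ k
^-pos zero    h = s≤s z≤n
^-pos (suc k) h = *-mono-≤ h (^-pos k h)

*-cancelˡ-≤′ : ∀ {m n} o → 0 < o → o * m ≤ o * n → m ≤ n
*-cancelˡ-≤′ o h = *-cancelˡ-≤ o {{>-nonZero h}}

-- Both Bernoulli inequalities are multiplied out so that no exponent k - 1 occurs.
bernoulli-≤ : ∀ a b k → (a + b) * (a + b) ^ k ≤ (a + b) * a ^ k + k * b * (a + b) ^ k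
bernoulli-≤ a b zero    = m≤m+n _ 0
bernoulli-≤ a b (suc k) = begin
  (a + b) * ((a + b) * (a + b) ^ k)
    ≤⟨ *-monoʳ-≤ (a + b) (bernoulli-≤ a b k) ⟩
  (a + b) * ((a + b) * a ^ k + k * b * (a + b) ^ k)
    ≡⟨ expand a b (a ^ k) k ((a + b) ^ k) ⟩
  (a + b) * (a * a ^ k) + (b * ((a + b) * a ^ k) + k * b * ((a + b) * (a + b) ^ k))
    ≤⟨ +-monoʳ-≤ ((a + b) * (a * a ^ k)) (+-monoˡ-≤ (k * b * ((a + b) * (a + b) ^ k))
         (*-monoʳ-≤ b (*-monoʳ-≤ (a + b) (^-monoˡ-≤ k (m≤m+n a b))))) ⟩
  (a + b) * (a * a ^ k) + (b * ((a + b) * (a + b) ^ k) + k * b * ((a + b) * (a + b) ^ k))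
    ≡⟨ cong ((a + b) * (a * a ^ k) +_) (collect b k ((a + b) * (a + b) ^ k)) ⟩
  (a + b) * (a * a ^ k) + suc k * b * ((a + b) * (a + b) ^ k) ∎
  where
  open ≤-Reasoning
  expand : ∀ a b x k y → (a + b) * ((a + b) * x + k * b * y)
    ≡ (a + b) * (a * x) + (b * ((a + b) * x) + k * b * ((a + b) * y))
  expand = solve-∀
  collect : ∀ b k x → b * x + k * b * x ≡ suc k * b * x
  collect = solve-∀

bernoulli-≥ : ∀ a b k → a ^ suc k + suc k * b * a ^ k ≤ (a + b) ^ suc k
bernoulli-≥ a b zero    = ≤-reflexive (base a b)
  where
  base : ∀ a b → a * 1 + 1 * b * 1 ≡ (a + b) * 1
  base = solve-∀
bernoulli-≥ a b (suc k) = begin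
  a * (a * a ^ k) + suc (suc k) * b * (a * a ^ k)
    ≤⟨ m≤m+n _ (suc k * (b * b) * a ^ k) ⟩
  a * (a * a ^ k) + suc (suc k) * b * (a * a ^ k) + suc k * (b * b) * a ^ k
    ≡⟨ factor a b k (a ^ k) ⟩
  (a + b) * (a * a ^ k + suc k * b * a ^ k)
    ≤⟨ *-monoʳ-≤ (a + b) (bernoulli-≥ a b k) ⟩
  (a + b) * (a + b) ^ suc k ∎
  where
  open ≤-Reasoning
  factor : ∀ a b k x → a * (a * x) + suc (suc k) * b * (a * x) + suc k * (b * b) * x
    ≡ (a + b) * (a * x + suc k * b * x)
  factor = solve-∀

-- This is (1 - b/(a+b))^m ≤ 1/2 when `b` is at least a fraction 1/m of the whole. Bernoulli gives
-- (a+b)^m ≥ a^m + m b a^(m-1), and m b ≥ a makes the second term at least a^m.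
power-halving : ∀ a b m → 0 < m → a + b ≤ m * b → 2 * a ^ m ≤ (a + b) ^ m
power-halving a b (suc m) _ h = begin
  2 * (a * a ^ m)                   ≡⟨ double (a * a ^ m) ⟩
  a ^ suc m + a * a ^ m             ≤⟨ +-monoʳ-≤ (a ^ suc m) (*-monoˡ-≤ (a ^ m) (≤-trans (m≤m+n a b) h)) ⟩
  a ^ suc m + suc m * b * a ^ m     ≤⟨ bernoulli-≥ a b m ⟩
  (a + b) ^ suc m                   ∎
  where
  open ≤-Reasoning
  double : ∀ x → 2 * x ≡ x + x
  double = solve-∀

power-decay : ∀ a b m k → 0 < m → a + b ≤ m * b → 2 ^ k * a ^ (m * k) ≤ (a + b) ^ (m * k)
power-decay a b m k 0<m h = begin
  2 ^ k * a ^ (m * k)     ≡⟨ cong (2 ^ k *_) (sym (^-*-assoc a m k)) ⟩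
  2 ^ k * (a ^ m) ^ k     ≡⟨ sym (^-distribʳ-* 2 (a ^ m) k) ⟩
  (2 * a ^ m) ^ k         ≤⟨ ^-monoˡ-≤ k (power-halving a b m 0<m h) ⟩
  ((a + b) ^ m) ^ k       ≡⟨ ^-*-assoc (a + b) m k ⟩
  (a + b) ^ (m * k)       ∎
  where open ≤-Reasoning

-- (1 - 1/(2h))^h ≥ 1/2, iterated g times, with m = 2h - 1.
slow-decay : ∀ m h g → 0 < h → suc m ≡ 2 * h → suc m ^ (h * g) ≤ 2 ^ g * m ^ (h * g)
slow-decay m h g 0<h eq = begin
  suc m ^ (h * g)         ≡⟨ sym (^-*-assoc (suc m) h g) ⟩
  (suc m ^ h) ^ g         ≤⟨ ^-monoˡ-≤ g half ⟩
  (2 * m ^ h) ^ g         ≡⟨ ^-distribʳ-* 2 (m ^ h) g ⟩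
  2 ^ g * (m ^ h) ^ g     ≡⟨ cong (2 ^ g *_) (^-*-assoc m h g) ⟩
  2 ^ g * m ^ (h * g)     ∎
  where
  open ≤-Reasoning
  s = suc m ^ h
  base : suc m * s ≤ suc m * m ^ h + h * 1 * s
  base = subst (λ x → x * x ^ h ≤ x * m ^ h + h * 1 * x ^ h) (+-comm m 1) (bernoulli-≤ m 1 h)
  half : s ≤ 2 * m ^ h
  half = *-cancelˡ-≤′ h 0<h (+-cancelʳ-≤ (h * s) _ _ (begin
    h * s + h * s                   ≡⟨ double h s ⟩
    2 * h * s                       ≡⟨ cong (_* s) (sym eq) ⟩
    suc m * s                       ≤⟨ base ⟩
    suc m * m ^ h + h * 1 * s       ≡⟨ cong₂ (λ x y → x * m ^ h + y * s) eq (*-identityʳ h) ⟩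
    2 * h * m ^ h + h * s           ≡⟨ cong (_+ h * s) (assoc h (m ^ h)) ⟩
    h * (2 * m ^ h) + h * s         ∎))
    where
    double : ∀ h s → h * s + h * s ≡ 2 * h * s
    double = solve-∀
    assoc : ∀ h x → 2 * h * x ≡ h * (2 * x)
    assoc = solve-∀

-- Counting tuples

module _ {A : Set} where

  cons-all : ∀ {k} → List A → List (Vec A k) → List (Vec A (suc k))
  cons-all []       ts = []
  cons-all (x ∷ xs) ts = map (x ∷_) ts ++ cons-all xs ts

  tuples : List A → (k : ℕ) → List (Vec A k)
  tuples xs zero    = [] ∷ []
  tuples xs (suc k) = cons-all xs (tuples xs k)

  ∑-cons-all : ∀ {k} (xs : List A) (ts : List (Vec A k)) (f : Vec A (suc k) → ℕ) →
    ∑ (cons-all xs ts) f ≡ ∑ xs (λ x → ∑ ts (λ t → f (x ∷ t)))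
  ∑-cons-all []       ts f = refl
  ∑-cons-all (x ∷ xs) ts f = trans (∑-++ (map (x ∷_) ts) _ f)
    (cong₂ _+_ (∑-map (x ∷_) ts f) (∑-cons-all xs ts f))

  #-tuples-all : (xs : List A) (k : ℕ) (p : A → Bool) →
    # (tuples xs k) (all p ∘ toList) ≡ # xs p ^ k
  #-tuples-all xs zero    p = refl
  #-tuples-all xs (suc k) p =
    trans (∑-cons-all xs (tuples xs k) _)
    (trans (∑-cong xs (λ x → trans (∑-cong (tuples xs k) (λ t → 𝟙-∧ (p x) (all p (toList t))))
                              (∑-*ˡ (tuples xs k) (𝟙 (p x)) _)))
    (trans (∑-*ʳ xs _ (𝟙 ∘ p)) (cong (# xs p *_) (#-tuples-all xs k p))))

  #-tuples : (xs : List A) (k : ℕ) → # (tuples xs k) (λ _ → true) ≡ length xs ^ k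
  #-tuples xs k = trans (#-cong (tuples xs k) (λ t → sym (all-true (toList t))))
    (trans (#-tuples-all xs k (λ _ → true)) (cong (_^ k) (#-true xs)))
    where
    all-true : ∀ t → all (λ _ → true) t ≡ true
    all-true []      = refl
    all-true (x ∷ t) = all-true t

  hitting : (Y p q : A → Bool) → List A → Bool
  hitting Y p q t = all Y t ∧ (all (not ∘ p) t ∧ any q t)

  hitting-cover : (Y p q : A → Bool) (t : List A) →
    𝟙 (all (λ y → Y y ∧ not (p y)) t) ≤
      𝟙 (hitting Y p q t) + 𝟙 (all (λ y → Y y ∧ not (q y)) t)
  hitting-cover Y p q t with any q t in eq
  ... | true  = ≤-trans (𝟙-mono (λ h → ∧-intro (proj₁ (unzip t h)) (∧-intro (proj₂ (unzip t h)) refl)))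
                        (m≤m+n _ _)
    where
    unzip : ∀ t → all (λ y → Y y ∧ not (p y)) t ≡ true → all Y t ≡ true × all (not ∘ p) t ≡ true
    unzip []      h = refl , refl
    unzip (y ∷ t) h with a , b ← ∧-elim {Y y ∧ not (p y)} h with c , d ← ∧-elim {Y y} a =
      ∧-intro c (proj₁ (unzip t b)) , ∧-intro d (proj₂ (unzip t b))
  ... | false = ≤-trans (𝟙-mono (miss t eq)) (m≤n+m _ _)
    where
    miss : ∀ t → any q t ≡ false → all (λ y → Y y ∧ not (p y)) t ≡ true →
      all (λ y → Y y ∧ not (q y)) t ≡ true
    miss []      e h = refl
    miss (y ∷ t) e h with q y
    ... | false with a , b ← ∧-elim {Y y ∧ not (p y)} h =
      ∧-intro (∧-intro (proj₁ (∧-elim {Y y} a)) refl) (miss t e b)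

  -- A union bound for a random tuple of length `m * k` from `Y`. It meets `p` with probability at
  -- most m k |p|/|Y| ≤ 1/(2v) by Bernoulli, and it misses `q` with probability at most (1 -
  -- 1/m)^(mk) ≤ 2^(-k) ≤ 1/(2v). So all but a fraction 1/v of the tuples avoid `p` and meet `q`.
  most-tuples-hit : (xs : List A) (Y p q : A → Bool) (m k v : ℕ) →
    0 < # xs Y → 0 < m → 2 * v ≤ 2 ^ k →
    2 * v * (m * k) * # xs (λ y → Y y ∧ p y) ≤ # xs Y →
    # xs Y ≤ m * # xs (λ y → Y y ∧ q y) →
    v * # xs Y ^ (m * k) ≤ v * # (tuples xs (m * k)) (hitting Y p q ∘ toList) + # xs Y ^ (m * k)
  most-tuples-hit xs Y p q m κ v 0<S 0<m 2v≤ few many = *-cancelˡ-≤′ 2 (s≤s z≤n) (begin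
    2 * (v * S ^ k)                              ≡⟨ assoc v (S ^ k) ⟩
    2 * v * S ^ k                                ≤⟨ avoid ⟩
    2 * v * a ^ k + S ^ k                        ≤⟨ +-monoˡ-≤ (S ^ k) (*-monoʳ-≤ (2 * v) cover) ⟩
    2 * v * (good + c ^ k) + S ^ k               ≡⟨ cong (_+ S ^ k) (*-distribˡ-+ (2 * v) good (c ^ k)) ⟩
    2 * v * good + 2 * v * c ^ k + S ^ k         ≤⟨ +-monoˡ-≤ (S ^ k) (+-monoʳ-≤ (2 * v * good)
                                                     (≤-trans (*-monoˡ-≤ (c ^ k) 2v≤) hit)) ⟩
    2 * v * good + S ^ k + S ^ k                 ≡⟨ collect v good (S ^ k) ⟩
    2 * (v * good + S ^ k)                       ∎)
    where
    open ≤-Reasoning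
    k = m * κ
    S = # xs Y
    a = # xs (λ y → Y y ∧ not (p y))
    b = # xs (λ y → Y y ∧ p y)
    c = # xs (λ y → Y y ∧ not (q y))
    d = # xs (λ y → Y y ∧ q y)
    good = # (tuples xs k) (hitting Y p q ∘ toList)
    S≡ab : a + b ≡ S
    S≡ab = trans (+-comm a b) (sym (#-split xs Y p))
    S≡cd : c + d ≡ S
    S≡cd = trans (+-comm c d) (sym (#-split xs Y q))
    cover : a ^ k ≤ good + c ^ k
    cover = begin
      a ^ k                                                ≡⟨ sym (#-tuples-all xs k _) ⟩
      # (tuples xs k) (all (λ y → Y y ∧ not (p y)) ∘ toList) ≤⟨ ∑-mono (tuples xs k) (hitting-cover Y p q ∘ toList) ⟩
      ∑ (tuples xs k) _                                    ≡⟨ ∑-+ (tuples xs k) _ _ ⟩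
      good + # (tuples xs k) (all (λ y → Y y ∧ not (q y)) ∘ toList) ≡⟨ cong (good +_) (#-tuples-all xs k _) ⟩
      good + c ^ k                                         ∎
    hit : 2 ^ κ * c ^ k ≤ S ^ k
    hit = subst (λ x → 2 ^ κ * c ^ k ≤ x ^ k) S≡cd
            (power-decay c d m κ 0<m (≤-trans (≤-reflexive S≡cd) many))
    assoc : ∀ v x → 2 * (v * x) ≡ 2 * v * x
    assoc = solve-∀
    collect : ∀ v g x → 2 * v * g + x + x ≡ 2 * (v * g + x)
    collect = solve-∀
    avoid : 2 * v * S ^ k ≤ 2 * v * a ^ k + S ^ k
    avoid = *-cancelˡ-≤′ S 0<S (begin
      S * (2 * v * S ^ k)                              ≡⟨ e₁ S v (S ^ k) ⟩
      2 * v * (S * S ^ k)                              ≤⟨ *-monoʳ-≤ (2 * v)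
        (subst (λ x → x * x ^ k ≤ x * a ^ k + k * b * x ^ k) S≡ab (bernoulli-≤ a b k)) ⟩
      2 * v * (S * a ^ k + k * b * S ^ k)              ≡⟨ e₂ v S (a ^ k) k b (S ^ k) ⟩
      S * (2 * v * a ^ k) + 2 * v * k * b * S ^ k      ≤⟨ +-monoʳ-≤ _ (*-monoˡ-≤ (S ^ k) few) ⟩
      S * (2 * v * a ^ k) + S * S ^ k                  ≡⟨ sym (*-distribˡ-+ S _ _) ⟩
      S * (2 * v * a ^ k + S ^ k)                      ∎)
      where
      e₁ : ∀ s v x → s * (2 * v * x) ≡ 2 * v * (s * x)
      e₁ = solve-∀
      e₂ : ∀ v s y k b x → 2 * v * (s * y + k * b * x) ≡ s * (2 * v * y) + 2 * v * k * b * x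
      e₂ = solve-∀

≤ᵇ-true : ∀ {m n} → m ≤ n → (m ≤ᵇ n) ≡ true
≤ᵇ-true {m} {n} h with m ≤ᵇ n in eq
... | true  = refl
... | false = contradiction (≤⇒≤ᵇ h) (subst (λ b → T b → _) (sym eq) (λ ()))

true-≤ᵇ : ∀ {m n} → (m ≤ᵇ n) ≡ true → m ≤ n
true-≤ᵇ {m} {n} e = ≤ᵇ⇒≤ m n (subst T (sym e) _)

false-≤ᵇ : ∀ {m n} → (m ≤ᵇ n) ≡ false → n < m
false-≤ᵇ {m} {n} e = ≰⇒> λ h → contradiction (trans (sym (≤ᵇ-true h)) e) λ ()

-- Markov's inequality for the fraction of z missed by t, with suc m in the role of 1/ε.
half-are-heavy : {A B : Set} (ts : List A) (zs : List B) (Y : A → Bool) (Z : B → Bool)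
  (r : A → B → Bool) (m : ℕ) → 0 < # zs Z →
  (∀ z → Z z ≡ true →
    2 * suc m * # ts Y ≤ 2 * suc m * # ts (λ t → Y t ∧ r t z) + # ts Y) →
  # ts Y ≤ 2 * # ts (λ t → Y t ∧ (m * # zs Z ≤ᵇ suc m * # zs (λ z → Z z ∧ r t z)))
half-are-heavy ts zs Y Z r m 0<Z h = *-cancelˡ-≤′ N 0<Z (+-cancelʳ-≤ (2 * (m * (N * total)) + N * total) _ _ (begin
  N * total + (2 * (m * (N * total)) + N * total)                ≡⟨ e₁ N total m ⟩
  N * (2 * suc m * total)                                ≤⟨ #-≥-const zs Z h ⟩
  ∑∈ zs Z (λ z → 2 * suc m * # ts (λ t → Y t ∧ r t z) + total) ≡⟨ split ⟩
  2 * suc m * Σc + N * total                             ≡⟨ cong (_+ N * total) (e₂ m Σc) ⟩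
  2 * (suc m * Σc) + N * total                           ≤⟨ +-monoˡ-≤ (N * total) (*-monoʳ-≤ 2 upper) ⟩
  2 * (total * (m * N) + Q * N) + N * total                  ≡⟨ e₃ N total m Q ⟩
  N * (2 * Q) + (2 * (m * (N * total)) + N * total)          ∎))
  where
  open ≤-Reasoning
  N = # zs Z
  total = # ts Y
  hits = λ t → # zs (λ z → Z z ∧ r t z)
  heavy = λ t → m * N ≤ᵇ suc m * hits t
  Q = # ts (λ t → Y t ∧ heavy t)
  Σc = ∑∈ ts Y hits
  split : ∑∈ zs Z (λ z → 2 * suc m * # ts (λ t → Y t ∧ r t z) + total) ≡ 2 * suc m * Σc + N * total
  split = trans (∑∈-+ zs Z _ _) (cong₂ _+_
    (trans (∑∈-*ˡ zs Z (2 * suc m) _)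
           (cong (2 * suc m *_) (sym (∑#-swap ts zs Y Z r))))
    (∑∈-const zs Z total))
  one : ∀ t → suc m * hits t ≤ m * N + 𝟙 (heavy t) * N
  one t with heavy t in eq
  ... | false = ≤-trans (<⇒≤ (false-≤ᵇ {m * N} eq)) (m≤m+n (m * N) 0)
  ... | true  = ≤-trans (*-monoʳ-≤ (suc m) (#-mono zs (λ z e → proj₁ (∧-elim {Z z} e))))
                        (≤-reflexive (e₄ m N))
    where
    e₄ : ∀ m n → suc m * n ≡ m * n + 1 * n
    e₄ = solve-∀
  upper : suc m * Σc ≤ total * (m * N) + Q * N
  upper = begin
    suc m * Σc                                         ≡⟨ sym (∑∈-*ˡ ts Y (suc m) hits) ⟩
    ∑∈ ts Y (λ t → suc m * hits t)                     ≤⟨ ∑∈-mono ts Y (λ t _ → one t) ⟩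
    ∑∈ ts Y (λ t → m * N + 𝟙 (heavy t) * N)            ≡⟨ ∑∈-+ ts Y _ _ ⟩
    ∑∈ ts Y (λ _ → m * N) + ∑∈ ts Y (λ t → 𝟙 (heavy t) * N) ≡⟨ cong₂ _+_ (∑∈-const ts Y _)
      (trans (∑-cong ts (λ t → sym (*-assoc (𝟙 (Y t)) (𝟙 (heavy t)) N)))
      (trans (∑-*ʳ ts N _) (cong (_* N) (sym (#-∧-∑ ts Y heavy))))) ⟩
    total * (m * N) + Q * N                                ∎
  e₁ : ∀ n t m → n * t + (2 * (m * (n * t)) + n * t) ≡ n * (2 * suc m * t)
  e₁ = solve-∀
  e₂ : ∀ m x → 2 * suc m * x ≡ 2 * (suc m * x)
  e₂ = solve-∀
  e₃ : ∀ n t m q → 2 * (t * (m * n) + q * n) + n * t ≡ n * (2 * q) + (2 * (m * (n * t)) + n * t)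
  e₃ = solve-∀

-- Common neighbours in families of bipartite graphs

#-∈ : {A : Set} (xs : List A) (p : A → Bool) {x : A} → x ∈ xs → p x ≡ true → 0 < # xs p
#-∈ (x ∷ xs) p (here refl) e rewrite e = s≤s z≤n
#-∈ (x ∷ xs) p (there h)   e = ≤-trans (#-∈ xs p h e) (m≤n+m _ _)

_==_ : ∀ {M} → Fin M → Fin M → Bool
x == y = does (x ≟ y)

==-refl : ∀ {M} (x : Fin M) → (x == x) ≡ true
==-refl x with x ≟ x
... | yes _ = refl
... | no h  = contradiction refl h

==-≡ : ∀ {M} {x y : Fin M} → (x == y) ≡ true → x ≡ y
==-≡ {x = x} {y} e with yes h ← x ≟ y = h

#-==-≤1 : ∀ {M n} (f : Fin n → Fin M) → (∀ {i j} → f i ≡ f j → i ≡ j) → (x : Fin M) →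
  # (tabulate f) (x ==_) ≤ 1
#-==-≤1 {n = zero}  f inj x = z≤n
#-==-≤1 {n = suc n} f inj x with x ≟ f zero
... | no _     = #-==-≤1 (f ∘ suc) (λ e → suc-injective (inj e)) x
... | yes refl = s≤s (≤-reflexive (none (f ∘ suc) (λ i e → contradiction (inj e) λ ())))
  where
  none : ∀ {M n} {x : Fin M} (g : Fin n → Fin M) → (∀ i → x ≡ g i → 1 ≡ 0) →
    # (tabulate g) (x ==_) ≡ 0
  none {n = zero}  g h = refl
  none {n = suc n} {x} g h with x ≟ g zero
  ... | yes e with () ← h zero e
  ... | no _  = none (g ∘ suc) (h ∘ suc)

#Fin : ∀ {M} → (Fin M → Bool) → ℕ
#Fin {M} = # (allFin M)

#Fin-true : ∀ {M} → #Fin {M} (λ _ → true) ≡ M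
#Fin-true {M} = trans (#-true (allFin M)) (length-tabulate {n = M} id)

#Fin-≤ : ∀ {M} (p : Fin M → Bool) → #Fin p ≤ M
#Fin-≤ {M} p = ≤-trans (#-mono (allFin M) (λ _ _ → refl)) (≤-reflexive #Fin-true)

insert : ∀ {M} → Fin M → (Fin M → Bool) → Fin M → Bool
insert x S y = S y ∨ (x == y)

insert-elim : ∀ {M} {x y : Fin M} (S : Fin M → Bool) → insert x S y ≡ true → S y ≡ true ⊎ x ≡ y
insert-elim {y = y} S e with S y
... | true  = inj₁ refl
... | false = inj₂ (==-≡ e)

#-insert : ∀ {M} (x : Fin M) (S : Fin M → Bool) → S x ≡ false → suc (#Fin S) ≤ #Fin (insert x S)
#-insert {M} x S new = begin
  1 + #Fin S                          ≤⟨ +-monoˡ-≤ (#Fin S) (#-∈ (allFin M) (x ==_) (∈-allFin x) (==-refl x)) ⟩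
  #Fin (x ==_) + #Fin S               ≡⟨ sym (∑-+ (allFin M) _ _) ⟩
  ∑ (allFin M) (λ y → 𝟙 (x == y) + 𝟙 (S y)) ≤⟨ ∑-mono (allFin M) one ⟩
  #Fin (insert x S)                   ∎
  where
  open ≤-Reasoning
  one : ∀ y → 𝟙 (x == y) + 𝟙 (S y) ≤ 𝟙 (insert x S y)
  one y with x ≟ y
  ... | yes refl rewrite new = ≤-refl
  ... | no _ with S y
  ...   | true  = ≤-refl
  ...   | false = z≤n

∨-𝟙 : ∀ a b → 𝟙 (a ∨ b) ≤ 𝟙 a + 𝟙 b
∨-𝟙 true  b = s≤s z≤n
∨-𝟙 false b = ≤-refl

∨-elim : ∀ {a b} → a ∨ b ≡ true → a ≡ true ⊎ b ≡ true
∨-elim {true}  e = inj₁ refl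
∨-elim {false} e = inj₂ e

#-∨ : {A : Set} (xs : List A) (p q : A → Bool) → # xs (λ x → p x ∨ q x) ≤ # xs p + # xs q
#-∨ xs p q = ≤-trans (∑-mono xs (λ x → ∨-𝟙 (p x) (q x))) (≤-reflexive (∑-+ xs _ _))

mem : ∀ {M} → List (Fin M) → Fin M → Bool
mem t y = any (λ x → x == y) t

used : ∀ {M} → List (List (Fin M)) → Fin M → Bool
used bs y = any (λ t → mem t y) bs

#-mem : ∀ {M} (t : List (Fin M)) → #Fin (mem t) ≤ length t
#-mem {M} []      = ≤-reflexive (∑-zero (allFin M))
#-mem {M} (x ∷ t) = ≤-trans (#-∨ (allFin M) (x ==_) (mem t)) (+-mono-≤ (#-==-≤1 id id x) (#-mem t))

#-used : ∀ {M ℓ} (bs : List (List (Fin M))) → All (λ t → length t ≡ ℓ) bs →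
  #Fin (used bs) ≤ length bs * ℓ
#-used {M} []  [] = ≤-reflexive (∑-zero (allFin M))
#-used {M} (t ∷ bs) (e ∷ es) = ≤-trans (#-∨ (allFin M) (mem t) (used bs))
  (+-mono-≤ (≤-trans (#-mem t) (≤-reflexive e)) (#-used bs es))

-- Here B is the neighbourhood of z in the current graph and P its blue part at x. The tuples are
-- listed newest first, and each has a neighbour of z that no earlier tuple contains.
Hits : ∀ {M} → (Fin M → Bool) → (Fin M → Bool) → List (List (Fin M)) → Set
Hits P B []       = ⊤
Hits P B (t ∷ bs) = all (not ∘ P) t ≡ true × any (λ y → B y ∧ not (used bs y)) t ≡ true × Hits P B bs

Hits-avoid : ∀ {M} (P B : Fin M → Bool) (bs : List (List (Fin M))) (y : Fin M) →
  Hits P B bs → used bs y ≡ true → P y ≡ false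
Hits-avoid P B (t ∷ bs) y (a , _ , h) u with ∨-elim {mem t y} u
... | inj₁ y∈t  = go t a y∈t
  where
  go : ∀ t → all (not ∘ P) t ≡ true → mem t y ≡ true → P y ≡ false
  go (x ∷ t) a m with b , c ← ∧-elim {not (P x)} a with ∨-elim {x == y} m
  ... | inj₁ e = subst (λ v → P v ≡ false) (==-≡ e) (not-true b)
  ... | inj₂ e = go t c e
... | inj₂ rest = Hits-avoid P B bs y h rest

module _ {M : ℕ} (B : Fin M → Fin M → Bool) (L : Fin M → Fin M → Fin M → Bool) where

  private
    V = allFin M

    BL : Fin M → Fin M → Fin M → Bool
    BL x z y = B y z ∧ L x y z

  module _ (X₀ : Fin M → Bool) (Y Z : Fin M → Fin M → Bool) (b κ s R μ n₀ : ℕ)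
    (M≡sR : M ≡ s * R) (0<X₀ : 0 < #Fin X₀) (0<s : 0 < s) (0<b : 0 < b) (0<μ : 0 < μ)
    (κ-large : 2 * (2 * suc μ) ≤ 2 ^ κ)
    (s-large : 2 * b * (n₀ * (2 * b * κ)) ≤ s)
    (Y-large : ∀ x → X₀ x ≡ true → s ≤ #Fin (Y x))
    (Z-large : ∀ x → X₀ x ≡ true → s ≤ #Fin (Z x))
    (sparse : ∀ x z → X₀ x ≡ true → Z x z ≡ true →
      2 * (2 * suc μ) * (2 * b * κ) * #Fin (λ y → Y x y ∧ BL x z y) ≤ #Fin (Y x))
    (dense : ∀ x z → X₀ x ≡ true → Z x z ≡ true →
      #Fin (Y x) ≤ b * #Fin (λ y → Y x y ∧ B y z))
    where

    private
      ℓ = 2 * b * κ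

    -- The tuples `bs` are shared by all surviving x in `X`, whereas each x keeps its own set `W x`
    -- of surviving z. The losses are very different: a round may divide `X` by 2 R^ℓ, but it leaves
    -- each `W x` a fraction 1 - 1/(μ+1).
    Blocks : ℕ → Set
    Blocks i = Σ (Fin M → Bool) λ X → Σ (Fin M → Fin M → Bool) λ W →
      Σ (List (List (Fin M))) λ bs →
        (∀ x → X x ≡ true → X₀ x ≡ true)
      × (∀ x z → X x ≡ true → W x z ≡ true → Z x z ≡ true × Hits (BL x z) (λ y → B y z) bs)
      × #Fin X₀ ≤ (2 * R ^ ℓ) ^ i * #Fin X
      × (∀ x → X x ≡ true → s * μ ^ i ≤ #Fin (W x) * suc μ ^ i)
      × length bs ≡ i × All (λ t → length t ≡ ℓ) bs

    next-block : ∀ i → i ≤ n₀ → Blocks i → Blocks (suc i)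
    next-block i i≤n₀ (X , W , bs , X⊆ , W⊆ , X-big , W-big , len , lens) =
      -- Each x finds at least half of the at least s^ℓ tuples inside `Y x` good, out of M^ℓ = (s
      -- R)^ℓ tuples altogether. Hence some tuple is good for a fraction 1/(2 R^ℓ) of `X`.
      extend (popular-neighbour V (tuples V ℓ) X (λ _ → true) good (s ^ ℓ) 2 0<X (^-pos ℓ 0<s) many-good)
      where
      open ≤-Reasoning
      hit : Fin M → Fin M → List (Fin M) → Bool
      hit x z t = all (not ∘ BL x z) t ∧ any (λ y → B y z ∧ not (used bs y)) t
      heavy : Fin M → List (Fin M) → Bool
      heavy x t = μ * #Fin (W x) ≤ᵇ suc μ * #Fin (λ z → W x z ∧ hit x z t)
      good : Fin M → Vec (Fin M) ℓ → Bool
      good x t = all (Y x) (toList t) ∧ heavy x (toList t)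
      0<X : 0 < #Fin X
      0<X = pos (#Fin X) X-big
        where
        pos : ∀ a → #Fin X₀ ≤ (2 * R ^ ℓ) ^ i * a → 0 < a
        pos zero    h = contradiction (≤-trans 0<X₀ (≤-trans h (≤-reflexive (*-zeroʳ ((2 * R ^ ℓ) ^ i))))) λ ()
        pos (suc a) h = s≤s z≤n
      0<W : ∀ x → X x ≡ true → 0 < #Fin (W x)
      0<W x h = pos (#Fin (W x)) (W-big x h)
        where
        pos : ∀ a → s * μ ^ i ≤ a * suc μ ^ i → 0 < a
        pos zero    h = contradiction (≤-trans (*-mono-≤ 0<s (^-pos i 0<μ)) h) λ ()
        pos (suc a) h = s≤s z≤n
      -- By `s-large` the at most n₀ ℓ vertices in earlier tuples are at most half of the guaranteed
      -- neighbours of z. Discarding them turns `b` into `2 * b`, and makes the neighbours later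
      -- taken from different tuples distinct.
      many : ∀ x z → X x ≡ true → W x z ≡ true →
        #Fin (Y x) ≤ 2 * b * #Fin (λ y → Y x y ∧ (B y z ∧ not (used bs y)))
      many x z hx hz = +-cancelʳ-≤ (2 * b * (n₀ * ℓ)) S (2 * b * q) (begin
        S + 2 * b * (n₀ * ℓ)             ≤⟨ +-monoʳ-≤ S (≤-trans s-large (Y-large x (X⊆ x hx))) ⟩
        S + S                            ≤⟨ +-mono-≤ le le ⟩
        b * a + b * a                    ≤⟨ +-mono-≤ (*-monoʳ-≤ b fresh) (*-monoʳ-≤ b fresh) ⟩
        b * (q + n₀ * ℓ) + b * (q + n₀ * ℓ) ≡⟨ collect b q (n₀ * ℓ) ⟩
        2 * b * q + 2 * b * (n₀ * ℓ)     ∎)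
        where
        S = #Fin (Y x)
        a = #Fin (λ y → Y x y ∧ B y z)
        q = #Fin (λ y → Y x y ∧ (B y z ∧ not (used bs y)))
        le = dense x z (X⊆ x hx) (proj₁ (W⊆ x z hx hz))
        collect : ∀ b q c → b * (q + c) + b * (q + c) ≡ 2 * b * q + 2 * b * c
        collect = solve-∀
        cover : ∀ y → 𝟙 (Y x y ∧ B y z) ≤ 𝟙 (Y x y ∧ (B y z ∧ not (used bs y))) + 𝟙 (used bs y)
        cover y with Y x y | B y z | used bs y
        ... | false | _     | _     = z≤n
        ... | true  | false | _     = z≤n
        ... | true  | true  | true  = ≤-refl
        ... | true  | true  | false = ≤-refl
        fresh : a ≤ q + n₀ * ℓ
        fresh = begin
          a                   ≤⟨ ∑-mono V cover ⟩
          ∑ V _               ≡⟨ ∑-+ V _ _ ⟩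
          q + #Fin (used bs)  ≤⟨ +-monoʳ-≤ q (≤-trans (#-used bs lens)
                                   (*-monoˡ-≤ ℓ (≤-trans (≤-reflexive len) i≤n₀))) ⟩
          q + n₀ * ℓ          ∎
      tuples-hit : ∀ x → X x ≡ true → ∀ z → W x z ≡ true →
        2 * suc μ * # (tuples V ℓ) (all (Y x) ∘ toList) ≤
          2 * suc μ * # (tuples V ℓ) (λ t → all (Y x) (toList t) ∧ hit x z (toList t))
          + # (tuples V ℓ) (all (Y x) ∘ toList)
      tuples-hit x hx z hz rewrite #-tuples-all V ℓ (Y x) =
        most-tuples-hit V (Y x) (BL x z) (λ y → B y z ∧ not (used bs y)) (2 * b) κ (2 * suc μ)
          (≤-trans 0<s (Y-large x (X⊆ x hx))) (*-mono-≤ (s≤s {n = 1} z≤n) 0<b) κ-large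
          (sparse x z (X⊆ x hx) (proj₁ (W⊆ x z hx hz))) (many x z hx hz)
      many-good : ∀ x → X x ≡ true → s ^ ℓ ≤ 2 * # (tuples V ℓ) (λ t → true ∧ good x t)
      many-good x hx = begin
        s ^ ℓ                                 ≤⟨ ^-monoˡ-≤ ℓ (Y-large x (X⊆ x hx)) ⟩
        #Fin (Y x) ^ ℓ                        ≡⟨ sym (#-tuples-all V ℓ (Y x)) ⟩
        # (tuples V ℓ) (all (Y x) ∘ toList)   ≤⟨ half-are-heavy (tuples V ℓ) V (all (Y x) ∘ toList) (W x)
                                                   (λ t z → hit x z (toList t)) μ (0<W x hx) (tuples-hit x hx) ⟩
        2 * # (tuples V ℓ) (good x)           ∎
      extend : (Σ (Vec (Fin M) ℓ) λ t → true ≡ true × #Fin X * s ^ ℓ ≤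
                 2 * (# (tuples V ℓ) (λ _ → true) * #Fin (λ x → X x ∧ good x t))) →
               Blocks (suc i)
      extend (t , _ , le) =
        X′ , W′ , toList t ∷ bs
        , (λ x h → X⊆ x (proj₁ (∧-elim {X x} h)))
        , (λ x z hx hz → let wz , hz′ = ∧-elim {W x z} hz
                             a , c = ∧-elim {all (not ∘ BL x z) (toList t)} hz′
                             z∈ , hits = W⊆ x z (proj₁ (∧-elim {X x} hx)) wz
                         in z∈ , a , c , hits)
        , X′-big , W′-big , cong suc len , length-toList t ∷ lens
        where
        X′ = λ x → X x ∧ good x t
        W′ = λ x z → W x z ∧ hit x z (toList t)
        shrink : #Fin X ≤ 2 * R ^ ℓ * #Fin X′
        shrink = *-cancelˡ-≤′ (s ^ ℓ) (^-pos ℓ 0<s) (begin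
          s ^ ℓ * #Fin X                       ≡⟨ *-comm (s ^ ℓ) (#Fin X) ⟩
          #Fin X * s ^ ℓ                       ≤⟨ le ⟩
          2 * (# (tuples V ℓ) (λ _ → true) * #Fin X′) ≡⟨ cong (λ c → 2 * (c * #Fin X′))
             (trans (#-tuples V ℓ) (trans (cong (_^ ℓ) (trans (length-tabulate id) M≡sR)) (^-distribʳ-* s R ℓ))) ⟩
          2 * (s ^ ℓ * R ^ ℓ * #Fin X′)        ≡⟨ assoc (s ^ ℓ) (R ^ ℓ) (#Fin X′) ⟩
          s ^ ℓ * (2 * R ^ ℓ * #Fin X′)        ∎)
          where
          assoc : ∀ a r x → 2 * (a * r * x) ≡ a * (2 * r * x)
          assoc = solve-∀
        X′-big : #Fin X₀ ≤ (2 * R ^ ℓ) ^ suc i * #Fin X′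
        X′-big = begin
          #Fin X₀                                        ≤⟨ X-big ⟩
          (2 * R ^ ℓ) ^ i * #Fin X                       ≤⟨ *-monoʳ-≤ ((2 * R ^ ℓ) ^ i) shrink ⟩
          (2 * R ^ ℓ) ^ i * (2 * R ^ ℓ * #Fin X′)        ≡⟨ assoc ((2 * R ^ ℓ) ^ i) (2 * R ^ ℓ) (#Fin X′) ⟩
          (2 * R ^ ℓ) ^ suc i * #Fin X′                  ∎
          where
          assoc : ∀ p r x → p * (r * x) ≡ r * p * x
          assoc = solve-∀
        W′-big : ∀ x → X′ x ≡ true → s * μ ^ suc i ≤ #Fin (W′ x) * suc μ ^ suc i
        W′-big x h with hx , hg ← ∧-elim {X x} h = begin
          s * (μ * μ ^ i)                      ≡⟨ assoc₁ s μ (μ ^ i) ⟩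
          μ * (s * μ ^ i)                      ≤⟨ *-monoʳ-≤ μ (W-big x hx) ⟩
          μ * (#Fin (W x) * suc μ ^ i)         ≡⟨ sym (*-assoc μ _ _) ⟩
          μ * #Fin (W x) * suc μ ^ i           ≤⟨ *-monoˡ-≤ (suc μ ^ i)
                                                   (true-≤ᵇ {μ * #Fin (W x)} (proj₂ (∧-elim {all (Y x) (toList t)} hg))) ⟩
          suc μ * #Fin (W′ x) * suc μ ^ i      ≡⟨ assoc₂ (suc μ) (#Fin (W′ x)) (suc μ ^ i) ⟩
          #Fin (W′ x) * suc μ ^ suc i          ∎
          where
          assoc₁ : ∀ s m p → s * (m * p) ≡ m * (s * p)
          assoc₁ = solve-∀
          assoc₂ : ∀ m w p → m * w * p ≡ w * (m * p)
          assoc₂ = solve-∀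

    blocks : ∀ i → i ≤ n₀ → Blocks i
    blocks zero    h = X₀ , Z , [] , (λ x e → e) , (λ x z hx hz → hz , tt)
      , ≤-reflexive (sym (+-identityʳ _))
      , (λ x hx → *-monoˡ-≤ 1 (Z-large x hx)) , refl , []
    blocks (suc i) h = next-block i (<⇒≤ h) (blocks i (<⇒≤ h))

factor-pos : ∀ {a} c d → 0 < a → a ≤ c * d → 0 < d
factor-pos c zero    0<a h = contradiction (≤-trans 0<a (≤-trans h (≤-reflexive (*-zeroʳ c)))) λ ()
factor-pos c (suc d) 0<a h = s≤s z≤n

#-∧-≤ˡ : {A : Set} (xs : List A) (p q : A → Bool) → # xs (λ x → p x ∧ q x) ≤ # xs p
#-∧-≤ˡ xs p q = #-mono xs (λ x h → proj₁ (∧-elim {p x} h))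

-- Greedy choice of the x. Keep only the z that lie in at least |X| ω/(2M) of the sets `W x`, half
-- the mean that is guaranteed. Since n₀ ≤ |X| ω/(4M), such a z always lies in at least |X| ω/(4M)
-- sets of unchosen x. So a popular x retains a fraction 1/(4G) of the surviving z.
common-neighbours : ∀ {M} (X : Fin M → Bool) (W : Fin M → Fin M → Bool) (ω G n₀ : ℕ) →
  0 < #Fin X → 0 < ω → M ≡ G * ω → 4 * (M * n₀) ≤ #Fin X * ω →
  (∀ x → X x ≡ true → ω ≤ #Fin (W x)) →
  Σ (Fin M → Bool) λ C → Σ (Fin M → Bool) λ Z →
    n₀ ≤ #Fin C × (∀ x → C x ≡ true → X x ≡ true)
    × (∀ x z → C x ≡ true → Z z ≡ true → W x z ≡ true)
    × ω ≤ 2 * (4 * G) ^ n₀ * #Fin Z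
common-neighbours {M} X W ω G n₀ 0<X 0<ω M≡Gω X-large W-large = result (choose n₀ ≤-refl)
  where
  open ≤-Reasoning
  V = allFin M
  deg = λ z → #Fin (λ x → X x ∧ W x z)
  Z₀ = λ z → #Fin X * ω ≤ᵇ 2 * M * deg z
  -- The degrees sum to at least |X| ω. The z outside `Z₀` contribute at most half of this, and each
  -- z inside contributes at most |X|.
  Z₀-large : ω ≤ 2 * #Fin Z₀
  Z₀-large = *-cancelˡ-≤′ M 0<M (*-cancelˡ-≤′ (#Fin X) 0<X (+-cancelʳ-≤ (M * (#Fin X * ω)) _ _ (begin
    #Fin X * (M * ω) + M * (#Fin X * ω)                 ≡⟨ e₁ (#Fin X) M ω ⟩
    2 * M * (#Fin X * ω)                                ≤⟨ *-monoʳ-≤ (2 * M) (#-≥-const V X W-large) ⟩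
    2 * M * ∑∈ V X (λ x → #Fin (W x))                   ≡⟨ cong (2 * M *_) (∑#-swap V V X (λ _ → true) W) ⟩
    2 * M * ∑∈ V (λ _ → true) deg                       ≡⟨ sym (∑∈-*ˡ V (λ _ → true) (2 * M) deg) ⟩
    ∑∈ V (λ _ → true) (λ z → 2 * M * deg z)             ≤⟨ ∑∈-mono V (λ _ → true) (λ z _ → one z) ⟩
    ∑∈ V (λ _ → true) (λ z → 𝟙 (Z₀ z) * (2 * M * #Fin X) + #Fin X * ω) ≡⟨ ∑∈-+ V (λ _ → true) _ _ ⟩
    ∑∈ V (λ _ → true) (λ z → 𝟙 (Z₀ z) * (2 * M * #Fin X)) + ∑∈ V (λ _ → true) (λ _ → #Fin X * ω)
      ≡⟨ cong₂ _+_ (trans (∑-cong V (λ z → +-identityʳ _)) (∑-*ʳ V _ (𝟙 ∘ Z₀)))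
                   (trans (∑∈-const V (λ _ → true) _) (cong (λ c → c * (#Fin X * ω)) (#Fin-true {M}))) ⟩
    #Fin Z₀ * (2 * M * #Fin X) + M * (#Fin X * ω)       ≡⟨ cong (_+ M * (#Fin X * ω)) (e₂ (#Fin Z₀) M (#Fin X)) ⟩
    #Fin X * (M * (2 * #Fin Z₀)) + M * (#Fin X * ω)     ∎)))
    where
    0<M : 0 < M
    0<M = ≤-trans 0<X (#Fin-≤ X)
    one : ∀ z → 2 * M * deg z ≤ 𝟙 (Z₀ z) * (2 * M * #Fin X) + #Fin X * ω
    one z with Z₀ z in eq
    ... | true  = ≤-trans (*-monoʳ-≤ (2 * M) (#-∧-≤ˡ V X (λ x → W x z)))
                    (≤-trans (≤-reflexive (sym (+-identityʳ _))) (m≤m+n _ _))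
    ... | false = <⇒≤ (false-≤ᵇ {#Fin X * ω} eq)
    e₁ : ∀ x m w → x * (m * w) + m * (x * w) ≡ 2 * m * (x * w)
    e₁ = solve-∀
    e₂ : ∀ z m x → z * (2 * m * x) ≡ x * (m * (2 * z))
    e₂ = solve-∀
  Chosen : ℕ → Set
  Chosen i = Σ (Fin M → Bool) λ C → Σ (Fin M → Bool) λ Z →
    i ≡ #Fin C × (∀ x → C x ≡ true → X x ≡ true)
    × (∀ x z → C x ≡ true → Z z ≡ true → W x z ≡ true)
    × (∀ z → Z z ≡ true → Z₀ z ≡ true)
    × ω ≤ 2 * (4 * G) ^ i * #Fin Z
  choose : ∀ i → i ≤ n₀ → Chosen i
  choose zero    h = (λ _ → false) , Z₀ , sym (∑-zero V) , (λ _ ()) , (λ _ _ ()) , (λ _ e → e) , Z₀-large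
  choose (suc i) h with choose i (<⇒≤ h)
  ... | C , Z , size , C⊆ , complete , Z⊆ , Z-large =
    extend (popular-neighbour V V Z X (λ z x → W x z ∧ not (C x)) (#Fin X * ω) (4 * M)
      (factor-pos (2 * (4 * G) ^ i) (#Fin Z) 0<ω Z-large) (*-mono-≤ 0<X 0<ω) fresh)
    where
    fresh : ∀ z → Z z ≡ true → #Fin X * ω ≤ 4 * M * #Fin (λ x → X x ∧ (W x z ∧ not (C x)))
    fresh z hz = +-cancelʳ-≤ (#Fin X * ω) (#Fin X * ω) _ (begin
      #Fin X * ω + #Fin X * ω           ≤⟨ +-mono-≤ le le ⟩
      2 * M * deg z + 2 * M * deg z     ≤⟨ +-mono-≤ (*-monoʳ-≤ (2 * M) split) (*-monoʳ-≤ (2 * M) split) ⟩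
      2 * M * (q + n₀) + 2 * M * (q + n₀) ≡⟨ e₁ M q n₀ ⟩
      4 * M * q + 4 * (M * n₀)          ≤⟨ +-monoʳ-≤ (4 * M * q) X-large ⟩
      4 * M * q + #Fin X * ω            ∎)
      where
      q = #Fin (λ x → X x ∧ (W x z ∧ not (C x)))
      le : #Fin X * ω ≤ 2 * M * deg z
      le = true-≤ᵇ {#Fin X * ω} (Z⊆ z hz)
      cover : ∀ x → 𝟙 (X x ∧ W x z) ≤ 𝟙 (X x ∧ (W x z ∧ not (C x))) + 𝟙 (C x)
      cover x with X x | W x z | C x
      ... | false | _     | _     = z≤n
      ... | true  | false | _     = z≤n
      ... | true  | true  | true  = ≤-refl
      ... | true  | true  | false = ≤-refl
      split : deg z ≤ q + n₀
      split = begin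
        deg z         ≤⟨ ∑-mono V cover ⟩
        ∑ V _         ≡⟨ ∑-+ V _ _ ⟩
        q + #Fin C    ≤⟨ +-monoʳ-≤ q (≤-trans (≤-reflexive (sym size)) (<⇒≤ h)) ⟩
        q + n₀        ∎
      e₁ : ∀ m q n → 2 * m * (q + n) + 2 * m * (q + n) ≡ 4 * m * q + 4 * (m * n)
      e₁ = solve-∀
    extend : (∃[ x ] X x ≡ true × #Fin Z * (#Fin X * ω) ≤
               4 * M * (#Fin X * #Fin (λ z → Z z ∧ (W x z ∧ not (C x))))) → Chosen (suc i)
    extend (x , hx , le) = insert x C , Z′ , size′ , ⊆′ , complete′ , (λ z hz → Z⊆ z (proj₁ (∧-elim {Z z} hz))) , large′
      where
      Z′ = λ z → Z z ∧ (W x z ∧ not (C x))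
      shrink : #Fin Z ≤ 4 * G * #Fin Z′
      shrink = *-cancelˡ-≤′ (#Fin X * ω) (*-mono-≤ 0<X 0<ω) (begin
        #Fin X * ω * #Fin Z                ≡⟨ *-comm (#Fin X * ω) (#Fin Z) ⟩
        #Fin Z * (#Fin X * ω)              ≤⟨ le ⟩
        4 * M * (#Fin X * #Fin Z′)         ≡⟨ cong (λ m → 4 * m * (#Fin X * #Fin Z′)) M≡Gω ⟩
        4 * (G * ω) * (#Fin X * #Fin Z′)   ≡⟨ e₁ G ω (#Fin X) (#Fin Z′) ⟩
        #Fin X * ω * (4 * G * #Fin Z′)     ∎)
        where
        e₁ : ∀ g w x z → 4 * (g * w) * (x * z) ≡ x * w * (4 * g * z)
        e₁ = solve-∀
      large′ : ω ≤ 2 * (4 * G) ^ suc i * #Fin Z′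
      large′ = begin
        ω                                          ≤⟨ Z-large ⟩
        2 * (4 * G) ^ i * #Fin Z                   ≤⟨ *-monoʳ-≤ (2 * (4 * G) ^ i) shrink ⟩
        2 * (4 * G) ^ i * (4 * G * #Fin Z′)        ≡⟨ e₁ ((4 * G) ^ i) (4 * G) (#Fin Z′) ⟩
        2 * (4 * G) ^ suc i * #Fin Z′              ∎
        where
        e₁ : ∀ p g z → 2 * p * (g * z) ≡ 2 * (g * p) * z
        e₁ = solve-∀
      -- The lower bound on `Z′` makes it nonempty, and membership in `Z′` includes `not (C x)`.
      new : C x ≡ false
      new with z , hz ← #-witness V Z′ (factor-pos (2 * (4 * G) ^ suc i) (#Fin Z′) 0<ω large′) =
        not-true (proj₂ (∧-elim {W x z} (proj₂ (∧-elim {Z z} hz))))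
      size′ : suc i ≡ #Fin (insert x C)
      size′ = ≤-antisym (≤-trans (s≤s (≤-reflexive size)) (#-insert x C new))
        (begin
          #Fin (insert x C)        ≤⟨ #-∨ V C (x ==_) ⟩
          #Fin C + #Fin (x ==_)    ≤⟨ +-mono-≤ (≤-reflexive (sym size)) (#-==-≤1 id id x) ⟩
          i + 1                    ≡⟨ +-comm i 1 ⟩
          suc i                    ∎)
      ⊆′ : ∀ y → insert x C y ≡ true → X y ≡ true
      ⊆′ y h with insert-elim {x = x} C h
      ... | inj₁ c    = C⊆ y c
      ... | inj₂ refl = hx
      complete′ : ∀ y z → insert x C y ≡ true → Z′ z ≡ true → W y z ≡ true
      complete′ y z h hz with insert-elim {x = x} C h | ∧-elim {Z z} hz
      ... | inj₁ c    | z∈ , _  = complete y z c z∈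
      ... | inj₂ refl | _ , rel = proj₁ (∧-elim {W y z} rel)
  result : Chosen n₀ → _
  result (C , Z , size , C⊆ , complete , _ , large) = C , Z , ≤-reflexive size , C⊆ , complete , large

-- The recursion treats the oldest tuple first. Every surviving z has a neighbour in the current
-- tuple that lies in no older one, and one of the at most ℓ candidates serves a fraction 1/ℓ of the
-- z. The inclusion of `Y` in the used vertices is carried along to show that this candidate is new.
common-hits : ∀ {M} (B : Fin M → Fin M → Bool) (P : Fin M → Fin M → Bool) (ℓ : ℕ)
  (Z : Fin M → Bool) → 0 < #Fin Z →
  (bs : List (List (Fin M))) → All (λ t → length t ≡ ℓ) bs →
  (∀ z → Z z ≡ true → Hits (P z) (λ y → B y z) bs) →
  Σ (Fin M → Bool) λ Y → Σ (Fin M → Bool) λ Z′ →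
    length bs ≤ #Fin Y × #Fin Z ≤ ℓ ^ length bs * #Fin Z′
    × (∀ z → Z′ z ≡ true → Z z ≡ true)
    × (∀ y z → Y y ≡ true → Z′ z ≡ true → B y z ≡ true)
    × (∀ y → Y y ≡ true → used bs y ≡ true)
common-hits B P ℓ Z 0<Z [] [] hits = (λ _ → false) , Z , z≤n , ≤-reflexive (sym (+-identityʳ _))
  , (λ _ e → e) , (λ _ _ ()) , (λ _ ())
common-hits {M} B P ℓ Z 0<Z (t ∷ bs) (lt ∷ lbs) hits
  with common-hits B P ℓ Z 0<Z bs lbs (λ z hz → proj₂ (proj₂ (hits z hz)))
... | Y , Z₁ , Y-size , Z₁-size , Z₁⊆ , complete , Y⊆ =
  extend (popular-neighbour V t Z₁ fresh (λ z y → B y z) 1 1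
    (factor-pos (ℓ ^ length bs) (#Fin Z₁) 0<Z Z₁-size) (s≤s z≤n) nonempty)
  where
  open ≤-Reasoning
  V = allFin M
  inTail = used bs
  fresh = λ y → not (inTail y) ∧ mem t y
  nonempty : ∀ z → Z₁ z ≡ true → 1 ≤ 1 * # t (λ y → fresh y ∧ B y z)
  nonempty z hz = ≤-trans (go t (λ y e → e) (proj₁ (proj₂ (hits z (Z₁⊆ z hz))))) (≤-reflexive (sym (+-identityʳ _)))
    where
    go : ∀ t′ → (∀ y → mem t′ y ≡ true → mem t y ≡ true) →
      any (λ y → B y z ∧ not (inTail y)) t′ ≡ true → 0 < # t′ (λ y → fresh y ∧ B y z)
    go (y ∷ t′) sub e with ∨-elim {B y z ∧ not (inTail y)} e
    ... | inj₂ e′ = ≤-trans (go t′ (λ v h → sub v (∨-introʳ (y == v) h)) e′) (m≤n+m _ _)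
      where
      ∨-introʳ : ∀ a {b} → b ≡ true → a ∨ b ≡ true
      ∨-introʳ true  h = refl
      ∨-introʳ false h = h
    ... | inj₁ e′ with b , f ← ∧-elim {B y z} e′ =
      ≤-trans (≤-reflexive (sym (cong 𝟙 (∧-intro (∧-intro f (sub y (here-mem y t′))) b)))) (m≤m+n _ _)
      where
      here-mem : ∀ y t′ → mem (y ∷ t′) y ≡ true
      here-mem y t′ rewrite ==-refl y = refl
  extend : _ → _
  extend (y , hy , le) = insert y Y , Z₂
    , ≤-trans (s≤s Y-size) (#-insert y Y new)
    , shrink
    , (λ z hz → Z₁⊆ z (proj₁ (∧-elim {Z₁ z} hz)))
    , complete′ , ⊆′
    where
    Z₂ = λ z → Z₁ z ∧ B y z
    y∉ = not-true (proj₁ (∧-elim {not (inTail y)} hy))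
    new : Y y ≡ false
    new with Y y in e
    ... | false = refl
    ... | true  = contradiction (trans (sym (Y⊆ y e)) y∉) λ ()
    shrink : #Fin Z ≤ ℓ ^ suc (length bs) * #Fin Z₂
    shrink = begin
      #Fin Z                                  ≤⟨ Z₁-size ⟩
      ℓ ^ length bs * #Fin Z₁                 ≤⟨ *-monoʳ-≤ (ℓ ^ length bs) (begin
        #Fin Z₁                                 ≡⟨ sym (*-identityʳ _) ⟩
        #Fin Z₁ * 1                             ≤⟨ le ⟩
        1 * (# t fresh * #Fin Z₂)               ≡⟨ +-identityʳ _ ⟩
        # t fresh * #Fin Z₂                     ≤⟨ *-monoˡ-≤ (#Fin Z₂) (≤-trans (#-mono t (λ _ _ → refl))
                                                     (≤-reflexive (trans (#-true t) lt))) ⟩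
        ℓ * #Fin Z₂                             ∎) ⟩
      ℓ ^ length bs * (ℓ * #Fin Z₂)           ≡⟨ assoc (ℓ ^ length bs) ℓ (#Fin Z₂) ⟩
      ℓ ^ suc (length bs) * #Fin Z₂           ∎
      where
      assoc : ∀ p l z → p * (l * z) ≡ l * p * z
      assoc = solve-∀
    complete′ : ∀ v z → insert y Y v ≡ true → Z₂ z ≡ true → B v z ≡ true
    complete′ v z h hz with insert-elim {x = y} Y h | ∧-elim {Z₁ z} hz
    ... | inj₁ c    | z∈ , _  = complete v z c z∈
    ... | inj₂ refl | _ , rel = rel
    ⊆′ : ∀ v → insert y Y v ≡ true → used (t ∷ bs) v ≡ true
    ⊆′ v h with insert-elim {x = y} Y h
    ... | inj₂ refl rewrite proj₂ (∧-elim {not (inTail y)} hy) = refl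
    ... | inj₁ c with mem t v
    ...   | true  = refl
    ...   | false = Y⊆ v c

-- Dense graphs and vertices with sparse links

edges : ∀ {M} → (Fin M → Fin M → Bool) → (Fin M → Bool) → (Fin M → Bool) → ℕ
edges {M} B Y Z = ∑∈ (allFin M) Y (λ y → #Fin (λ z → Z z ∧ B y z))

-- The density bound is 1/b; working with its inverse keeps everything in the natural numbers.
Dense : ∀ {M} → ℕ → ℕ → (Fin M → Fin M → Bool) → Set
Dense s b B = ∀ Y Z → s ≤ #Fin Y → s ≤ #Fin Z → #Fin Y * #Fin Z ≤ b * edges B Y Z

SparsePair : ∀ {M} → ℕ → ℕ → (Fin M → Fin M → Bool) → (Fin M → Bool) → (Fin M → Bool) → Set
SparsePair s b B Y Z = s ≤ #Fin Y × s ≤ #Fin Z × b * edges B Y Z < #Fin Y * #Fin Z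

-- The witnesses are vectors rather than predicates, so that a finite search can find them.
NotDense : ∀ {M} → ℕ → ℕ → (Fin M → Fin M → Bool) → Set
NotDense {M} s b B = Σ (Subset M) λ Y → Σ (Subset M) λ Z → SparsePair s b B (lookup Y) (lookup Z)

abstract
  notDense? : ∀ {M} s b (B : Fin M → Fin M → Bool) → Dec (NotDense s b B)
  notDense? s b B = anySubset? λ Y → anySubset? λ Z →
    (s ≤? _) ×-dec ((s ≤? _) ×-dec (b * edges B (lookup Y) (lookup Z) <? _))

¬notDense : ∀ {M} s b (B : Fin M → Fin M → Bool) → ¬ NotDense s b B → Dense s b B
¬notDense {M} s b B h Y Z Y-large Z-large = ≮⇒≥ λ sparse →
  h (Vec.tabulate Y , Vec.tabulate Z
    , subst (s ≤_) #Y Y-large , subst (s ≤_) #Z Z-large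
    , subst (λ e → b * e < _) e≡ (subst (b * edges B Y Z <_) (cong₂ _*_ #Y #Z) sparse))
  where
  #Y : #Fin Y ≡ #Fin (lookup (Vec.tabulate Y))
  #Y = #-cong (allFin M) (λ i → sym (lookup∘tabulate Y i))
  #Z : #Fin Z ≡ #Fin (lookup (Vec.tabulate Z))
  #Z = #-cong (allFin M) (λ i → sym (lookup∘tabulate Z i))
  e≡ : edges B Y Z ≡ edges B (lookup (Vec.tabulate Y)) (lookup (Vec.tabulate Z))
  e≡ = ∑-cong (allFin M) λ y → cong₂ _*_ (cong 𝟙 (sym (lookup∘tabulate Y y)))
    (#-cong (allFin M) λ z → cong (_∧ B y z) (sym (lookup∘tabulate Z z)))

module _ {M : ℕ} (B L : Fin M → Fin M → Bool) (b c σ : ℕ) (0<σ : 0 < σ) (dense : Dense σ b B)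
  (Y Z : Fin M → Bool) where

  private
    V = allFin M
    BL = λ y z → B y z ∧ L y z
    sparseAt denseAt : Fin M → Bool
    sparseAt z = c * #Fin (λ y → Y y ∧ BL y z) ≤ᵇ #Fin Y
    denseAt z = #Fin Y ≤ᵇ b * #Fin (λ y → Y y ∧ B y z)

  typical : Fin M → Bool
  typical z = (Z z ∧ sparseAt z) ∧ denseAt z

  -- At most half of `Z` sees too much of `BL`, since the pair is sparse. At most σ vertices of `Z`
  -- see too little of `B`, since a larger set of them would violate the density of `B` against `Y`.
  -- From |Z| ≥ 4σ at least 2σ - σ vertices remain; this is why the size threshold grows by a factor
  -- 4 whenever a graph `B` is cut down.
  typical-large : SparsePair (4 * σ) (2 * c) BL Y Z → σ ≤ #Fin typical
  typical-large (Y-large , Z-large , sparse) = *-cancelˡ-≤′ 2 (s≤s z≤n)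
    (+-cancelʳ-≤ (2 * σ + #Fin Z) _ _ (begin
      2 * σ + (2 * σ + #Fin Z)                    ≡⟨ e₁ σ (#Fin Z) ⟩
      4 * σ + #Fin Z                              ≤⟨ +-monoˡ-≤ (#Fin Z) Z-large ⟩
      #Fin Z + #Fin Z                             ≡⟨ cong (λ n → n + n) split ⟩
      #Fin typical + Q₂ + Q₁ + (#Fin typical + Q₂ + Q₁) ≡⟨ e₂ (#Fin typical) Q₁ Q₂ ⟩
      2 * #Fin typical + (2 * Q₂ + 2 * Q₁)        ≤⟨ +-monoʳ-≤ (2 * #Fin typical)
                                                       (+-mono-≤ (*-monoʳ-≤ 2 few-isolated) few-rich) ⟩
      2 * #Fin typical + (2 * σ + #Fin Z)         ∎))
    where
    open ≤-Reasoning
    isolated rich : Fin M → Bool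
    isolated z = (Z z ∧ sparseAt z) ∧ not (denseAt z)
    rich z = Z z ∧ not (sparseAt z)
    Q₁ = #Fin rich
    Q₂ = #Fin isolated
    split : #Fin Z ≡ #Fin typical + Q₂ + Q₁
    split = trans (#-split V Z sparseAt) (cong (_+ Q₁) (#-split V _ denseAt))
    0<Y : 0 < #Fin Y
    0<Y = ≤-trans 0<σ (≤-trans (m≤n*m σ 4) Y-large)
    e₁ : ∀ s z → 2 * s + (2 * s + z) ≡ 4 * s + z
    e₁ = solve-∀
    e₂ : ∀ t q r → t + r + q + (t + r + q) ≡ 2 * t + (2 * r + 2 * q)
    e₂ = solve-∀
    few-rich : 2 * Q₁ ≤ #Fin Z
    few-rich = *-cancelˡ-≤′ (#Fin Y) 0<Y (begin
      #Fin Y * (2 * Q₁)                               ≡⟨ e₃ (#Fin Y) Q₁ ⟩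
      2 * (Q₁ * #Fin Y)                               ≤⟨ *-monoʳ-≤ 2 (#-≥-const V rich λ z h →
        <⇒≤ (false-≤ᵇ {c * #Fin (λ y → Y y ∧ BL y z)} (not-true (proj₂ (∧-elim {Z z} h))))) ⟩
      2 * ∑∈ V rich (λ z → c * #Fin (λ y → Y y ∧ BL y z)) ≡⟨ cong (2 *_) (∑∈-*ˡ V rich c _) ⟩
      2 * (c * ∑∈ V rich (λ z → #Fin (λ y → Y y ∧ BL y z))) ≤⟨ *-monoʳ-≤ 2 (*-monoʳ-≤ c (∑-mono V λ z →
        *-monoˡ-≤ _ (𝟙-mono {rich z} {Z z} λ h → proj₁ (∧-elim {Z z} h)))) ⟩
      2 * (c * ∑∈ V Z (λ z → #Fin (λ y → Y y ∧ BL y z))) ≡⟨ cong (λ e → 2 * (c * e)) (sym (∑#-swap V V Y Z BL)) ⟩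
      2 * (c * edges BL Y Z)                          ≡⟨ sym (*-assoc 2 c _) ⟩
      2 * c * edges BL Y Z                            ≤⟨ <⇒≤ sparse ⟩
      #Fin Y * #Fin Z                                 ∎)
      where
      e₃ : ∀ y q → y * (2 * q) ≡ 2 * (q * y)
      e₃ = solve-∀
    few-isolated : Q₂ ≤ σ
    few-isolated = ≮⇒≥ λ σ<Q₂ → n≮n (Q₂ * #Fin Y) (begin-strict
      Q₂ * #Fin Y                                          ≡⟨ *-comm Q₂ (#Fin Y) ⟩
      #Fin Y * Q₂                                          ≤⟨ dense Y isolated (≤-trans (m≤n*m σ 4) Y-large) (<⇒≤ σ<Q₂) ⟩
      b * edges B Y isolated                               ≡⟨ cong (b *_) (∑#-swap V V Y isolated B) ⟩
      b * ∑∈ V isolated (λ z → #Fin (λ y → Y y ∧ B y z))   ≡⟨ sym (∑∈-*ˡ V isolated b _) ⟩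
      ∑∈ V isolated (λ z → b * #Fin (λ y → Y y ∧ B y z))   <⟨ +-monoˡ-< _ (≤-trans 0<σ (<⇒≤ σ<Q₂)) ⟩
      Q₂ + ∑∈ V isolated (λ z → b * #Fin (λ y → Y y ∧ B y z)) ≡⟨ cong (_+ ∑∈ V isolated _)
        (sym (trans (∑∈-const V isolated 1) (*-identityʳ Q₂))) ⟩
      ∑∈ V isolated (λ _ → 1) + ∑∈ V isolated (λ z → b * #Fin (λ y → Y y ∧ B y z)) ≡⟨ sym (∑∈-+ V isolated _ _) ⟩
      ∑∈ V isolated (λ z → suc (b * #Fin (λ y → Y y ∧ B y z))) ≤⟨ #-≤-const V isolated (λ z h →
        false-≤ᵇ {#Fin Y} (not-true (proj₂ (∧-elim {Z z ∧ sparseAt z} h)))) ⟩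
      Q₂ * #Fin Y                                          ∎)

  typical-sparse : ∀ z → typical z ≡ true → c * #Fin (λ y → Y y ∧ BL y z) ≤ #Fin Y
  typical-sparse z h = true-≤ᵇ {c * #Fin (λ y → Y y ∧ BL y z)} (proj₂ (∧-elim {Z z} (proj₁ (∧-elim {Z z ∧ sparseAt z} h))))

  typical-dense : ∀ z → typical z ≡ true → #Fin Y ≤ b * #Fin (λ y → Y y ∧ B y z)
  typical-dense z h = true-≤ᵇ {#Fin Y} (proj₂ (∧-elim {Z z ∧ sparseAt z} h))

-- `L` is the indicator of blue, so `false` means red.
RedBox : ∀ {M} → ℕ → (Fin M → Fin M → Fin M → Bool) → Set
RedBox {M} n L = Σ (Fin M → Bool) λ X → Σ (Fin M → Bool) λ Y → Σ (Fin M → Bool) λ Z →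
  n ≤ #Fin X × n ≤ #Fin Y × n ≤ #Fin Z
  × (∀ x y z → X x ≡ true → Y y ≡ true → Z z ≡ true → L x y z ≡ false)

module _ {M : ℕ} (B : Fin M → Fin M → Bool) (L : Fin M → Fin M → Fin M → Bool) (b w σ : ℕ) where

  BadAt : Fin M → Set
  BadAt x = NotDense (4 * σ) (b * w) (λ y z → B y z ∧ L x y z)

  badAt? : ∀ x → Dec (BadAt x)
  badAt? x = notDense? (4 * σ) (b * w) (λ y z → B y z ∧ L x y z)

  bad : Fin M → Bool
  bad x = does (badAt? x)

  -- After n₀ = h g tuples each `W x` still has at least s (1 - 1/(2h))^(hg) ≥ s/2^g = ω vertices.
  -- Relative to the whole block this is a fraction 1/G with G = 2^g R. Intersecting over n₀
  -- vertices x then costs 2 (4G)^n₀, and fixing one neighbour per tuple costs ℓ^n₀; `ω-large`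
  -- leaves n₀ vertices z after both.
  many-bad⇒redBox : ∀ κ s ω R μ h g n₀ → M ≡ s * R → s ≡ 2 ^ g * ω → n₀ ≡ h * g → suc μ ≡ 2 * h →
    w ≡ 8 * (2 * suc μ) * κ → 2 * (2 * suc μ) ≤ 2 ^ κ →
    0 < ω → 0 < b → 0 < μ → 0 < h → 0 < n₀ → s ≤ σ →
    2 * b * (n₀ * (2 * b * κ)) ≤ s →
    2 * (4 * (2 ^ g * R)) ^ n₀ * (2 * b * κ) ^ n₀ * n₀ ≤ ω →
    0 < R →
    4 * (2 ^ g * R) * n₀ * (2 * R ^ (2 * b * κ)) ^ n₀ ≤ #Fin bad →
    Dense σ b B → RedBox n₀ L
  many-bad⇒redBox κ s ω R μ h g n₀ M≡ s≡ n₀≡ μ≡ w≡ κ-large 0<ω 0<b 0<μ 0<h 0<n₀ s≤σ s-large ω-large 0<R bad-large dense =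
    assemble (blocks B L bad Y Z b κ s R μ n₀ M≡ 0<bad 0<s 0<b 0<μ κ-large s-large
      Y-large Z-large sparse-at dense-at
      n₀ ≤-refl)
    where
    open ≤-Reasoning
    ℓ = 2 * b * κ
    G = 2 ^ g * R
    c = 2 * (2 * suc μ) * ℓ
    V = allFin M
    0<2^g = ^-pos {2} g (s≤s z≤n)
    0<s : 0 < s
    0<s = subst (0 <_) (sym s≡) (*-mono-≤ 0<2^g 0<ω)
    0<σ = ≤-trans 0<s s≤σ
    0<bad : 0 < #Fin bad
    0<bad = ≤-trans (*-mono-≤ (*-mono-≤ (*-mono-≤ (s≤s {n = 3} z≤n) (*-mono-≤ 0<2^g 0<R)) 0<n₀)
      (^-pos n₀ (*-mono-≤ (s≤s {n = 1} z≤n) (^-pos ℓ 0<R)))) bad-large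
    pick : ∀ x → Dec (BadAt x) →
      (Fin M → Bool) × (Fin M → Bool)
    pick x (yes (Y , Z , _)) = lookup Y , typical B (L x) b c σ 0<σ dense (lookup Y) (lookup Z)
    pick x (no _)            = (λ _ → false) , (λ _ → false)
    Y Z : Fin M → Fin M → Bool
    Y x = proj₁ (pick x (badAt? x))
    Z x = proj₂ (pick x (badAt? x))
    props : ∀ x → bad x ≡ true → s ≤ #Fin (Y x) × s ≤ #Fin (Z x)
      × (∀ z → Z x z ≡ true → c * #Fin (λ y → Y x y ∧ (B y z ∧ L x y z)) ≤ #Fin (Y x))
      × (∀ z → Z x z ≡ true → #Fin (Y x) ≤ b * #Fin (λ y → Y x y ∧ B y z))
    props x e = go (badAt? x) e
      where
      -- Here `c` is twice 2(μ+1) times ℓ, as the union bound over the ℓ entries of a tuple demands.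
      -- The further factor 2 pays for the half of `Z` given up in `typical-large`. This equation is
      -- the origin of `w`.
      bw≡2c : b * w ≡ 2 * c
      bw≡2c = trans (cong (b *_) w≡) (e₁ b (suc μ) κ)
        where
        e₁ : ∀ b m k → b * (8 * (2 * m) * k) ≡ 2 * (2 * (2 * m) * (2 * b * k))
        e₁ = solve-∀
      go : (d : Dec (NotDense (4 * σ) (b * w) (λ y z → B y z ∧ L x y z))) → does d ≡ true →
        let Y = proj₁ (pick x d) ; Z = proj₂ (pick x d) in
        s ≤ #Fin Y × s ≤ #Fin Z
        × (∀ z → Z z ≡ true → c * #Fin (λ y → Y y ∧ (B y z ∧ L x y z)) ≤ #Fin Y)
        × (∀ z → Z z ≡ true → #Fin Y ≤ b * #Fin (λ y → Y y ∧ B y z))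
      go (yes (Y , Z , sp@(Y-large , _ , _))) _ = ≤-trans s≤σ (≤-trans (m≤n*m σ 4) Y-large)
        , ≤-trans s≤σ (typical-large B (L x) b c σ 0<σ dense (lookup Y) (lookup Z)
            (subst (λ t → SparsePair (4 * σ) t (λ y z → B y z ∧ L x y z) (lookup Y) (lookup Z)) bw≡2c sp))
        , typical-sparse B (L x) b c σ 0<σ dense (lookup Y) (lookup Z)
        , typical-dense B (L x) b c σ 0<σ dense (lookup Y) (lookup Z)
    Y-large : ∀ x → bad x ≡ true → s ≤ #Fin (Y x)
    Y-large x e = proj₁ (props x e)
    Z-large : ∀ x → bad x ≡ true → s ≤ #Fin (Z x)
    Z-large x e = proj₁ (proj₂ (props x e))
    sparse-at : ∀ x z → bad x ≡ true → Z x z ≡ true →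
      c * #Fin (λ y → Y x y ∧ (B y z ∧ L x y z)) ≤ #Fin (Y x)
    sparse-at x z e = proj₁ (proj₂ (proj₂ (props x e))) z
    dense-at : ∀ x z → bad x ≡ true → Z x z ≡ true →
      #Fin (Y x) ≤ b * #Fin (λ y → Y x y ∧ B y z)
    dense-at x z e = proj₂ (proj₂ (proj₂ (props x e))) z
    M≡Gω : M ≡ G * ω
    M≡Gω = trans M≡ (trans (cong (_* R) s≡) (e₂ (2 ^ g) ω R))
      where
      e₂ : ∀ p w r → p * w * r ≡ p * r * w
      e₂ = solve-∀
    assemble : Blocks B L bad Y Z b κ s R μ n₀ M≡ 0<bad 0<s 0<b 0<μ κ-large s-large
      Y-large Z-large sparse-at dense-at n₀ →
      RedBox n₀ L
    assemble (X , W , bs , X⊆ , W⊆ , X-big , W-big , len , lens) =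
      box (common-neighbours X W ω G n₀ (factor-pos ((2 * R ^ ℓ) ^ n₀) (#Fin X) 0<bad X-big) 0<ω M≡Gω X-large W-large)
      where
      X-large : 4 * (M * n₀) ≤ #Fin X * ω
      X-large = begin
        4 * (M * n₀)         ≡⟨ cong (λ m → 4 * (m * n₀)) M≡Gω ⟩
        4 * (G * ω * n₀)     ≡⟨ e₃ G ω n₀ ⟩
        4 * G * n₀ * ω       ≤⟨ *-monoˡ-≤ ω (*-cancelˡ-≤′ p 0<p (begin
          p * (4 * G * n₀)     ≡⟨ *-comm p (4 * G * n₀) ⟩
          4 * G * n₀ * p       ≤⟨ bad-large ⟩
          #Fin bad             ≤⟨ X-big ⟩
          p * #Fin X           ∎)) ⟩
        #Fin X * ω           ∎
        where
        p = (2 * R ^ ℓ) ^ n₀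
        0<p : 0 < p
        0<p = ^-pos n₀ (*-mono-≤ (s≤s {n = 1} z≤n) (^-pos ℓ 0<R))
        e₃ : ∀ g w n → 4 * (g * w * n) ≡ 4 * g * n * w
        e₃ = solve-∀
      W-large : ∀ x → X x ≡ true → ω ≤ #Fin (W x)
      W-large x hx = *-cancelˡ-≤′ (2 ^ g) 0<2^g (*-cancelˡ-≤′ (μ ^ n₀) (^-pos n₀ 0<μ) (begin
        μ ^ n₀ * (2 ^ g * ω)               ≡⟨ cong (μ ^ n₀ *_) (sym s≡) ⟩
        μ ^ n₀ * s                         ≡⟨ *-comm (μ ^ n₀) s ⟩
        s * μ ^ n₀                         ≤⟨ W-big x hx ⟩
        #Fin (W x) * suc μ ^ n₀            ≤⟨ *-monoʳ-≤ (#Fin (W x)) decay ⟩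
        #Fin (W x) * (2 ^ g * μ ^ n₀)      ≡⟨ e₄ (#Fin (W x)) (2 ^ g) (μ ^ n₀) ⟩
        μ ^ n₀ * (2 ^ g * #Fin (W x))      ∎))
        where
        decay : suc μ ^ n₀ ≤ 2 ^ g * μ ^ n₀
        decay = subst (λ n → suc μ ^ n ≤ 2 ^ g * μ ^ n) (sym n₀≡) (slow-decay μ h g 0<h μ≡)
        e₄ : ∀ w p m → w * (p * m) ≡ m * (p * w)
        e₄ = solve-∀
      box : _ → RedBox n₀ L
      -- Any single x₀ in `C` suffices to find the y: being a `B`-neighbour does not involve x, and
      -- for every x in `C` the tuples avoid the blue part.
      box (C , Zc , C-size , C⊆ , complete , Zc-size)
        with x₀ , hx₀ ← #-witness V C (≤-trans 0<n₀ C-size)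
        with common-hits B (λ z y → B y z ∧ L x₀ y z) ℓ Zc (factor-pos (2 * (4 * G) ^ n₀) (#Fin Zc) 0<ω Zc-size) bs lens
               (λ z hz → proj₂ (W⊆ x₀ z (C⊆ x₀ hx₀) (complete x₀ z hx₀ hz)))
      ... | Y₁ , Z₁ , Y₁-size , Z₁-size , Z₁⊆ , inB , Y₁⊆ =
        C , Y₁ , Z₁ , C-size , subst (_≤ #Fin Y₁) len Y₁-size , Z₁-large , isRed
        where
        Z₁-large : n₀ ≤ #Fin Z₁
        Z₁-large = *-cancelˡ-≤′ q 0<q (begin
          q * n₀                                   ≤⟨ ω-large ⟩
          ω                                        ≤⟨ Zc-size ⟩
          2 * (4 * G) ^ n₀ * #Fin Zc               ≤⟨ *-monoʳ-≤ (2 * (4 * G) ^ n₀)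
             (subst (λ i → #Fin Zc ≤ ℓ ^ i * #Fin Z₁) len Z₁-size) ⟩
          2 * (4 * G) ^ n₀ * (ℓ ^ n₀ * #Fin Z₁)    ≡⟨ sym (*-assoc (2 * (4 * G) ^ n₀) (ℓ ^ n₀) (#Fin Z₁)) ⟩
          q * #Fin Z₁                              ∎)
          where
          q = 2 * (4 * G) ^ n₀ * ℓ ^ n₀
          0<κ : ∀ k → 2 ≤ 2 ^ k → 0 < k
          0<κ zero    (s≤s ())
          0<κ (suc k) _ = s≤s z≤n
          0<q : 0 < q
          0<q = *-mono-≤ (*-mono-≤ (s≤s {n = 1} z≤n) (^-pos n₀ (*-mono-≤ (s≤s {n = 3} z≤n) (*-mono-≤ 0<2^g 0<R))))
            (^-pos n₀ (*-mono-≤ (*-mono-≤ (s≤s {n = 1} z≤n) 0<b) (0<κ κ (≤-trans (*-monoʳ-≤ 2 (s≤s z≤n)) κ-large))))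
        isRed : ∀ x y z → C x ≡ true → Y₁ y ≡ true → Z₁ z ≡ true → L x y z ≡ false
        isRed x y z hx hy hz = subst (λ t → t ∧ L x y z ≡ false) (inB y z hy hz)
          (Hits-avoid (λ v → B v z ∧ L x v z) (λ v → B v z) bs y
            (proj₂ (W⊆ x z (C⊆ x hx) (complete x z hx (Z₁⊆ z hz)))) (Y₁⊆ y hy))

-- The greedy embedding

∑-∈ : {A : Set} (xs : List A) (f : A → ℕ) {x : A} → x ∈ xs → f x ≤ ∑ xs f
∑-∈ (x ∷ xs) f (here refl) = m≤m+n _ _
∑-∈ (x ∷ xs) f (there h)   = ≤-trans (∑-∈ xs f h) (m≤n+m _ _)

∑-allFin : ∀ {n} (f : Fin (suc n) → ℕ) → ∑ (allFin (suc n)) f ≡ f zero + ∑ (allFin n) (f ∘ suc)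
∑-allFin {n} f = cong (f zero +_)
  (trans (cong (λ xs → ∑ xs f) (sym (map-tabulate {n = n} id suc))) (∑-map suc (allFin n) f))

prefix : ∀ {n} → ℕ → (Fin n → ℕ) → ℕ
prefix {n} i f = ∑ (allFin n) (λ a → 𝟙 (toℕ a <ᵇ i) * f a)

prefix-zero : ∀ {n} (f : Fin n → ℕ) → prefix 0 f ≡ 0
prefix-zero {n} f = ∑-zero (allFin n)

prefix-suc : ∀ {n} (i : Fin n) (f : Fin n → ℕ) → prefix (suc (toℕ i)) f ≡ prefix (toℕ i) f + f i
prefix-suc {suc n} zero f = begin
  prefix 1 f                                     ≡⟨ ∑-allFin (λ a → 𝟙 (toℕ a <ᵇ 1) * f a) ⟩
  f zero + 0 + ∑ (allFin n) (λ _ → 0)            ≡⟨ cong₂ _+_ (+-identityʳ (f zero)) (∑-zero (allFin n)) ⟩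
  f zero + 0                                     ≡⟨ +-comm (f zero) 0 ⟩
  0 + f zero                                     ≡⟨ cong (_+ f zero) (sym (prefix-zero f)) ⟩
  prefix 0 f + f zero                            ∎
  where open ≡-Reasoning
prefix-suc {suc n} (suc i) f = begin
  prefix (suc (suc (toℕ i))) f                   ≡⟨ ∑-allFin (λ a → 𝟙 (toℕ a <ᵇ suc (suc (toℕ i))) * f a) ⟩
  f zero + 0 + prefix (suc (toℕ i)) (f ∘ suc)    ≡⟨ cong (f zero + 0 +_) (prefix-suc i (f ∘ suc)) ⟩
  f zero + 0 + (prefix (toℕ i) (f ∘ suc) + f (suc i)) ≡⟨ sym (+-assoc (f zero + 0) _ _) ⟩
  f zero + 0 + prefix (toℕ i) (f ∘ suc) + f (suc i) ≡⟨ cong (_+ f (suc i)) (sym (∑-allFin (λ a → 𝟙 (toℕ a <ᵇ suc (toℕ i)) * f a))) ⟩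
  prefix (suc (toℕ i)) f + f (suc i)             ∎
  where open ≡-Reasoning

<ᵇ-true : ∀ {m n} → m < n → (m <ᵇ n) ≡ true
<ᵇ-true {m} {n} h with m <ᵇ n in eq
... | true  = refl
... | false = contradiction (<⇒<ᵇ h) (subst (λ b → ¬ T b) (sym eq) (λ ()))

true-<ᵇ : ∀ {m n} → (m <ᵇ n) ≡ true → m < n
true-<ᵇ {m} {n} e = <ᵇ⇒< m n (subst T (sym e) _)

prefix-mono : ∀ {n} {i k} → i ≤ k → (f : Fin n → ℕ) → prefix i f ≤ prefix k f
prefix-mono {n} i≤k f = ∑-mono (allFin n) λ a → *-monoˡ-≤ (f a)
  (𝟙-mono λ e → <ᵇ-true (≤-trans (true-<ᵇ {toℕ a} e) i≤k))

union-bound : {A : Set} (xs : List A) (S : A → Bool) (cost : A → ℕ) →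
  ∑ xs cost < # xs S → ∃[ x ] S x ≡ true × cost x ≡ 0
union-bound xs S cost h with #-witness xs (λ x → S x ∧ (cost x ≡ᵇ 0)) (+-cancelʳ-< (∑ xs cost) 0 _ (begin-strict
  ∑ xs cost                                              <⟨ h ⟩
  # xs S                                                 ≤⟨ ∑-mono xs one ⟩
  ∑ xs (λ x → 𝟙 (S x ∧ (cost x ≡ᵇ 0)) + cost x)          ≡⟨ ∑-+ xs _ _ ⟩
  # xs (λ x → S x ∧ (cost x ≡ᵇ 0)) + ∑ xs cost           ∎))
  where
  open ≤-Reasoning
  one : ∀ x → 𝟙 (S x) ≤ 𝟙 (S x ∧ (cost x ≡ᵇ 0)) + cost x
  one x with S x | cost x
  ... | false | _     = z≤n
  ... | true  | zero  = ≤-refl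
  ... | true  | suc _ = s≤s z≤n
... | x , e with p , q ← ∧-elim {S x} e = x , p , zero-cost (cost x) q
  where
  zero-cost : ∀ c → (c ≡ᵇ 0) ≡ true → c ≡ 0
  zero-cost zero    _ = refl

-- If more than `s` vertices had too small a degree into `Z`, they would form with `Z` a pair
-- violating density.
dense-degrees : ∀ {M} (B : Fin M → Fin M → Bool) (s b : ℕ) (Z : Fin M → Bool) →
  0 < s → Dense s b B → s ≤ #Fin Z →
  #Fin (λ x → not (#Fin Z ≤ᵇ b * #Fin (λ z → Z z ∧ B x z))) ≤ s
dense-degrees {M} B s b Z 0<s dense Z-large = ≮⇒≥ λ s<Y → n≮n (#Fin Y * #Fin Z) (begin-strict
  #Fin Y * #Fin Z                                   ≤⟨ dense Y Z (<⇒≤ s<Y) Z-large ⟩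
  b * edges B Y Z                                   ≡⟨ sym (∑∈-*ˡ V Y b _) ⟩
  ∑∈ V Y (λ y → b * #Fin (λ z → Z z ∧ B y z))       <⟨ +-monoˡ-< _ (≤-trans 0<s (<⇒≤ s<Y)) ⟩
  #Fin Y + ∑∈ V Y (λ y → b * #Fin (λ z → Z z ∧ B y z)) ≡⟨ cong (_+ ∑∈ V Y (λ y → b * #Fin (λ z → Z z ∧ B y z)))
    (sym (trans (∑∈-const V Y 1) (*-identityʳ (#Fin Y)))) ⟩
  ∑∈ V Y (λ _ → 1) + ∑∈ V Y (λ y → b * #Fin (λ z → Z z ∧ B y z)) ≡⟨ sym (∑∈-+ V Y _ _) ⟩
  ∑∈ V Y (λ y → suc (b * #Fin (λ z → Z z ∧ B y z))) ≤⟨ #-≤-const V Y (λ y h → false-≤ᵇ {#Fin Z} (not-true h)) ⟩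
  #Fin Y * #Fin Z                                   ∎)
  where
  open ≤-Reasoning
  V = allFin M
  Y = λ x → not (#Fin Z ≤ᵇ b * #Fin (λ z → Z z ∧ B x z))

module _ {n : ℕ} (E : Fin n → Fin n → Fin n → Bool) where

  -- These count edges only for i ≤ b < c and i ≤ c, since E a b c is consulted only for a < b < c.
  multiplicity : ℕ → Fin n → Fin n → ℕ
  multiplicity i b c = prefix i (λ a → 𝟙 (E a b c))

  load : ℕ → Fin n → ℕ
  load i c = prefix i (λ b → multiplicity (toℕ b) b c)

  -- The edges counted on the left have c as their last vertex and so belong to its load. Hence a
  -- bound on the load also bounds every exponent of a density.
  multiplicity≤load : ∀ {i} b c → i ≤ toℕ b → toℕ b < toℕ c → multiplicity i b c ≤ load (toℕ c) c
  multiplicity≤load {i} b c i≤b b<c = begin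
    multiplicity i b c           ≤⟨ prefix-mono i≤b (λ a → 𝟙 (E a b c)) ⟩
    multiplicity (toℕ b) b c     ≤⟨ m≤n+m _ (load (toℕ b) c) ⟩
    load (toℕ b) c + multiplicity (toℕ b) b c ≡⟨ sym (prefix-suc b (λ b → multiplicity (toℕ b) b c)) ⟩
    load (suc (toℕ b)) c         ≤⟨ prefix-mono b<c (λ b → multiplicity (toℕ b) b c) ⟩
    load (toℕ c) c               ∎
    where open ≤-Reasoning

module _ {n M : ℕ} (E : Fin n → Fin n → Fin n → Bool)
  (blue : Fin n → Fin n → Fin n → Fin M → Fin M → Fin M → Bool) (d s w n₀ τ K : ℕ) where

  RedEdge : Set
  RedEdge = ∃[ a ] ∃[ b ] ∃[ c ] toℕ a < toℕ b × toℕ b < toℕ c × E a b c ≡ true × RedBox n₀ (blue a b c)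

  private
    mult = multiplicity E
    ld = load E
    Bad = λ (B : Fin M → Fin M → Bool) L j → bad B L (w ^ j) w (4 ^ j * s)

  -- `f` is meaningful on ranks below i, and `S` and `B` on ranks from i on. Edges with one embedded
  -- vertex are recorded in `B` through `link`, those with two in `S` through `candidate`.
  -- Accordingly the density of `B b c` is governed by the number of edges of the first kind over b,
  -- c, and the size of `S c` by the number of edges of the second kind ending in c, which is its
  -- load.
  record Embedded (i : ℕ) : Set where
    field
      f : Fin n → Fin M
      S : Fin n → Fin M → Bool
      B : Fin n → Fin n → Fin M → Fin M → Bool
      link : ∀ a b c y z → toℕ a < i → i ≤ toℕ b → toℕ b < toℕ c → E a b c ≡ true →
        B b c y z ≡ true → blue a b c (f a) y z ≡ true
      dense : ∀ b c → i ≤ toℕ b → toℕ b < toℕ c →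
        Dense (4 ^ mult i b c * s) (w ^ mult i b c) (B b c)
      large : ∀ c → i ≤ toℕ c → M ≤ w ^ ld i c * #Fin (S c)
      candidate : ∀ a b c z → toℕ a < toℕ b → toℕ b < i → i ≤ toℕ c → E a b c ≡ true →
        S c z ≡ true → blue a b c (f a) (f b) z ≡ true
      embedded : ∀ a b c → toℕ a < toℕ b → toℕ b < toℕ c → toℕ c < i → E a b c ≡ true →
        blue a b c (f a) (f b) (f c) ≡ true

  module _ (0<s : 0 < s) (0<w : 0 < w) (0<M : 0 < M)
    (redBox : ∀ j → j ≤ d → (B : Fin M → Fin M → Bool) (L : Fin M → Fin M → Fin M → Bool) →
      Dense (4 ^ j * s) (w ^ j) B → τ ≤ #Fin (Bad B L j) → RedBox n₀ L)
    (load≤d : ∀ c → ld (toℕ c) c ≤ d)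
    (degree≤d : ∀ b → ∑ (allFin n) (λ c → 𝟙 (toℕ b <ᵇ toℕ c) * mult (toℕ b) b c) ≤ d)
    (K-size : w ^ d * K ≤ M) (K-large : d * (4 ^ d * s) + n * (n * τ) < K) (s≤K : 4 ^ d * s ≤ K)
    where

    start : Embedded 0
    start = record
      -- A placeholder: before anything is embedded no field constrains `f`.
      { f = λ _ → fromℕ< 0<M
      ; S = λ _ _ → true
      ; B = λ _ _ _ _ → true
      ; link = λ _ _ _ _ _ ()
      ; dense = λ b c _ _ → complete (mult 0 b c) (prefix-zero (λ a → 𝟙 (E a b c)))
      ; large = λ c _ → ≤-trans (≤-reflexive (sym (#Fin-true {M})))
          (≤-trans (≤-reflexive (sym (+-identityʳ _))) (≤-reflexive (cong (λ k → w ^ k * #Fin {M} (λ _ → true))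
            (sym (prefix-zero (λ b → mult (toℕ b) b c))))))
      ; candidate = λ _ _ _ _ _ ()
      ; embedded = λ _ _ _ _ _ ()
      }
      where
      complete : ∀ j → j ≡ 0 → Dense (4 ^ j * s) (w ^ j) (λ _ _ → true)
      complete j refl Y Z _ _ = ≤-trans
        (#-≥-const (allFin M) Y (λ y _ → #-mono (allFin M) (λ z e → ∧-intro e refl)))
        (≤-reflexive (sym (+-identityʳ _)))

    module _ (i : Fin n) (st : Embedded (toℕ i)) where

      open Embedded st
      private
        ι = toℕ i
        V = allFin M
        F = allFin n
        m = λ c → mult ι i c

      next : Fin M → Fin n → Fin M
      next x v = if v == i then x else f v

      next-here : ∀ x → next x i ≡ x
      next-here x rewrite ==-refl i = refl

      next-old : ∀ x v → toℕ v < ι → next x v ≡ f v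
      next-old x v v<i with v ≟ i
      ... | yes refl = contradiction v<i (n≮n _)
      ... | no _     = refl

      Good : Fin M → Set
      Good x = S i x ≡ true
        × (∀ c → ι < toℕ c → 0 < m c → #Fin (S c) ≤ w ^ m c * #Fin (λ z → S c z ∧ B i c x z))
        × (∀ b c → ι < toℕ b → toℕ b < toℕ c → E i b c ≡ true →
            Dense (4 ^ suc (mult ι b c) * s) (w ^ suc (mult ι b c)) (λ y z → B b c y z ∧ blue i b c x y z))

      extend : ∀ x → Good x → Embedded (suc ι)
      extend x (x∈S , shrinks , densities) = record
        { f = next x
        ; S = S′
        ; B = B′
        ; link = link′
        ; dense = dense′
        ; large = large′
        ; candidate = candidate′
        ; embedded = embedded′
        }
        where
        S′ : Fin n → Fin M → Bool
        -- If `m c` is 0, no edge through i and c has an embedded third vertex, so c need not be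
        -- restricted. The multiplicities add up to at most d, so at most d of the later vertices c
        -- are restricted.
        S′ c z = if 0 <ᵇ m c then S c z ∧ B i c x z else S c z
        B′ : Fin n → Fin n → Fin M → Fin M → Bool
        B′ b c y z = if E i b c then B b c y z ∧ blue i b c x y z else B b c y z
        old⊎new : ∀ a → toℕ a < suc ι → toℕ a < ι ⊎ a ≡ i
        old⊎new a (s≤s h) with m≤n⇒m<n∨m≡n h
        ... | inj₁ lt = inj₁ lt
        ... | inj₂ eq = inj₂ (toℕ-injective eq)
        link′ : ∀ a b c y z → toℕ a < suc ι → suc ι ≤ toℕ b → toℕ b < toℕ c → E a b c ≡ true →
          B′ b c y z ≡ true → blue a b c (next x a) y z ≡ true
        link′ a b c y z a< b> b<c e h with old⊎new a a<
        ... | inj₂ refl rewrite e | next-here x = proj₂ (∧-elim {B b c y z} h)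
        ... | inj₁ a<i  rewrite next-old x a a<i = link a b c y z a<i (<⇒≤ b>) b<c e inB
          where
          inB : B b c y z ≡ true
          inB with E i b c
          ... | true  = proj₁ (∧-elim {B b c y z} h)
          ... | false = h
        dense′ : ∀ b c → suc ι ≤ toℕ b → toℕ b < toℕ c →
          Dense (4 ^ mult (suc ι) b c * s) (w ^ mult (suc ι) b c) (B′ b c)
        dense′ b c b> b<c = subst (λ k → Dense (4 ^ k * s) (w ^ k) (B′ b c))
          (sym (prefix-suc i (λ a → 𝟙 (E a b c)))) step
          where
          step : Dense (4 ^ (mult ι b c + 𝟙 (E i b c)) * s) (w ^ (mult ι b c + 𝟙 (E i b c))) (B′ b c)
          step with E i b c in eq
          ... | true  rewrite +-comm (mult ι b c) 1 = densities b c b> b<c eq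
          ... | false rewrite +-identityʳ (mult ι b c) = dense b c (<⇒≤ b>) b<c
        large′ : ∀ c → suc ι ≤ toℕ c → M ≤ w ^ ld (suc ι) c * #Fin (S′ c)
        large′ c c> = begin
          M                                          ≤⟨ large c (<⇒≤ c>) ⟩
          w ^ ld ι c * #Fin (S c)                    ≤⟨ *-monoʳ-≤ (w ^ ld ι c) step ⟩
          w ^ ld ι c * (w ^ m c * #Fin (S′ c))       ≡⟨ sym (*-assoc (w ^ ld ι c) (w ^ m c) _) ⟩
          w ^ ld ι c * w ^ m c * #Fin (S′ c)         ≡⟨ cong (_* #Fin (S′ c)) (sym (^-distribˡ-+-* w (ld ι c) (m c))) ⟩
          w ^ (ld ι c + m c) * #Fin (S′ c)           ≡⟨ cong (λ k → w ^ k * #Fin (S′ c))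
                                                          (sym (prefix-suc i (λ b → mult (toℕ b) b c))) ⟩
          w ^ ld (suc ι) c * #Fin (S′ c)             ∎
          where
          open ≤-Reasoning
          step : #Fin (S c) ≤ w ^ m c * #Fin (S′ c)
          step with 0 <ᵇ m c in eq
          ... | true  = shrinks c c> (true-<ᵇ eq)
          ... | false = m≤n*m _ (w ^ m c) {{>-nonZero (^-pos (m c) 0<w)}}
        candidate′ : ∀ a b c z → toℕ a < toℕ b → toℕ b < suc ι → suc ι ≤ toℕ c → E a b c ≡ true →
          S′ c z ≡ true → blue a b c (next x a) (next x b) z ≡ true
        candidate′ a b c z a<b b< c> e h with old⊎new b b<
        ... | inj₁ b<i rewrite next-old x b b<i | next-old x a (<-trans a<b b<i) =
          candidate a b c z a<b b<i (<⇒≤ c>) e inS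
          where
          inS : S c z ≡ true
          inS with 0 <ᵇ m c
          ... | true  = proj₁ (∧-elim {S c z} h)
          ... | false = h
        ... | inj₂ refl rewrite next-here x | next-old x a a<b =
          link a i c x z a<b ≤-refl c> e (proj₂ (∧-elim {S c z} (subst (λ t → (if t then S c z ∧ B i c x z else S c z) ≡ true) (<ᵇ-true positive) h)))
          where
          -- The edge on a, i, c is itself counted by `m c`, so `S′ c` is in its restricted form.
          positive : 0 < m c
          positive = ≤-trans (≤-reflexive (sym (trans (cong₂ (λ p q → 𝟙 p * 𝟙 q) (<ᵇ-true a<b) e) refl)))
            (∑-∈ F (λ a → 𝟙 (toℕ a <ᵇ ι) * 𝟙 (E a i c)) (∈-allFin a))
        embedded′ : ∀ a b c → toℕ a < toℕ b → toℕ b < toℕ c → toℕ c < suc ι → E a b c ≡ true →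
          blue a b c (next x a) (next x b) (next x c) ≡ true
        embedded′ a b c a<b b<c c< e with old⊎new c c<
        ... | inj₁ c<i rewrite next-old x c c<i | next-old x b (<-trans b<c c<i)
                             | next-old x a (<-trans a<b (<-trans b<c c<i)) = embedded a b c a<b b<c c<i e
        ... | inj₂ refl rewrite next-here x | next-old x b b<c | next-old x a (<-trans a<b b<c) =
          candidate a b i x a<b b<c ≤-refl e x∈S

      size : ∀ c → ι ≤ toℕ c → K ≤ #Fin (S c)
      size c i≤c = *-cancelˡ-≤′ (w ^ d) (^-pos d 0<w) (begin
        w ^ d * K                     ≤⟨ K-size ⟩
        M                             ≤⟨ large c i≤c ⟩
        w ^ ld ι c * #Fin (S c)       ≤⟨ *-monoˡ-≤ (#Fin (S c)) (^-monoʳ-≤ w {{>-nonZero 0<w}}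
                                           (≤-trans (prefix-mono i≤c (λ b → mult (toℕ b) b c)) (load≤d c))) ⟩
        w ^ d * #Fin (S c)            ∎)
        where
        open ≤-Reasoning

      narrow : Fin M → Fin n → Bool
      narrow x c = (0 <ᵇ m c) ∧ ((ι <ᵇ toℕ c) ∧ not (#Fin (S c) ≤ᵇ w ^ m c * #Fin (λ z → S c z ∧ B i c x z)))

      poor : Fin M → Fin n → Fin n → Bool
      poor x b c = ((ι <ᵇ toℕ b) ∧ ((toℕ b <ᵇ toℕ c) ∧ E i b c)) ∧ Bad (B b c) (blue i b c) (mult ι b c) x

      m≤d : ∀ c → ι < toℕ c → m c ≤ d
      m≤d c i<c = ≤-trans (multiplicity≤load E i c ≤-refl i<c) (load≤d c)

      4^-mono : ∀ {j} → j ≤ d → 4 ^ j * s ≤ 4 ^ d * s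
      4^-mono j≤d = *-monoˡ-≤ s (^-monoʳ-≤ 4 j≤d)

      -- A vertex c with positive `m c` excludes at most 4^d s choices. Weighting this by `m c` lets
      -- the bound on the middle degree cap the total by d instead of n.
      narrow-few : ∑ F (λ c → #Fin (λ x → narrow x c)) ≤ d * (4 ^ d * s)
      narrow-few = begin
        ∑ F (λ c → #Fin (λ x → narrow x c))                            ≤⟨ ∑-mono F one ⟩
        ∑ F (λ c → 𝟙 (ι <ᵇ toℕ c) * m c * (4 ^ d * s))                 ≡⟨ ∑-*ʳ F (4 ^ d * s) _ ⟩
        ∑ F (λ c → 𝟙 (ι <ᵇ toℕ c) * m c) * (4 ^ d * s)                 ≤⟨ *-monoˡ-≤ (4 ^ d * s) (degree≤d i) ⟩
        d * (4 ^ d * s)                                                ∎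
        where
        open ≤-Reasoning
        one : ∀ c → #Fin (λ x → narrow x c) ≤ 𝟙 (ι <ᵇ toℕ c) * m c * (4 ^ d * s)
        one c with 0 <ᵇ m c in pos | ι <ᵇ toℕ c in lt
        ... | false | _     = ≤-trans (≤-reflexive (∑-zero V)) z≤n
        ... | true  | false = ≤-trans (≤-reflexive (∑-zero V)) z≤n
        ... | true  | true  = ≤-trans
          (dense-degrees (B i c) (4 ^ m c * s) (w ^ m c) (S c) (*-mono-≤ (^-pos (m c) (s≤s z≤n)) 0<s)
            (dense i c ≤-refl i<c) (≤-trans (4^-mono (m≤d c i<c)) (≤-trans s≤K (size c (<⇒≤ i<c)))))
          (≤-trans (4^-mono (m≤d c i<c))
            (≤-trans (m≤n*m (4 ^ d * s) (m c) {{>-nonZero (true-<ᵇ pos)}})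
              (≤-reflexive (cong (_* (4 ^ d * s)) (sym (+-identityʳ (m c)))))))
          where
          i<c = true-<ᵇ lt

      cost : Fin M → ℕ
      cost x = ∑ F (λ c → 𝟙 (narrow x c)) + ∑ F (λ b → ∑ F (λ c → 𝟙 (poor x b c)))

      -- The two kinds of failure balance differently: sets of order s are excluded by low degrees,
      -- but only d times, while the pairs b, c may fail n² times and are allowed only τ vertices
      -- each.
      choose : (∀ b c → #Fin (λ x → poor x b c) ≤ τ) → ∃[ x ] Good x
      choose few with union-bound V (S i) cost (begin-strict
        ∑ V cost                                                       ≡⟨ ∑-+ V _ _ ⟩
        ∑ V (λ x → ∑ F (λ c → 𝟙 (narrow x c))) + ∑ V (λ x → ∑ F (λ b → ∑ F (λ c → 𝟙 (poor x b c))))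
          ≡⟨ cong₂ _+_ (∑-swap V F _) (trans (∑-swap V F _) (∑-cong F (λ b → ∑-swap V F _))) ⟩
        ∑ F (λ c → #Fin (λ x → narrow x c)) + ∑ F (λ b → ∑ F (λ c → #Fin (λ x → poor x b c)))
          ≤⟨ +-mono-≤ narrow-few (∑-mono F (λ b → ∑-mono F (few b))) ⟩
        d * (4 ^ d * s) + ∑ F (λ b → ∑ F (λ c → τ))                    ≡⟨ cong (d * (4 ^ d * s) +_)
          (trans (∑-cong F (λ _ → const τ)) (const (n * τ))) ⟩
        d * (4 ^ d * s) + n * (n * τ)                                  <⟨ K-large ⟩
        K                                                              ≤⟨ size i ≤-refl ⟩
        #Fin (S i)                                                     ∎)
        where
        open ≤-Reasoning
        const : ∀ k → ∑ F (λ _ → k) ≡ n * k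
        const k = trans (∑-cong F (λ _ → sym (+-identityʳ k)))
          (trans (∑-*ʳ F k (λ _ → 1)) (cong (_* k) (#Fin-true {n})))
      ... | x , x∈S , free = x , x∈S , shrinks , densities
        where
        none : ∀ b → b ≢ true → b ≡ false
        none true  h = contradiction refl h
        none false h = refl
        shrinks : ∀ c → ι < toℕ c → 0 < m c → #Fin (S c) ≤ w ^ m c * #Fin (λ z → S c z ∧ B i c x z)
        shrinks c i<c pos with #Fin (S c) ≤ᵇ w ^ m c * #Fin (λ z → S c z ∧ B i c x z) in eq
        ... | true  = true-≤ᵇ {#Fin (S c)} eq
        ... | false = contradiction (≤-trans
          (≤-reflexive (sym (cong 𝟙 (∧-intro (<ᵇ-true pos) (∧-intro (<ᵇ-true i<c) (cong not eq))))))
          (≤-trans (∑-∈ F (λ c → 𝟙 (narrow x c)) (∈-allFin c)) (≤-trans (m≤m+n _ _) (≤-reflexive free)))) λ ()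
        densities : ∀ b c → ι < toℕ b → toℕ b < toℕ c → E i b c ≡ true →
          Dense (4 ^ suc (mult ι b c) * s) (w ^ suc (mult ι b c)) (λ y z → B b c y z ∧ blue i b c x y z)
        densities b c i<b b<c e = subst₂ (λ p q → Dense p q (λ y z → B b c y z ∧ blue i b c x y z))
          (sym (*-assoc 4 (4 ^ mult ι b c) s)) (*-comm (w ^ mult ι b c) w)
          (¬notDense (4 * (4 ^ mult ι b c * s)) (w ^ mult ι b c * w) (λ y z → B b c y z ∧ blue i b c x y z) λ nd → contradiction (≤-trans
            (≤-reflexive (sym (cong 𝟙 (∧-intro (∧-intro (<ᵇ-true i<b) (∧-intro (<ᵇ-true b<c) e)) (is-bad nd)))))
            (≤-trans (∑-∈ F (λ c → 𝟙 (poor x b c)) (∈-allFin c))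
              (≤-trans (∑-∈ F (λ b → ∑ F (λ c → 𝟙 (poor x b c))) (∈-allFin b))
                (≤-trans (m≤n+m _ _) (≤-reflexive free))))) λ ())
          where
          is-bad : NotDense (4 * (4 ^ mult ι b c * s)) (w ^ mult ι b c * w) (λ y z → B b c y z ∧ blue i b c x y z) →
            Bad (B b c) (blue i b c) (mult ι b c) x ≡ true
          is-bad nd = dec-true (badAt? (B b c) (blue i b c) (w ^ mult ι b c) w (4 ^ mult ι b c * s) x) nd

      step : RedEdge ⊎ Embedded (suc ι)
      step with any? (λ b → any? (λ c → τ <? #Fin (λ x → poor x b c)))
      ... | no none = inj₂ (let x , g = choose (λ b c → ≮⇒≥ λ lt → none (b , c , lt)) in extend x g)
      ... | yes (b , c , many) = inj₁ (i , b , c , i<b , b<c , e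
          , redBox (mult ι b c) (≤-trans (multiplicity≤load E b c (<⇒≤ i<b) b<c) (load≤d c))
              (B b c) (blue i b c) (dense b c (<⇒≤ i<b) b<c)
              (≤-trans (<⇒≤ many) (#-mono V (λ x h → proj₂ (∧-elim {(ι <ᵇ toℕ b) ∧ ((toℕ b <ᵇ toℕ c) ∧ E i b c)} h)))))
        where
        cond : (ι <ᵇ toℕ b) ∧ ((toℕ b <ᵇ toℕ c) ∧ E i b c) ≡ true
        cond with x , h ← #-witness V (λ x → poor x b c) (≤-trans (s≤s z≤n) many) =
          proj₁ (∧-elim {(ι <ᵇ toℕ b) ∧ ((toℕ b <ᵇ toℕ c) ∧ E i b c)} h)
        i<b = true-<ᵇ {ι} (proj₁ (∧-elim {ι <ᵇ toℕ b} cond))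
        b<c = true-<ᵇ {toℕ b} (proj₁ (∧-elim {toℕ b <ᵇ toℕ c} (proj₂ (∧-elim {ι <ᵇ toℕ b} cond))))
        e = proj₂ (∧-elim {toℕ b <ᵇ toℕ c} (proj₂ (∧-elim {ι <ᵇ toℕ b} cond)))

    embed : ∀ i → i ≤ n → RedEdge ⊎ Embedded i
    embed zero    h = inj₂ start
    embed (suc i) h with embed i (<⇒≤ h)
    ... | inj₁ r  = inj₁ r
    ... | inj₂ st = subst (λ k → RedEdge ⊎ Embedded (suc k)) (toℕ-fromℕ< h)
      (step (fromℕ< h) (subst Embedded (sym (toℕ-fromℕ< h)) st))

    greedy-embedding : RedEdge ⊎ (Σ (Fin n → Fin M) λ f → ∀ a b c → toℕ a < toℕ b → toℕ b < toℕ c →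
      E a b c ≡ true → blue a b c (f a) (f b) (f c) ≡ true)
    greedy-embedding with embed n ≤-refl
    ... | inj₁ r  = inj₁ r
    ... | inj₂ st = inj₂ (Embedded.f st , λ a b c a<b b<c → Embedded.embedded st a b c a<b b<c (toℕ<n c))

-- Degeneracy in terms of ranks

triple : ∀ {n} → Fin n → Fin n → Fin n → Subset n
triple x y z = ⁅ x ⁆ ∪ (⁅ y ⁆ ∪ ⁅ z ⁆)

∈-triple⁻ : ∀ {n} {v x y z : Fin n} → v ∈ˢ triple x y z → v ≡ x ⊎ v ≡ y ⊎ v ≡ z
∈-triple⁻ {x = x} {y} {z} h with x∈p∪q⁻ ⁅ x ⁆ (⁅ y ⁆ ∪ ⁅ z ⁆) h
... | inj₁ e = inj₁ (x∈⁅y⁆⇒x≡y x e)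
... | inj₂ h′ with x∈p∪q⁻ ⁅ y ⁆ ⁅ z ⁆ h′
...   | inj₁ e = inj₂ (inj₁ (x∈⁅y⁆⇒x≡y y e))
...   | inj₂ e = inj₂ (inj₂ (x∈⁅y⁆⇒x≡y z e))

∈-triple⁺ : ∀ {n} {v x y z : Fin n} → v ≡ x ⊎ v ≡ y ⊎ v ≡ z → v ∈ˢ triple x y z
∈-triple⁺ (inj₁ refl)        = x∈p∪q⁺ (inj₁ (x∈⁅x⁆ _))
∈-triple⁺ (inj₂ (inj₁ refl)) = x∈p∪q⁺ (inj₂ (x∈p∪q⁺ (inj₁ (x∈⁅x⁆ _))))
∈-triple⁺ (inj₂ (inj₂ refl)) = x∈p∪q⁺ (inj₂ (x∈p∪q⁺ (inj₂ (x∈⁅x⁆ _))))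

#-≤1 : ∀ {n} (p : Fin n → Bool) → (∀ {x y} → p x ≡ true → p y ≡ true → x ≡ y) → #Fin p ≤ 1
#-≤1 {n} p unique with #Fin p in eq
... | zero  = z≤n
... | suc k with x , px ← #-witness (allFin n) p (subst (0 <_) (sym eq) (s≤s z≤n)) =
  ≤-trans (≤-reflexive (sym eq)) (≤-trans
    (#-mono (allFin n) (λ y py → subst (λ v → (x == v) ≡ true) (unique px py) (==-refl x)))
    (#-==-≤1 id id x))

∈-subsets : ∀ {n} (e : Subset n) → e ∈ subsets n
∈-subsets []            = here refl
∈-subsets (inside ∷ e)  = ∈-++⁺ˡ (∈-map⁺ (inside ∷_) (∈-subsets e))
∈-subsets (outside ∷ e) = ∈-++⁺ʳ _ (∈-map⁺ (outside ∷_) (∈-subsets e))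

length-filter : {A : Set} {P : A → Set} (P? : ∀ x → Dec (P x)) (xs : List A) →
  length (filter P? xs) ≡ # xs (λ x → does (P? x))
length-filter P? []       = refl
length-filter P? (x ∷ xs) with does (P? x)
... | true  = cong suc (length-filter P? xs)
... | false = length-filter P? xs

-- Double counting of the pairs against their keys: each pair is found at its key, each subset is
-- the key of at most one pair, and only subsets satisfying `P` occur.
count-injective : ∀ {n k} (g : Fin k → Fin k → Bool) (key : Fin k → Fin k → Subset n) (P : Subset n → Bool) →
  (∀ p q → g p q ≡ true → P (key p q) ≡ true) →
  (∀ {p q p′ q′} → g p q ≡ true → g p′ q′ ≡ true → key p q ≡ key p′ q′ → p ≡ p′ × q ≡ q′) →
  ∑ (allFin k) (λ p → #Fin (g p)) ≤ # (subsets n) P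
count-injective {n} {k} g key P into inj = begin
  ∑ F (λ p → #Fin (g p))                                        ≤⟨ ∑-mono F (λ p → ∑-mono F (λ q → found p q)) ⟩
  ∑ F (λ p → ∑ F (λ q → # (subsets n) (λ e → h e p q)))         ≡⟨ ∑-cong F (λ p → ∑-swap F (subsets n) _) ⟩
  ∑ F (λ p → ∑ (subsets n) (λ e → #Fin (h e p)))                ≡⟨ ∑-swap F (subsets n) _ ⟩
  ∑ (subsets n) (λ e → ∑ F (λ p → #Fin (h e p)))                ≤⟨ ∑-mono (subsets n) once ⟩
  # (subsets n) P                                               ∎
  where
  open ≤-Reasoning
  F = allFin k
  same : Subset n → Subset n → Bool
  same e e′ = does (≡-dec Bool._≟_ e e′)
  same-≡ : ∀ {e e′} → same e e′ ≡ true → e ≡ e′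
  same-≡ {e} {e′} s with ≡-dec Bool._≟_ e e′
  ... | yes eq = eq
  h : Subset n → Fin k → Fin k → Bool
  h e p q = g p q ∧ same (key p q) e
  found : ∀ p q → 𝟙 (g p q) ≤ # (subsets n) (λ e → h e p q)
  found p q with g p q in eq
  ... | false = z≤n
  ... | true  = #-∈ (subsets n) (same (key p q)) (∈-subsets (key p q)) (dec-true (≡-dec Bool._≟_ (key p q) (key p q)) refl)
  unique : ∀ {e p q p′ q′} → h e p q ≡ true → h e p′ q′ ≡ true → p ≡ p′ × q ≡ q′
  unique {e} {p} {q} {p′} {q′} a b with a₁ , a₂ ← ∧-elim {g p q} a with b₁ , b₂ ← ∧-elim {g p′ q′} b =
    inj a₁ b₁ (trans (same-≡ a₂) (sym (same-≡ b₂)))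
  once : ∀ e → ∑ F (λ p → #Fin (h e p)) ≤ 𝟙 (P e)
  once e = begin
    ∑ F (λ p → #Fin (h e p))              ≤⟨ ∑-mono F row ⟩
    #Fin (λ p → 0 <ᵇ #Fin (h e p))        ≤⟨ all-rows ⟩
    𝟙 (P e)                               ∎
    where
    row : ∀ p → #Fin (h e p) ≤ 𝟙 (0 <ᵇ #Fin (h e p))
    row p with #Fin (h e p) in eq | #-≤1 (h e p) (λ {x} {y} a b → proj₂ (unique {e} {p} {x} {p} {y} a b))
    ... | zero  | _ = z≤n
    ... | suc _ | l = l
    witness : ∀ p → (0 <ᵇ #Fin (h e p)) ≡ true → ∃[ q ] h e p q ≡ true
    witness p pos = #-witness F (h e p) (true-<ᵇ pos)
    all-rows : #Fin (λ p → 0 <ᵇ #Fin (h e p)) ≤ 𝟙 (P e)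
    all-rows with true? (P e)
    ... | inj₁ Pe rewrite Pe = #-≤1 (λ p → 0 <ᵇ #Fin (h e p)) (λ {x} {y} a b →
      let q , hq = witness x a ; q′ , hq′ = witness y b in proj₁ (unique {e} {x} {q} {y} {q′} hq hq′))
    ... | inj₂ ¬Pe = ≤-trans (≤-reflexive (trans (#-cong F none) (∑-zero F))) z≤n
      where
      none : ∀ p → (0 <ᵇ #Fin (h e p)) ≡ false
      none p with 0 <ᵇ #Fin (h e p) in eq
      ... | false = refl
      ... | true with q , hq ← witness p eq with a , b ← ∧-elim {g p q} hq =
        contradiction (trans (sym (subst (λ v → P v ≡ true) (same-≡ b) (into p q a))) ¬Pe) λ ()

T-true : ∀ {b} → T b → b ≡ true
T-true {true} _ = refl

true-T : ∀ {b} → b ≡ true → T b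
true-T refl = _

module _ {n : ℕ} (H : OrderedGraph 3 n) (u : Permutation′ n) where

  private
    edge = OrderedGraph.edge? H

  rankedEdge : Fin n → Fin n → Fin n → Bool
  rankedEdge a b c = edge (triple (u ⟨$⟩ʳ a) (u ⟨$⟩ʳ b) (u ⟨$⟩ʳ c))

  u-injective : ∀ {i j} → u ⟨$⟩ʳ i ≡ u ⟨$⟩ʳ j → i ≡ j
  u-injective e = trans (sym (inverseˡ u)) (trans (cong (u ⟨$⟩ˡ_) e) (inverseˡ u))

  private
    key : Fin n → Fin n → Fin n → Subset n
    key a b c = triple (u ⟨$⟩ʳ a) (u ⟨$⟩ʳ b) (u ⟨$⟩ʳ c)

    isBack : Fin n → Subset n → Bool
    isBack i e = does (T? (edge e) ×-dec ((u ⟨$⟩ʳ i) ∈? e)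
      ×-dec any? (λ j → (j Fin.<? i) ×-dec ((u ⟨$⟩ʳ j) ∈? e)))

    back-intro : ∀ {i j e} → edge e ≡ true → (u ⟨$⟩ʳ i) ∈ˢ e → toℕ j < toℕ i → (u ⟨$⟩ʳ j) ∈ˢ e →
      isBack i e ≡ true
    back-intro {i} {j} {e} h i∈ j<i j∈ = dec-true (T? (edge e) ×-dec ((u ⟨$⟩ʳ i) ∈? e)
      ×-dec any? (λ j → (j Fin.<? i) ×-dec ((u ⟨$⟩ʳ j) ∈? e))) (true-T h , i∈ , j , j<i , j∈)

    member : ∀ {v a b c} → (u ⟨$⟩ʳ v) ∈ˢ key a b c → v ≡ a ⊎ v ≡ b ⊎ v ≡ c
    member h with ∈-triple⁻ h
    ... | inj₁ e        = inj₁ (u-injective e)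
    ... | inj₂ (inj₁ e) = inj₂ (inj₁ (u-injective e))
    ... | inj₂ (inj₂ e) = inj₂ (inj₂ (u-injective e))

    min≤ : ∀ {a b c a′ b′ c′} → toℕ a′ < toℕ b′ → toℕ b′ < toℕ c′ →
      key a b c ≡ key a′ b′ c′ → toℕ a′ ≤ toℕ a
    min≤ {a} a<b b<c e with member (subst ((u ⟨$⟩ʳ a) ∈ˢ_) e (∈-triple⁺ (inj₁ refl)))
    ... | inj₁ refl        = ≤-refl
    ... | inj₂ (inj₁ refl) = <⇒≤ a<b
    ... | inj₂ (inj₂ refl) = <⇒≤ (<-trans a<b b<c)

    ≤max : ∀ {a b c a′ b′ c′} → toℕ a′ < toℕ b′ → toℕ b′ < toℕ c′ →
      key a b c ≡ key a′ b′ c′ → toℕ c ≤ toℕ c′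
    ≤max {c = c} a<b b<c e with member (subst ((u ⟨$⟩ʳ c) ∈ˢ_) e (∈-triple⁺ (inj₂ (inj₂ refl))))
    ... | inj₁ refl        = <⇒≤ (<-trans a<b b<c)
    ... | inj₂ (inj₁ refl) = <⇒≤ b<c
    ... | inj₂ (inj₂ refl) = ≤-refl

    -- The set forgets the order of the triple, but ranks restore it: first the least and the
    -- greatest element, then the middle one.
    key-injective : ∀ {a b c a′ b′ c′} → toℕ a < toℕ b → toℕ b < toℕ c → toℕ a′ < toℕ b′ → toℕ b′ < toℕ c′ →
      key a b c ≡ key a′ b′ c′ → a ≡ a′ × b ≡ b′ × c ≡ c′
    key-injective {a} {b} {c} {a′} {b′} {c′} a<b b<c a′<b′ b′<c′ e = a≡ , b≡ , c≡
      where
      a≡ : a ≡ a′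
      a≡ = toℕ-injective (≤-antisym (min≤ a<b b<c (sym e)) (min≤ a′<b′ b′<c′ e))
      c≡ : c ≡ c′
      c≡ = toℕ-injective (≤-antisym (≤max a′<b′ b′<c′ e) (≤max a<b b<c (sym e)))
      b≡ : b ≡ b′
      b≡ with member (subst ((u ⟨$⟩ʳ b) ∈ˢ_) e (∈-triple⁺ (inj₂ (inj₁ refl))))
      ... | inj₂ (inj₁ h) = h
      ... | inj₁ h        = contradiction (trans a≡ (sym h)) λ { refl → n≮n _ a<b }
      ... | inj₂ (inj₂ h) = contradiction (trans h (sym c≡)) λ { refl → n≮n _ b<c }

    sorted : Fin n → Fin n → Fin n → Bool
    sorted a b c = (toℕ b <ᵇ toℕ c) ∧ ((toℕ a <ᵇ toℕ b) ∧ rankedEdge a b c)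

    sorted-elim : ∀ {a b c} → sorted a b c ≡ true → toℕ b < toℕ c × toℕ a < toℕ b × rankedEdge a b c ≡ true
    sorted-elim {a} {b} {c} h with p , q ← ∧-elim {toℕ b <ᵇ toℕ c} h with r , s ← ∧-elim {toℕ a <ᵇ toℕ b} q =
      true-<ᵇ p , true-<ᵇ r , s

    count-sorted : ∀ b c → 𝟙 (toℕ b <ᵇ toℕ c) * multiplicity rankedEdge (toℕ b) b c ≡ #Fin (λ a → sorted a b c)
    count-sorted b c = trans (sym (∑-*ˡ (allFin n) (𝟙 (toℕ b <ᵇ toℕ c)) _))
      (∑-cong (allFin n) (λ a → trans (cong (𝟙 (toℕ b <ᵇ toℕ c) *_) (sym (𝟙-∧ (toℕ a <ᵇ toℕ b) _)))
                                      (sym (𝟙-∧ (toℕ b <ᵇ toℕ c) _))))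

  module _ {d : ℕ} (degenerate : ∀ i → backDegree H u i ≤ d) where

    private
      back≤d : ∀ i → # (subsets n) (isBack i) ≤ d
      back≤d i = ≤-trans (≤-reflexive (sym (length-filter _ (subsets n)))) (degenerate i)

    -- Weak degeneracy enters in two ways. An edge whose last vertex is c is a back edge of c, which
    -- bounds the load. An edge whose middle vertex is b is a back edge of b, because its least
    -- vertex precedes b; this gives `degree≤d`.
    load≤d : ∀ c → load rankedEdge (toℕ c) c ≤ d
    load≤d c = ≤-trans (≤-reflexive (∑-cong (allFin n) (λ b → count-sorted b c)))
      (≤-trans (count-injective (λ b a → sorted a b c) (λ b a → key a b c) (isBack c)
        (λ b a h → let b<c , a<b , e = sorted-elim {a} h in
          back-intro e (∈-triple⁺ (inj₂ (inj₂ refl))) (<-trans a<b b<c) (∈-triple⁺ (inj₁ refl)))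
        (λ {b} {a} {b′} {a′} h h′ eq →
          let b<c , a<b , _ = sorted-elim {a} h
              b<c′ , a<b′ , _ = sorted-elim {a′} h′
              a≡ , b≡ , _ = key-injective a<b b<c a<b′ b<c′ eq in b≡ , a≡))
        (back≤d c))

    degree≤d : ∀ b → ∑ (allFin n) (λ c → 𝟙 (toℕ b <ᵇ toℕ c) * multiplicity rankedEdge (toℕ b) b c) ≤ d
    degree≤d b = ≤-trans (≤-reflexive (∑-cong (allFin n) (λ c → count-sorted b c)))
      (≤-trans (count-injective (λ c a → sorted a b c) (λ c a → key a b c) (isBack b)
        (λ c a h → let b<c , a<b , e = sorted-elim {a} h in
          back-intro e (∈-triple⁺ (inj₂ (inj₁ refl))) a<b (∈-triple⁺ (inj₁ refl)))
        (λ {c} {a} {c′} {a′} h h′ eq →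
          let b<c , a<b , _ = sorted-elim {a} h
              b<c′ , a<b′ , _ = sorted-elim {a′} h′
              a≡ , _ , c≡ = key-injective a<b b<c a<b′ b<c′ eq in c≡ , a≡))
        (back≤d b))

-- Triples of vertices

triple-swapˡ : ∀ {n} (x y z : Fin n) → triple x y z ≡ triple y x z
triple-swapˡ x y z = trans (sym (∪-assoc ⁅ x ⁆ ⁅ y ⁆ ⁅ z ⁆))
  (trans (cong (_∪ ⁅ z ⁆) (∪-comm ⁅ x ⁆ ⁅ y ⁆)) (∪-assoc ⁅ y ⁆ ⁅ x ⁆ ⁅ z ⁆))

triple-swapʳ : ∀ {n} (x y z : Fin n) → triple x y z ≡ triple x z y
triple-swapʳ x y z = cong (⁅ x ⁆ ∪_) (∪-comm ⁅ y ⁆ ⁅ z ⁆)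

∣⁅x⁆∪p∣ : ∀ {n} (x : Fin n) (p : Subset n) → x ∉ˢ p → ∣ ⁅ x ⁆ ∪ p ∣ ≡ suc ∣ p ∣
∣⁅x⁆∪p∣ zero    (true  ∷ p) x∉p = contradiction Vec.here x∉p
∣⁅x⁆∪p∣ zero    (false ∷ p) x∉p = cong (suc ∘ ∣_∣) (∪-identityˡ p)
∣⁅x⁆∪p∣ (suc x) (true  ∷ p) x∉p = cong suc (∣⁅x⁆∪p∣ x p (x∉p ∘ Vec.there))
∣⁅x⁆∪p∣ (suc x) (false ∷ p) x∉p = ∣⁅x⁆∪p∣ x p (x∉p ∘ Vec.there)

∣triple∣ : ∀ {n} {x y z : Fin n} → x ≢ y → x ≢ z → y ≢ z → ∣ triple x y z ∣ ≡ 3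
∣triple∣ {x = x} {y} {z} x≢y x≢z y≢z = trans
  (∣⁅x⁆∪p∣ x (⁅ y ⁆ ∪ ⁅ z ⁆) λ h → distinct (∈-triple⁻ {x = y} {y} {z} (∈∪ h)))
  (cong suc (trans (∣⁅x⁆∪p∣ y ⁅ z ⁆ λ h → y≢z (x∈⁅y⁆⇒x≡y z h)) (cong suc (∣⁅x⁆∣≡1 z))))
  where
  ∈∪ : x ∈ˢ ⁅ y ⁆ ∪ ⁅ z ⁆ → x ∈ˢ triple y y z
  ∈∪ = q⊆p∪q ⁅ y ⁆ (⁅ y ⁆ ∪ ⁅ z ⁆)
  distinct : ¬ (x ≡ y ⊎ x ≡ y ⊎ x ≡ z)
  distinct (inj₁ e)        = x≢y e
  distinct (inj₂ (inj₁ e)) = x≢y e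
  distinct (inj₂ (inj₂ e)) = x≢z e

elements : ∀ {n} → Subset n → List (Fin n)
elements []          = []
elements (true ∷ e)  = zero ∷ map suc (elements e)
elements (false ∷ e) = map suc (elements e)

length-elements : ∀ {n} (e : Subset n) → length (elements e) ≡ ∣ e ∣
length-elements []          = refl
length-elements (true ∷ e)  = cong suc (trans (length-map suc (elements e)) (length-elements e))
length-elements (false ∷ e) = trans (length-map suc (elements e)) (length-elements e)

∈-elements⁺ : ∀ {n} (e : Subset n) {v} → v ∈ˢ e → v ∈ elements e
∈-elements⁺ (true ∷ e)  Vec.here      = here refl
∈-elements⁺ (true ∷ e)  (Vec.there h) = there (∈-map⁺ suc (∈-elements⁺ e h))
∈-elements⁺ (false ∷ e) (Vec.there h) = ∈-map⁺ suc (∈-elements⁺ e h)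

∈-elements⁻ : ∀ {n} (e : Subset n) {v} → v ∈ elements e → v ∈ˢ e
∈-elements⁻ (true ∷ e)  (here refl) = Vec.here
∈-elements⁻ (true ∷ e)  (there h) with w , w∈ , refl ← ∈-map⁻ suc h = Vec.there (∈-elements⁻ e w∈)
∈-elements⁻ (false ∷ e) h with w , w∈ , refl ← ∈-map⁻ suc h = Vec.there (∈-elements⁻ e w∈)

elements-sorted : ∀ {n} (e : Subset n) → AllPairs Fin._<_ (elements e)
elements-sorted []          = []
elements-sorted (true ∷ e)  = All.map⁺ (All.tabulate (λ _ → s≤s z≤n)) ∷ AllPairs.map⁺ (AllPairs.map s≤s (elements-sorted e))
elements-sorted (false ∷ e) = AllPairs.map⁺ (AllPairs.map s≤s (elements-sorted e))

as-triple : ∀ {n} (e : Subset n) → ∣ e ∣ ≡ 3 → ∃[ x ] ∃[ y ] ∃[ z ] x Fin.< y × y Fin.< z × e ≡ triple x y z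
as-triple e size with elements e in eq | trans (length-elements e) size | elements-sorted e
... | x ∷ y ∷ z ∷ [] | refl | (x<y ∷ _) ∷ (y<z ∷ _) ∷ _ = x , y , z , x<y , y<z , ⊆-antisym
  (λ h → ∈-triple⁺ (listed (subst (_ ∈_) eq (∈-elements⁺ e h))))
  (λ h → ∈-elements⁻ e (subst (_ ∈_) (sym eq) (listing (∈-triple⁻ h))))
  where
  listed : ∀ {v} → v ∈ x ∷ y ∷ z ∷ [] → v ≡ x ⊎ v ≡ y ⊎ v ≡ z
  listed (here e)                 = inj₁ e
  listed (there (here e))         = inj₂ (inj₁ e)
  listed (there (there (here e))) = inj₂ (inj₂ e)
  listing : ∀ {v} → v ≡ x ⊎ v ≡ y ⊎ v ≡ z → v ∈ x ∷ y ∷ z ∷ []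
  listing (inj₁ e)        = here e
  listing (inj₂ (inj₁ e)) = there (here e)
  listing (inj₂ (inj₂ e)) = there (there (here e))

sort-triple : ∀ {n k} (ρ : Fin n → Fin k) → (∀ {i j} → ρ i ≡ ρ j → i ≡ j) → ∀ {x y z} → x ≢ y → x ≢ z → y ≢ z →
  ∃[ a ] ∃[ b ] ∃[ c ] ρ a Fin.< ρ b × ρ b Fin.< ρ c × triple x y z ≡ triple a b c
sort-triple ρ inj {x} {y} {z} x≢y x≢z y≢z with <-cmp (ρ x) (ρ y) | <-cmp (ρ y) (ρ z) | <-cmp (ρ x) (ρ z)
... | tri≈ _ e _ | _ | _ = contradiction (inj e) x≢y
... | _ | tri≈ _ e _ | _ = contradiction (inj e) y≢z
... | _ | _ | tri≈ _ e _ = contradiction (inj e) x≢z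
... | tri< xy _ _ | tri< yz _ _ | _           = x , y , z , xy , yz , refl
... | tri< xy _ _ | tri> _ _ zy | tri< xz _ _ = x , z , y , xz , zy , triple-swapʳ x y z
... | tri< xy _ _ | tri> _ _ zy | tri> _ _ zx = z , x , y , zx , xy , trans (triple-swapʳ x y z) (triple-swapˡ x z y)
... | tri> _ _ yx | tri< yz _ _ | tri< xz _ _ = y , x , z , yx , xz , triple-swapˡ x y z
... | tri> _ _ yx | tri< yz _ _ | tri> _ _ zx = y , z , x , yz , zx , trans (triple-swapˡ x y z) (triple-swapʳ y x z)
... | tri> _ _ yx | tri> _ _ zy | _           = z , y , x , zy , yx ,
  trans (triple-swapˡ x y z) (trans (triple-swapʳ y x z) (triple-swapˡ y z x))

∈-image⁺ : ∀ {m n} (φ : Fin m → Fin n) (e : Subset m) {i} → i ∈ˢ e → φ i ∈ˢ image φ e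
∈-image⁺ φ e {i} h = lookup⇒[]= (φ i) (image φ e) (trans (lookup∘tabulate _ (φ i))
  (dec-true (any? λ k → (k ∈? e) ×-dec (φ k Fin.≟ φ i)) (i , h , refl)))

∈-image⁻ : ∀ {m n} (φ : Fin m → Fin n) (e : Subset m) {j} → j ∈ˢ image φ e → ∃[ i ] i ∈ˢ e × φ i ≡ j
∈-image⁻ φ e {j} h with any? (λ i → (i ∈? e) ×-dec (φ i Fin.≟ j)) | trans (sym (lookup∘tabulate (λ j → does (any? λ i → (i ∈? e) ×-dec (φ i Fin.≟ j))) j)) ([]=⇒lookup h)
... | yes w | _ = w

image-triple : ∀ {m n} (φ : Fin m → Fin n) x y z → image φ (triple x y z) ≡ triple (φ x) (φ y) (φ z)
image-triple φ x y z = ⊆-antisym to from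
  where
  to : ∀ {j} → j ∈ˢ image φ (triple x y z) → j ∈ˢ triple (φ x) (φ y) (φ z)
  to h with ∈-image⁻ φ (triple x y z) h
  ... | i , i∈ , refl with ∈-triple⁻ i∈
  ...   | inj₁ refl        = ∈-triple⁺ (inj₁ refl)
  ...   | inj₂ (inj₁ refl) = ∈-triple⁺ (inj₂ (inj₁ refl))
  ...   | inj₂ (inj₂ refl) = ∈-triple⁺ (inj₂ (inj₂ refl))
  from : ∀ {j} → j ∈ˢ triple (φ x) (φ y) (φ z) → j ∈ˢ image φ (triple x y z)
  from h with ∈-triple⁻ h
  ... | inj₁ refl        = ∈-image⁺ φ _ (∈-triple⁺ (inj₁ refl))
  ... | inj₂ (inj₁ refl) = ∈-image⁺ φ _ (∈-triple⁺ (inj₂ (inj₁ refl)))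
  ... | inj₂ (inj₂ refl) = ∈-image⁺ φ _ (∈-triple⁺ (inj₂ (inj₂ refl)))

-- Order-preserving embeddings

increasing-injective : ∀ {m n} {φ : Fin m → Fin n} → (∀ {i j} → i Fin.< j → φ i Fin.< φ j) →
  ∀ {i j} → φ i ≡ φ j → i ≡ j
increasing-injective {φ = φ} mono {i} {j} e with <-cmp i j
... | tri< i<j _ _ = contradiction (subst (λ v → φ i Fin.< v) (sym e) (mono i<j)) (n≮n _)
... | tri≈ _ h _   = h
... | tri> _ _ j<i = contradiction (subst (λ v → φ j Fin.< v) e (mono j<i)) (n≮n _)

increasing-preserves : ∀ {m n} {φ : Fin m → Fin n} → (∀ {i j} → i Fin.< j → φ i Fin.< φ j) →
  ∀ {i j} → i Fin.≤ j → φ i Fin.≤ φ j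
increasing-preserves mono i≤j with m≤n⇒m<n∨m≡n i≤j
... | inj₁ i<j = <⇒≤ (mono i<j)
... | inj₂ e with refl ← toℕ-injective e = ≤-refl

contains-triples : ∀ {m n} (H : OrderedGraph 3 m) (χ : Subset n → Colour) (c : Colour) (φ : Fin m → Fin n) →
  (∀ {i j} → i Fin.< j → φ i Fin.< φ j) →
  (∀ e → e ∈E H → ∃[ x ] ∃[ y ] ∃[ z ] x ≢ y × x ≢ z × y ≢ z × e ≡ triple x y z × χ (triple (φ x) (φ y) (φ z)) ≡ c) →
  Contains (colourClass 3 χ c) H
contains-triples H χ c φ mono h = φ , inj , increasing-preserves mono , edge
  where
  inj = increasing-injective mono
  edge : ∀ e → e ∈E H → image φ e ∈E colourClass 3 χ c
  edge e e∈ with x , y , z , x≢y , x≢z , y≢z , refl , col ← h e e∈ rewrite image-triple φ x y z =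
    fromWitness (∣triple∣ (x≢y ∘ inj) (x≢z ∘ inj) (y≢z ∘ inj) , col)

enumerate : ∀ {M} n (p : Fin M → Bool) → n ≤ #Fin p →
  Σ (Fin n → Fin M) λ α → (∀ {i j} → i Fin.< j → α i Fin.< α j) × (∀ i → p (α i) ≡ true)
enumerate zero    p h = (λ ()) , (λ { {()} }) , λ ()
enumerate {zero}  (suc n) p ()
enumerate {suc M} (suc n) p h with p zero in eq | subst (suc n ≤_) (∑-allFin (λ i → 𝟙 (p i))) h
... | false | h′ with α , mono , sat ← enumerate (suc n) (p ∘ suc) h′ =
  suc ∘ α , (λ i<j → s≤s (mono i<j)) , sat
... | true  | h′ with α , mono , sat ← enumerate n (p ∘ suc) (≤-pred h′) =
  α′ , mono′ , sat′
  where
  α′ : Fin (suc n) → Fin (suc M)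
  α′ zero    = zero
  α′ (suc i) = suc (α i)
  mono′ : ∀ {i j} → i Fin.< j → α′ i Fin.< α′ j
  mono′ {zero}  {suc j} _         = s≤s z≤n
  mono′ {suc i} {suc j} (s≤s i<j) = s≤s (mono i<j)
  sat′ : ∀ i → p (α′ i) ≡ true
  sat′ zero    = eq
  sat′ (suc i) = sat i

combine-monoʳ-< : ∀ {m n} (v : Fin m) {x y : Fin n} → x Fin.< y → combine v x Fin.< combine v y
combine-monoʳ-< {m} {n} v {x} {y} x<y = begin-strict
  toℕ (combine v x)    ≡⟨ toℕ-combine v x ⟩
  n * toℕ v + toℕ x    <⟨ +-monoʳ-< (n * toℕ v) x<y ⟩
  n * toℕ v + toℕ y    ≡⟨ sym (toℕ-combine v y) ⟩
  toℕ (combine v y)    ∎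
  where open ≤-Reasoning

three-exhaust : ∀ {m} → m ≤ 3 → {x y z : Fin m} → x ≢ y → x ≢ z → y ≢ z → ∀ q → q ≡ x ⊎ q ≡ y ⊎ q ≡ z
three-exhaust {m} m≤3 {x} {y} {z} x≢y x≢z y≢z q with pigeonhole (s≤s m≤3) (lookup (x ∷ y ∷ z ∷ q ∷ []))
... | zero , suc zero , _ , e                 = contradiction e x≢y
... | zero , suc (suc zero) , _ , e           = contradiction e x≢z
... | zero , suc (suc (suc zero)) , _ , e     = inj₁ (sym e)
... | suc zero , suc zero , s≤s () , e
... | suc zero , suc (suc zero) , _ , e       = contradiction e y≢z
... | suc zero , suc (suc (suc zero)) , _ , e = inj₂ (inj₁ (sym e))
... | suc (suc zero) , suc zero , s≤s () , e
... | suc (suc zero) , suc (suc zero) , s≤s (s≤s ()) , e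
... | suc (suc zero) , suc (suc (suc zero)) , _ , e = inj₂ (inj₂ (sym e))
... | suc (suc (suc zero)) , suc zero , s≤s () , e
... | suc (suc (suc zero)) , suc (suc zero) , s≤s (s≤s ()) , e
... | suc (suc (suc zero)) , suc (suc (suc zero)) , s≤s (s≤s (s≤s ())) , e

not-blue : ∀ {c} → does (c ≟ᶜ blue) ≡ false → c ≡ red
not-blue {red} _ = refl

is-blue : ∀ {c} → does (c ≟ᶜ blue) ≡ true → c ≡ blue
is-blue {blue} _ = refl

module _ {n M : ℕ} (H : OrderedGraph 3 n) (u : Permutation′ n) (χ : Subset (n * M) → Colour) where

  blueTriple : Fin n → Fin n → Fin n → Fin M → Fin M → Fin M → Bool
  blueTriple a b c x y z = does (χ (triple (combine (u ⟨$⟩ʳ a) x) (combine (u ⟨$⟩ʳ b) y) (combine (u ⟨$⟩ʳ c) z)) ≟ᶜ blue)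

  -- The blocks stand in the order of V(H), so one vertex from each block preserves the order
  -- whatever the ranks are. Only the edges have to be sorted by rank before the hypothesis applies.
  blue-copy : (f : Fin n → Fin M) →
    (∀ a b c → toℕ a < toℕ b → toℕ b < toℕ c → rankedEdge H u a b c ≡ true → blueTriple a b c (f a) (f b) (f c) ≡ true) →
    Contains (colourClass 3 χ blue) H
  blue-copy f h = contains-triples H χ blue φ (λ {i} {j} → combine-monoˡ-< (f (u ⟨$⟩ˡ i)) (f (u ⟨$⟩ˡ j))) edge
    where
    φ = λ v → combine v (f (u ⟨$⟩ˡ v))
    ρ = u ⟨$⟩ˡ_
    ρ-injective : ∀ {i j} → ρ i ≡ ρ j → i ≡ j
    ρ-injective e = trans (sym (inverseʳ u)) (trans (cong (u ⟨$⟩ʳ_) e) (inverseʳ u))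
    <⇒≢ρ : ∀ {i j} → ρ i Fin.< ρ j → i ≢ j
    <⇒≢ρ lt refl = n≮n _ lt
    edge : ∀ e → e ∈E H → ∃[ x ] ∃[ y ] ∃[ z ] x ≢ y × x ≢ z × y ≢ z × e ≡ triple x y z × χ (triple (φ x) (φ y) (φ z)) ≡ blue
    edge e e∈ with x , y , z , x<y , y<z , refl ← as-triple e (OrderedGraph.uniform H e e∈)
              with a , b , c , a<b , b<c , eq ← sort-triple ρ ρ-injective {x} {y} {z}
                     (λ { refl → n≮n _ x<y }) (λ { refl → n≮n _ (<-trans x<y y<z) }) (λ { refl → n≮n _ y<z }) =
      a , b , c , <⇒≢ρ a<b , <⇒≢ρ (<-trans a<b b<c) , <⇒≢ρ b<c , eq , colour
      where
      colour : χ (triple (φ a) (φ b) (φ c)) ≡ blue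
      colour = is-blue (subst (λ v → does (χ (triple (combine v (f (ρ a))) (φ b) (φ c)) ≟ᶜ blue) ≡ true) (inverseʳ u)
        (subst (λ v → does (χ (triple (combine (u ⟨$⟩ʳ ρ a) (f (ρ a))) (combine v (f (ρ b))) (φ c)) ≟ᶜ blue) ≡ true) (inverseʳ u)
        (subst (λ v → does (χ (triple (combine (u ⟨$⟩ʳ ρ a) (f (ρ a))) (combine (u ⟨$⟩ʳ ρ b) (f (ρ b))) (combine v (f (ρ c)))) ≟ᶜ blue) ≡ true) (inverseʳ u)
          (h (ρ a) (ρ b) (ρ c) a<b b<c (trans (cong (OrderedGraph.edge? H)
            (trans (cong₂ (λ p q → triple p q (u ⟨$⟩ʳ ρ c)) (inverseʳ u) (inverseʳ u))
              (trans (cong (triple a b) (inverseʳ u)) (sym eq)))) (T-true e∈))))))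

  -- The edge on a, b, c meets each of the at most three intervals exactly once, so it provides one
  -- block per interval, and these blocks stand in the order of the intervals. Each interval is sent
  -- increasingly into the side of the box in its block. Every edge of H likewise has one vertex in
  -- each interval, so its image has one vertex in each side and is red.
  red-copy : ∀ {m} → m ≤ 3 → IntervalColourable H m →
    ∀ a b c → rankedEdge H u a b c ≡ true → toℕ a < toℕ b → toℕ b < toℕ c →
    RedBox n (blueTriple a b c) → Contains (colourClass 3 χ red) H
  red-copy {m} m≤3 (p , _ , interval , proper) a b c e₀ a<b b<c (X , Y , Z , X-size , Y-size , Z-size , isRed)
    with α , α-mono , α∈ ← enumerate n X X-size
    with β , β-mono , β∈ ← enumerate n Y Y-size
    with γ , γ-mono , γ∈ ← enumerate n Z Z-size =
    contains-triples H χ red φ φ-mono edge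
    where
    va = u ⟨$⟩ʳ a
    vb = u ⟨$⟩ʳ b
    vc = u ⟨$⟩ʳ c
    e₀∈ : triple va vb vc ∈E H
    e₀∈ = true-T e₀
    separate : ∀ {i j} → toℕ i < toℕ j → (u ⟨$⟩ʳ i) ∈ˢ triple va vb vc → (u ⟨$⟩ʳ j) ∈ˢ triple va vb vc → p (u ⟨$⟩ʳ i) ≢ p (u ⟨$⟩ʳ j)
    separate i<j i∈ j∈ same with refl ← u-injective H u (proper _ e₀∈ i∈ j∈ same) = n≮n _ i<j
    a∈ = ∈-triple⁺ {v = va} {va} {vb} {vc} (inj₁ refl)
    b∈ = ∈-triple⁺ {v = vb} {va} {vb} {vc} (inj₂ (inj₁ refl))
    c∈ = ∈-triple⁺ {v = vc} {va} {vb} {vc} (inj₂ (inj₂ refl))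
    ab = separate a<b a∈ b∈
    bc = separate b<c b∈ c∈
    ac = separate (<-trans a<b b<c) a∈ c∈
    rep : Fin m → Fin n
    rep q = if q == p va then va else (if q == p vb then vb else vc)
    -- Each side has at least n vertices, so w itself can serve as the index and the intervals need
    -- no enumeration of their own.
    coord : Fin m → Fin n → Fin M
    coord q = if q == p va then α else (if q == p vb then β else γ)
    φ : Fin n → Fin (n * M)
    φ w = combine (rep (p w)) (coord (p w) w)
    ==-no : ∀ {q r : Fin m} → q ≢ r → (q == r) ≡ false
    ==-no {q} {r} q≢r with q ≟ r
    ... | yes e = contradiction e q≢r
    ... | no _  = refl
    φa : ∀ {w} → p w ≡ p va → φ w ≡ combine va (α w)
    φa {w} e rewrite e | ==-refl (p va) = refl
    φb : ∀ {w} → p w ≡ p vb → φ w ≡ combine vb (β w)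
    φb {w} e rewrite e | ==-no (ab ∘ sym) | ==-refl (p vb) = refl
    φc : ∀ {w} → p w ≡ p vc → φ w ≡ combine vc (γ w)
    φc {w} e rewrite e | ==-no (ac ∘ sym) | ==-no (bc ∘ sym) = refl
    p-rep : ∀ q → p (rep q) ≡ q
    p-rep q with three-exhaust m≤3 ab ac bc q
    ... | inj₁ refl rewrite ==-refl (p va) = refl
    ... | inj₂ (inj₁ refl) rewrite ==-no (ab ∘ sym) | ==-refl (p vb) = refl
    ... | inj₂ (inj₂ refl) rewrite ==-no (ac ∘ sym) | ==-no (bc ∘ sym) = refl
    coord-mono : ∀ q {i j} → i Fin.< j → coord q i Fin.< coord q j
    coord-mono q with q == p va | q == p vb
    ... | true  | _     = α-mono
    ... | false | true  = β-mono
    ... | false | false = γ-mono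
    intervals-ordered : ∀ {v v′ w w′} → w Fin.< w′ → p v ≡ p w → p v′ ≡ p w′ → p w ≢ p w′ → v Fin.< v′
    intervals-ordered {v} {v′} {w} {w′} w<w′ v~w v′~w′ w≁w′ = ≰⇒> λ v′≤v → absurd v′≤v (≤-total (toℕ v′) (toℕ w))
      where
      absurd : toℕ v′ ≤ toℕ v → (toℕ v′ ≤ toℕ w) ⊎ (toℕ w ≤ toℕ v′) → _
      absurd v′≤v (inj₁ v′≤w) = w≁w′ (interval (p w′) {v′} {w} {w′} v′~w′ refl v′≤w (<⇒≤ w<w′))
      absurd v′≤v (inj₂ w≤v′) = w≁w′ (trans (sym (interval (p w) {w} {v′} {v} refl v~w w≤v′ v′≤v)) v′~w′)
    φ-mono : ∀ {i j} → i Fin.< j → φ i Fin.< φ j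
    φ-mono {i} {j} i<j with p i ≟ p j
    ... | no p≢ = combine-monoˡ-< (coord (p i) i) (coord (p j) j)
                    (intervals-ordered i<j (p-rep (p i)) (p-rep (p j)) p≢)
    ... | yes e = subst (λ q → combine (rep q) (coord q i) Fin.< φ j) (sym e)
                    (combine-monoʳ-< (rep (p j)) (coord-mono (p j) i<j))
    edge : ∀ e → e ∈E H → ∃[ x ] ∃[ y ] ∃[ z ] x ≢ y × x ≢ z × y ≢ z × e ≡ triple x y z × χ (triple (φ x) (φ y) (φ z)) ≡ red
    edge e e∈ with x , y , z , x<y , y<z , refl ← as-triple e (OrderedGraph.uniform H e e∈) = listing (at va) (at vb) (at vc)
      where
      x∈ = ∈-triple⁺ {v = x} {x} {y} {z} (inj₁ refl)
      y∈ = ∈-triple⁺ {v = y} {x} {y} {z} (inj₂ (inj₁ refl))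
      z∈ = ∈-triple⁺ {v = z} {x} {y} {z} (inj₂ (inj₂ refl))
      at : ∀ v → ∃[ w ] w ∈ˢ triple x y z × p w ≡ p v
      at v with three-exhaust m≤3 (λ s → n≮n _ (subst (x Fin.<_) (sym (proper _ e∈ x∈ y∈ s)) x<y))
                                  (λ s → n≮n _ (subst (x Fin.<_) (sym (proper _ e∈ x∈ z∈ s)) (<-trans x<y y<z)))
                                  (λ s → n≮n _ (subst (y Fin.<_) (sym (proper _ e∈ y∈ z∈ s)) y<z)) (p v)
      ... | inj₁ s        = x , x∈ , sym s
      ... | inj₂ (inj₁ s) = y , y∈ , sym s
      ... | inj₂ (inj₂ s) = z , z∈ , sym s
      listing : (∃[ w ] w ∈ˢ triple x y z × p w ≡ p va) → (∃[ w ] w ∈ˢ triple x y z × p w ≡ p vb) →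
        (∃[ w ] w ∈ˢ triple x y z × p w ≡ p vc) →
        ∃[ x′ ] ∃[ y′ ] ∃[ z′ ] x′ ≢ y′ × x′ ≢ z′ × y′ ≢ z′ × triple x y z ≡ triple x′ y′ z′ × χ (triple (φ x′) (φ y′) (φ z′)) ≡ red
      listing (wa , wa∈ , pa) (wb , wb∈ , pb) (wc , wc∈ , pc) =
        wa , wb , wc
        , (λ { refl → ab (trans (sym pa) pb) }) , (λ { refl → ac (trans (sym pa) pc) }) , (λ { refl → bc (trans (sym pb) pc) })
        , ⊆-antisym to from , colour
        where
        to : ∀ {v} → v ∈ˢ triple x y z → v ∈ˢ triple wa wb wc
        to {v} h with three-exhaust m≤3 ab ac bc (p v)
        ... | inj₁ s        = ∈-triple⁺ (inj₁ (proper _ e∈ h wa∈ (trans s (sym pa))))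
        ... | inj₂ (inj₁ s) = ∈-triple⁺ (inj₂ (inj₁ (proper _ e∈ h wb∈ (trans s (sym pb)))))
        ... | inj₂ (inj₂ s) = ∈-triple⁺ (inj₂ (inj₂ (proper _ e∈ h wc∈ (trans s (sym pc)))))
        from : ∀ {v} → v ∈ˢ triple wa wb wc → v ∈ˢ triple x y z
        from h with ∈-triple⁻ h
        ... | inj₁ refl        = wa∈
        ... | inj₂ (inj₁ refl) = wb∈
        ... | inj₂ (inj₂ refl) = wc∈
        colour : χ (triple (φ wa) (φ wb) (φ wc)) ≡ red
        colour rewrite φa pa | φb pb | φc pc = not-blue (isRed (α wa) (β wb) (γ wc) (α∈ wa) (β∈ wb) (γ∈ wc))

-- Decidability of the arrow relation

-- A colouring of the subsets of `Fin (suc N)` amounts to two colourings, one for the subsets with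
-- the first element and one for those without. Colourings are compared pointwise, hence the
-- hypothesis `ext`.
allColourings? : ∀ N (P : (Subset N → Colour) → Set) →
  (∀ {χ χ′} → (∀ e → χ e ≡ χ′ e) → P χ → P χ′) → (∀ χ → Dec (P χ)) → Dec (∀ χ → P χ)
allColourings? zero P ext P? = map′
  (λ (r , b) χ → both χ r b) (λ h → h _ , h _) (P? (λ _ → red) ×-dec P? (λ _ → blue))
  where
  both : ∀ χ → P (λ _ → red) → P (λ _ → blue) → P χ
  both χ r b with χ [] in eq
  ... | red  = ext (λ { [] → sym eq }) r
  ... | blue = ext (λ { [] → sym eq }) b
allColourings? (suc N) P ext P? = map′
  (λ h χ → ext (λ { (true ∷ e) → refl ; (false ∷ e) → refl }) (h (λ e → χ (true ∷ e)) (λ e → χ (false ∷ e))))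
  (λ h χ₁ χ₂ → h (glue χ₁ χ₂))
  (allColourings? N (λ χ₁ → ∀ χ₂ → P (glue χ₁ χ₂))
    (λ eq h χ₂ → ext (λ { (true ∷ e) → eq e ; (false ∷ e) → refl }) (h χ₂))
    (λ χ₁ → allColourings? N (λ χ₂ → P (glue χ₁ χ₂))
      (λ eq → ext (λ { (true ∷ e) → refl ; (false ∷ e) → eq e })) (λ χ₂ → P? (glue χ₁ χ₂))))
  where
  glue : (Subset N → Colour) → (Subset N → Colour) → Subset (suc N) → Colour
  glue χ₁ χ₂ (true  ∷ e) = χ₁ e
  glue χ₁ χ₂ (false ∷ e) = χ₂ e

anyFunction? : ∀ m {n} (P : (Fin m → Fin n) → Set) →
  (∀ {φ ψ} → (∀ i → φ i ≡ ψ i) → P φ → P ψ) → (∀ φ → Dec (P φ)) → Dec (∃[ φ ] P φ)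
anyFunction? zero {n} P ext P? = map′ (λ p → none , p) (λ (φ , p) → ext (λ ()) p) (P? none)
  where
  none : Fin 0 → Fin n
  none ()
anyFunction? (suc m) {n} P ext P? = map′
  (λ (x , φ , p) → cons x φ , p)
  (λ (φ , p) → φ zero , (λ i → φ (suc i)) , ext (λ { zero → refl ; (suc i) → refl }) p)
  (any? λ x → anyFunction? m (λ φ → P (cons x φ))
    (λ eq → ext (λ { zero → refl ; (suc i) → eq i })) (λ φ → P? (cons x φ)))
  where
  cons : Fin n → (Fin m → Fin n) → Fin (suc m) → Fin n
  cons x φ zero    = x
  cons x φ (suc i) = φ i

allSubsets? : ∀ {n} {P : Subset n → Set} → (∀ e → Dec (P e)) → Dec (∀ e → P e)
allSubsets? P? = map′ (λ h e → decidable-stable (P? e) (λ ¬p → h (e , ¬p))) (λ h (e , ¬p) → ¬p (h e))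
  (¬? (anySubset? (λ e → ¬? (P? e))))

image-cong : ∀ {m n} {φ ψ : Fin m → Fin n} → (∀ i → φ i ≡ ψ i) → ∀ e → image φ e ≡ image ψ e
image-cong {φ = φ} {ψ} eq e = ⊆-antisym (sub φ ψ eq) (sub ψ φ (λ i → sym (eq i)))
  where
  sub : ∀ (φ ψ : _) → (∀ i → φ i ≡ ψ i) → ∀ {j} → j ∈ˢ image φ e → j ∈ˢ image ψ e
  sub φ ψ eq h with i , i∈ , refl ← ∈-image⁻ φ e h = subst (_∈ˢ image ψ e) (sym (eq i)) (∈-image⁺ ψ e i∈)

contains? : ∀ {k m n} (G : OrderedGraph k n) (H : OrderedGraph k m) → Dec (Contains G H)
contains? {k} {m} {n} G H = anyFunction? m IsCopy copy-ext copy?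
  where
  IsCopy : (Fin m → Fin n) → Set
  IsCopy φ = Injective _≡_ _≡_ φ × φ Preserves Fin._≤_ ⟶ Fin._≤_ × (∀ e → e ∈E H → image φ e ∈E G)
  copy-ext : ∀ {φ ψ} → (∀ i → φ i ≡ ψ i) → IsCopy φ → IsCopy ψ
  copy-ext eq (inj , mono , edge) =
    (λ {x} {y} h → inj (trans (eq x) (trans h (sym (eq y)))))
    , (λ {x} {y} h → subst₂ Fin._≤_ (eq x) (eq y) (mono h))
    , (λ e h → subst (_∈E G) (image-cong eq e) (edge e h))
  copy? : ∀ φ → Dec (IsCopy φ)
  copy? φ =
    map′ (λ h {x} {y} → h x y) (λ h x y → h {x} {y}) (all? λ x → all? λ y → (φ x Fin.≟ φ y) →-dec (x Fin.≟ y))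
    ×-dec map′ (λ h {x} {y} → h x y) (λ h x y → h {x} {y}) (all? λ x → all? λ y → (x Fin.≤? y) →-dec (φ x Fin.≤? φ y))
    ×-dec allSubsets? (λ e → T? (OrderedGraph.edge? H e) →-dec T? (OrderedGraph.edge? G (image φ e)))

-- The Ramsey number is defined as a least element. To produce it from an upper bound, the search
-- below that bound must be able to decide each value.
arrows? : ∀ {k m n} (G : OrderedGraph k m) (H : OrderedGraph k n) N → Dec (Arrows G H N)
arrows? {k} G H N = allColourings? N (λ χ → Contains (colourClass k χ blue) G ⊎ Contains (colourClass k χ red) H)
  (λ { eq (inj₁ c) → inj₁ (recolour {F = G} eq c) ; eq (inj₂ c) → inj₂ (recolour {F = H} eq c) })
  (λ χ → contains? (colourClass k χ blue) G ⊎-dec contains? (colourClass k χ red) H)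
  where
  recolour : ∀ {χ χ′ c m} {F : OrderedGraph k m} → (∀ e → χ e ≡ χ′ e) →
    Contains (colourClass k {N} χ c) F → Contains (colourClass k χ′ c) F
  recolour {χ} {χ′} {c} eq (φ , inj , mono , edge) = φ , inj , mono , λ e h →
    let size , col = toWitness {a? = (∣ image φ e ∣ ℕ.≟ k) ×-dec (χ (image φ e) ≟ᶜ c)} (edge e h)
    in fromWitness (size , trans (sym (eq (image φ e))) col)

least : ∀ {P : ℕ → Set} → (∀ k → Dec (P k)) → ∀ {N} → P N → ∃[ r ] IsLeast P r × r ≤ N
least {P} P? {N} p = go (search N)
  where
  search : ∀ k → (∃[ r ] IsLeast P r × r < k) ⊎ (∀ {j} → P j → k ≤ j)
  search zero    = inj₂ (λ _ → z≤n)
  search (suc k) with search k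
  ... | inj₁ (r , least-r , r<k) = inj₁ (r , least-r , ℕ.s≤s (<⇒≤ r<k))
  ... | inj₂ none with P? k
  ...   | yes pk = inj₁ (k , (pk , none) , ≤-refl)
  ...   | no ¬pk = inj₂ above
    where
    above : ∀ {j} → P j → suc k ≤ j
    above {j} pj with m≤n⇒m<n∨m≡n (none pj)
    ... | inj₁ lt   = lt
    ... | inj₂ refl with () ← ¬pk pj
  go : (∃[ r ] IsLeast P r × r < N) ⊎ (∀ {j} → P j → N ≤ j) → ∃[ r ] IsLeast P r × r ≤ N
  go (inj₁ (r , least-r , r<N)) = r , least-r , <⇒≤ r<N
  go (inj₂ none) = N , (p , none) , ≤-refl

-- Choice of the parameters

n<2^n : ∀ n → n < 2 ^ n
n<2^n zero    = s≤s z≤n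
n<2^n (suc n) = begin-strict
  suc n          ≡⟨ +-comm 1 n ⟩
  n + 1          <⟨ +-mono-<-≤ (n<2^n n) (^-pos n (s≤s z≤n)) ⟩
  2 ^ n + 2 ^ n  ≡⟨ cong (λ x → 2 ^ n + x) (sym (+-identityʳ _)) ⟩
  2 ^ suc n      ∎
  where open ≤-Reasoning

1≤2^ : ∀ k → 1 ≤ 2 ^ k
1≤2^ k = ^-pos k (s≤s z≤n)

logarithm : ∀ b n → 2 ≤ b → 1 ≤ n → ∃[ a ] b ^ a ≤ n × n < b ^ suc a
logarithm b n 2≤b 1≤n = descend n (≤-trans (n<2^n n) (^-monoˡ-≤ n 2≤b))
  where
  descend : ∀ k → n < b ^ k → ∃[ a ] b ^ a ≤ n × n < b ^ suc a
  descend zero    h = contradiction (≤-trans h 1≤n) (n≮n _)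
  descend (suc k) h with b ^ k ℕ.≤? n
  ... | yes le = k , le , h
  ... | no gt  = descend k (≰⇒> gt)

redBox-mono : ∀ {M n n₀} {L : Fin M → Fin M → Fin M → Bool} → n ≤ n₀ → RedBox n₀ L → RedBox n L
redBox-mono le (X , Y , Z , hX , hY , hZ , isRed) = X , Y , Z , ≤-trans le hX , ≤-trans le hY , ≤-trans le hZ , isRed

-- A record, so that the exponents can be inferred.
record _≡2^_ (x e : ℕ) : Set where
  constructor exact
  field
    power-eq : x ≡ 2 ^ e

open _≡2^_

infixl 6 _⊗_

_⊗_ : ∀ {x y e f} → x ≡2^ e → y ≡2^ f → (x * y) ≡2^ (e + f)
_⊗_ {e = e} {f} (exact p) (exact q) = exact (trans (cong₂ _*_ p q) (sym (^-distribˡ-+-* 2 e f)))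

_↑_ : ∀ {x e} → x ≡2^ e → ∀ k → (x ^ k) ≡2^ (e * k)
_↑_ {e = e} (exact p) k = exact (trans (cong (_^ k) p) (^-*-assoc 2 e k))

infixr 3 _then_

_then_ : ∀ {x y e} → x ≡ y → y ≡2^ e → x ≡2^ e
p then exact q = exact (trans p q)

2^ᵖ : ∀ e → (2 ^ e) ≡2^ e
2^ᵖ e = exact refl

-- In the application n₀ = 2^(a + c) is n up to a constant factor and 2^a is about n^(1/(5d)). Each
-- tuple loses a factor 1 - 1/2^(a+1), and R = M / s absorbs the shrinking of the candidate sets.
module Parameters (d a c : ℕ) (n₀ h g μ κ w ℓ R G τ P ω s M K : ℕ)
  (n₀≡ : n₀ ≡ 2 ^ (a + c)) (h≡ : h ≡ 2 ^ a) (g≡ : g ≡ 2 ^ c) (sucμ : suc μ ≡ 2 * h) (κ≡ : κ ≡ 4 * h)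
  (w≡ : w ≡ 8 * (2 * (2 * h)) * κ) (ℓ≡ : ℓ ≡ 2 * w ^ d * κ) (R≡ : R ≡ 2 * (8 ^ d * w ^ d))
  (G≡ : G ≡ 2 ^ g * R) (τ≡ : τ ≡ 4 * G * n₀ * (2 * R ^ ℓ) ^ n₀)
  (P≡ : P ≡ 2 * (4 * G) ^ n₀ * ℓ ^ n₀ * n₀) (ω≡ : ω ≡ τ * (n₀ * n₀) * P)
  (s≡ : s ≡ 2 ^ g * ω) (M≡ : M ≡ s * R) (K≡ : K ≡ 2 * (8 ^ d * s)) where

  private
    pos : ∀ {x y} → x ≡ y → 0 < y → 0 < x
    pos e h = subst (0 <_) (sym e) h

    4*-pos : ∀ {x} → 0 < x → 0 < 4 * x
    4*-pos = *-mono-≤ (s≤s {n = 3} z≤n)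

    2*-pos : ∀ {x} → 0 < x → 0 < 2 * x
    2*-pos = *-mono-≤ (s≤s {n = 1} z≤n)

  0<h : 0 < h
  0<h = pos h≡ (1≤2^ a)

  0<n₀ : 0 < n₀
  0<n₀ = pos n₀≡ (1≤2^ (a + c))

  0<μ : 0 < μ
  0<μ = ≤-pred (subst (2 ≤_) (sym sucμ) (*-monoʳ-≤ 2 0<h))

  0<κ : 0 < κ
  0<κ = pos κ≡ (4*-pos 0<h)

  0<w : 0 < w
  0<w = pos w≡ (*-mono-≤ (*-mono-≤ (s≤s {n = 7} z≤n) (2*-pos (2*-pos 0<h))) 0<κ)

  0<ℓ : 0 < ℓ
  0<ℓ = pos ℓ≡ (*-mono-≤ (2*-pos (^-pos d 0<w)) 0<κ)

  0<8^d : 0 < 8 ^ d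
  0<8^d = ^-pos d (s≤s z≤n)

  0<R : 0 < R
  0<R = pos R≡ (2*-pos (*-mono-≤ 0<8^d (^-pos d 0<w)))

  0<G : 0 < G
  0<G = pos G≡ (*-mono-≤ (1≤2^ g) 0<R)

  0<τ : 0 < τ
  0<τ = pos τ≡ (*-mono-≤ (*-mono-≤ (4*-pos 0<G) 0<n₀) (^-pos n₀ (2*-pos (^-pos ℓ 0<R))))

  0<P : 0 < P
  0<P = pos P≡ (*-mono-≤ (*-mono-≤ (2*-pos (^-pos n₀ (4*-pos 0<G))) (^-pos n₀ 0<ℓ)) 0<n₀)

  0<ω : 0 < ω
  0<ω = pos ω≡ (*-mono-≤ (*-mono-≤ 0<τ (*-mono-≤ 0<n₀ 0<n₀)) 0<P)

  0<s : 0 < s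
  0<s = pos s≡ (*-mono-≤ (1≤2^ g) 0<ω)

  0<M : 0 < M
  0<M = pos M≡ (*-mono-≤ 0<s 0<R)

  grows : ∀ x y → 0 < y → x ≤ y * x
  grows x y h = m≤n*m x y {{>-nonZero h}}

  -- `ω` has to dominate `P`, for the last step of the red box, and n₀² τ, for the union bound over
  -- pairs. Taking the product rather than a maximum keeps all parameters powers of 2.
  P≤ω : P ≤ ω
  P≤ω = ≤-trans (grows P (τ * (n₀ * n₀)) (*-mono-≤ 0<τ (*-mono-≤ 0<n₀ 0<n₀))) (≤-reflexive (sym ω≡))

  ω≤s : ω ≤ s
  ω≤s = ≤-trans (grows ω (2 ^ g) (1≤2^ g)) (≤-reflexive (sym s≡))

  self-power : ∀ x → 0 < x → x ≤ x ^ n₀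
  self-power x 0<x = ≤-trans (≤-reflexive (sym (*-identityʳ x))) (^-monoʳ-≤ x {{>-nonZero 0<x}} 0<n₀)

  ℓ-mono : ∀ {j} → j ≤ d → 2 * w ^ j * κ ≤ ℓ
  ℓ-mono j≤d = ≤-trans (*-monoˡ-≤ κ (*-monoʳ-≤ 2 (^-monoʳ-≤ w {{>-nonZero 0<w}} j≤d))) (≤-reflexive (sym ℓ≡))

  κ-large : 2 * (2 * suc μ) ≤ 2 ^ κ
  κ-large = begin
    2 * (2 * suc μ)         ≡⟨ cong (λ x → 2 * (2 * x)) sucμ ⟩
    2 * (2 * (2 * h))       ≡⟨ cong (λ x → 2 * (2 * (2 * x))) h≡ ⟩
    2 ^ (3 + a)             ≤⟨ ^-monoʳ-≤ 2 (begin
      3 + a                   ≡⟨ sym (+-suc 2 a) ⟩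
      2 + suc a               ≤⟨ +-mono-≤ (*-mono-≤ (≤-refl {2}) 0<h) (subst (a <_) (sym h≡) (n<2^n a)) ⟩
      2 * h + h               ≤⟨ m≤m+n _ h ⟩
      2 * h + h + h           ≡⟨ trans (four h) (sym κ≡) ⟩
      κ                       ∎) ⟩
    2 ^ κ                   ∎
    where
    open ≤-Reasoning
    four : ∀ h → 2 * h + h + h ≡ 4 * h
    four = solve-∀

  s-large : ∀ {j} → j ≤ d → 2 * w ^ j * (n₀ * (2 * w ^ j * κ)) ≤ s
  s-large {j} j≤d = begin
    2 * w ^ j * (n₀ * (2 * w ^ j * κ))  ≤⟨ *-mono-≤ (*-monoʳ-≤ 2 (^-monoʳ-≤ w {{>-nonZero 0<w}} j≤d)) (*-monoʳ-≤ n₀ (ℓ-mono j≤d)) ⟩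
    2 * w ^ d * (n₀ * ℓ)                ≤⟨ *-monoˡ-≤ (n₀ * ℓ) (*-monoʳ-≤ 2 w^d≤4G) ⟩
    2 * (4 * G) * (n₀ * ℓ)              ≤⟨ *-mono-≤ (*-monoʳ-≤ 2 (self-power (4 * G) (*-mono-≤ (s≤s {n = 3} z≤n) 0<G)))
                                                    (*-monoʳ-≤ n₀ (self-power ℓ 0<ℓ)) ⟩
    2 * (4 * G) ^ n₀ * (n₀ * ℓ ^ n₀)    ≡⟨ trans (assoc (2 * (4 * G) ^ n₀) n₀ (ℓ ^ n₀)) (sym P≡) ⟩
    P                                   ≤⟨ ≤-trans P≤ω ω≤s ⟩
    s                                   ∎
    where
    open ≤-Reasoning
    assoc : ∀ x n l → x * (n * l) ≡ x * l * n
    assoc = solve-∀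
    w^d≤4G : w ^ d ≤ 4 * G
    w^d≤4G = begin
      w ^ d                  ≤⟨ grows (w ^ d) (8 ^ d) (^-pos d (s≤s z≤n)) ⟩
      8 ^ d * w ^ d          ≤⟨ m≤n*m (8 ^ d * w ^ d) 2 ⟩
      2 * (8 ^ d * w ^ d)    ≡⟨ sym R≡ ⟩
      R                      ≤⟨ grows R (2 ^ g) (1≤2^ g) ⟩
      2 ^ g * R              ≡⟨ sym G≡ ⟩
      G                      ≤⟨ m≤n*m G 4 ⟩
      4 * G                  ∎

  ω-large : ∀ {j} → j ≤ d → 2 * (4 * G) ^ n₀ * (2 * w ^ j * κ) ^ n₀ * n₀ ≤ ω
  ω-large j≤d = ≤-trans (≤-trans (*-monoˡ-≤ n₀ (*-monoʳ-≤ (2 * (4 * G) ^ n₀) (^-monoˡ-≤ n₀ (ℓ-mono j≤d)))) (≤-reflexive (sym P≡))) P≤ω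

  τ-large : ∀ {j} → j ≤ d → 4 * G * n₀ * (2 * R ^ (2 * w ^ j * κ)) ^ n₀ ≤ τ
  τ-large j≤d = ≤-trans (*-monoʳ-≤ (4 * G * n₀) (^-monoˡ-≤ n₀ (*-monoʳ-≤ 2 (^-monoʳ-≤ R {{>-nonZero 0<R}} (ℓ-mono j≤d))))) (≤-reflexive (sym τ≡))

  redBox : ∀ j → j ≤ d → (B : Fin M → Fin M → Bool) (L : Fin M → Fin M → Fin M → Bool) →
    Dense (4 ^ j * s) (w ^ j) B → τ ≤ #Fin (bad B L (w ^ j) w (4 ^ j * s)) → RedBox n₀ L
  redBox j j≤d B L dense many = many-bad⇒redBox B L (w ^ j) w (4 ^ j * s) κ s ω R μ h g n₀
    M≡ s≡ n₀≡hg sucμ (trans w≡ (cong (λ x → 8 * (2 * x) * κ) (sym sucμ))) κ-large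
    0<ω (^-pos j 0<w) 0<μ 0<h 0<n₀ (grows s (4 ^ j) (^-pos j (s≤s z≤n))) (s-large j≤d)
    (subst (λ G → 2 * (4 * G) ^ n₀ * (2 * w ^ j * κ) ^ n₀ * n₀ ≤ ω) G≡ (ω-large j≤d)) 0<R
    (≤-trans (subst (λ G → 4 * G * n₀ * (2 * R ^ (2 * w ^ j * κ)) ^ n₀ ≤ τ) G≡ (τ-large j≤d)) many) dense
    where
    n₀≡hg : n₀ ≡ h * g
    n₀≡hg = trans n₀≡ (trans (^-distribˡ-+-* 2 a c) (cong₂ _*_ (sym h≡) (sym g≡)))

  -- `R` is defined so that equality holds: a candidate set loses at most w^d in total and ends with
  -- at least `K` vertices.
  K-size : w ^ d * K ≤ M
  K-size = ≤-reflexive (trans (cong (λ x → w ^ d * x) K≡) (trans (assoc (w ^ d) (8 ^ d) s) (trans (cong (λ x → s * x) (sym R≡)) (sym M≡))))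
    where
    assoc : ∀ w e s → w * (2 * (e * s)) ≡ s * (2 * (e * w))
    assoc = solve-∀

  4^d≤8^d : 4 ^ d ≤ 8 ^ d
  4^d≤8^d = ^-monoˡ-≤ d (s≤s (s≤s (s≤s (s≤s z≤n))))

  s≤K : 4 ^ d * s ≤ K
  s≤K = ≤-trans (*-monoˡ-≤ s 4^d≤8^d) (≤-trans (m≤n*m (8 ^ d * s) 2) (≤-reflexive (sym K≡)))

  -- Low degrees exclude d · 4^d s vertices and all pairs together at most another 4^d s. The factor
  -- 8^d in `K` comes from (d+1) 4^d ≤ 2^d 4^d, and the factor 2 makes the inequality strict.
  K-large : ∀ {n} → n ≤ n₀ → d * (4 ^ d * s) + n * (n * τ) < K
  K-large {n} n≤n₀ = begin-strict
    d * (4 ^ d * s) + n * (n * τ)    ≤⟨ +-monoʳ-≤ (d * (4 ^ d * s)) (begin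
      n * (n * τ)                      ≤⟨ *-mono-≤ n≤n₀ (*-monoˡ-≤ τ n≤n₀) ⟩
      n₀ * (n₀ * τ)                    ≡⟨ e₁ n₀ τ ⟩
      τ * (n₀ * n₀)                    ≤⟨ m≤m*n (τ * (n₀ * n₀)) P {{>-nonZero 0<P}} ⟩
      τ * (n₀ * n₀) * P                ≡⟨ sym ω≡ ⟩
      ω                                ≤⟨ ω≤s ⟩
      s                                ≤⟨ grows s (4 ^ d) (^-pos d (s≤s z≤n)) ⟩
      4 ^ d * s                        ∎) ⟩
    d * (4 ^ d * s) + 4 ^ d * s      ≡⟨ e₂ d (4 ^ d * s) ⟩
    suc d * (4 ^ d * s)              ≤⟨ *-monoˡ-≤ (4 ^ d * s) (n<2^n d) ⟩
    2 ^ d * (4 ^ d * s)              ≡⟨ sym (*-assoc (2 ^ d) (4 ^ d) s) ⟩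
    2 ^ d * 4 ^ d * s                ≡⟨ cong (_* s) (sym (^-distribʳ-* 2 4 d)) ⟩
    8 ^ d * s                        <⟨ m<m+n (8 ^ d * s) (*-mono-≤ (*-mono-≤ 0<8^d 0<s) (≤-refl {1})) ⟩
    8 ^ d * s + 8 ^ d * s * 1        ≡⟨ trans (e₃ (8 ^ d * s)) (sym K≡) ⟩
    K                                ∎
    where
    open ≤-Reasoning
    e₁ : ∀ n t → n * (n * t) ≡ t * (n * n)
    e₁ = solve-∀
    e₂ : ∀ d x → d * x + x ≡ suc d * x
    e₂ = solve-∀
    e₃ : ∀ x → x + x * 1 ≡ 2 * x
    e₃ = solve-∀

  arrows : ∀ {n} (H : OrderedGraph 3 n) → n ≤ n₀ → WeaklyDegenerate d H → ∀ {m} → m ≤ 3 → IntervalColourable H m →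
    Arrows H H (n * M)
  arrows {n} H n≤n₀ (u , degenerate) m≤3 colouring χ =
    result (greedy-embedding (rankedEdge H u) (blueTriple H u χ) d s w n₀ τ K 0<s 0<w 0<M redBox
             (load≤d H u degenerate) (degree≤d H u degenerate) K-size (K-large n≤n₀) s≤K)
    where
    result : RedEdge (rankedEdge H u) (blueTriple H u χ) d s w n₀ τ K
      ⊎ (Σ (Fin n → Fin M) λ f → ∀ a b c → toℕ a < toℕ b → toℕ b < toℕ c →
          rankedEdge H u a b c ≡ true → blueTriple H u χ a b c (f a) (f b) (f c) ≡ true) →
      Contains (colourClass 3 χ blue) H ⊎ Contains (colourClass 3 χ red) H
    result (inj₁ (a′ , b , c′ , a<b , b<c , e , box)) =
      inj₂ (red-copy H u χ m≤3 colouring a′ b c′ e a<b b<c (redBox-mono n≤n₀ box))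
    result (inj₂ (f , isBlue)) = inj₁ (blue-copy H u χ f isBlue)

  -- Left unsimplified: these are the exponents that `⊗` and `↑` produce along the definitions of
  -- the parameters.
  log-w log-ℓ log-R log-M : ℕ
  log-w = 3 + (1 + (1 + a)) + (2 + a)
  log-ℓ = 1 + log-w * d + (2 + a)
  log-R = 1 + (3 * d + log-w * d)
  log-M = g + ((2 + (g + log-R) + (a + c) + (1 + log-R * ℓ) * n₀) + ((a + c) + (a + c))
    + (1 + (2 + (g + log-R)) * n₀ + log-ℓ * n₀ + (a + c))) + log-R

  private
    h-power : h ≡2^ a
    h-power = exact h≡

    n₀-power : n₀ ≡2^ (a + c)
    n₀-power = exact n₀≡

    κ-power : κ ≡2^ (2 + a)
    κ-power = κ≡ then 2^ᵖ 2 ⊗ h-power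

    w-power : w ≡2^ log-w
    w-power = w≡ then 2^ᵖ 3 ⊗ (2^ᵖ 1 ⊗ (2^ᵖ 1 ⊗ h-power)) ⊗ κ-power

    ℓ-power : ℓ ≡2^ log-ℓ
    ℓ-power = ℓ≡ then 2^ᵖ 1 ⊗ (w-power ↑ d) ⊗ κ-power

    R-power : R ≡2^ log-R
    R-power = R≡ then 2^ᵖ 1 ⊗ ((2^ᵖ 3 ↑ d) ⊗ (w-power ↑ d))

    G-power : G ≡2^ (g + log-R)
    G-power = G≡ then 2^ᵖ g ⊗ R-power

    τ-power : τ ≡2^ (2 + (g + log-R) + (a + c) + (1 + log-R * ℓ) * n₀)
    τ-power = τ≡ then 2^ᵖ 2 ⊗ G-power ⊗ n₀-power ⊗ ((2^ᵖ 1 ⊗ (R-power ↑ ℓ)) ↑ n₀)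

    P-power : P ≡2^ (1 + (2 + (g + log-R)) * n₀ + log-ℓ * n₀ + (a + c))
    P-power = P≡ then 2^ᵖ 1 ⊗ ((2^ᵖ 2 ⊗ G-power) ↑ n₀) ⊗ (ℓ-power ↑ n₀) ⊗ n₀-power

    M-power : M ≡2^ log-M
    M-power = M≡ then (s≡ then 2^ᵖ g ⊗ (ω≡ then τ-power ⊗ (n₀-power ⊗ n₀-power) ⊗ P-power)) ⊗ R-power

  -- This is where the choice of the tuples is balanced against the intersections. For fixed d,
  -- `log-R` is linear in a and so at most a constant times h, while ℓ is a constant times h^(2d+1).
  -- The product is of order h^(2d+2), and the hypothesis on c says precisely that h^(2d+2) ≤ g.
  log-R*ℓ≤ : 2 * (a * d) + 2 * a ≤ c → log-R * ℓ ≤ (1 + 12 * d) * 2 ^ (3 + 7 * d) * g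
  log-R*ℓ≤ c-large = begin
    log-R * ℓ                                                    ≤⟨ *-mono-≤ log-R≤ (≤-reflexive ℓ-split) ⟩
    (1 + 12 * d) * h * (2 ^ (3 + 7 * d) * 2 ^ (2 * (a * d) + a)) ≡⟨ e₁ (1 + 12 * d) h (2 ^ (3 + 7 * d)) (2 ^ (2 * (a * d) + a)) ⟩
    (1 + 12 * d) * 2 ^ (3 + 7 * d) * (2 ^ (2 * (a * d) + a) * h) ≡⟨ cong (λ x → (1 + 12 * d) * 2 ^ (3 + 7 * d) * x) (power-eq (2^ᵖ (2 * (a * d) + a) ⊗ h-power)) ⟩
    (1 + 12 * d) * 2 ^ (3 + 7 * d) * 2 ^ (2 * (a * d) + a + a)   ≤⟨ *-monoʳ-≤ ((1 + 12 * d) * 2 ^ (3 + 7 * d))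
      (^-monoʳ-≤ 2 (≤-trans (≤-reflexive (e₂ a d)) c-large)) ⟩
    (1 + 12 * d) * 2 ^ (3 + 7 * d) * 2 ^ c                       ≡⟨ cong (λ x → (1 + 12 * d) * 2 ^ (3 + 7 * d) * x) (sym g≡) ⟩
    (1 + 12 * d) * 2 ^ (3 + 7 * d) * g                           ∎
    where
    open ≤-Reasoning
    e₁ : ∀ x h y z → x * h * (y * z) ≡ x * y * (z * h)
    e₁ = solve-∀
    e₂ : ∀ a d → 2 * (a * d) + a + a ≡ 2 * (a * d) + 2 * a
    e₂ = solve-∀
    e₃ : ∀ a d → 1 + (3 + (1 + (1 + a)) + (2 + a)) * d + (2 + a) ≡ (3 + 7 * d) + (2 * (a * d) + a)
    e₃ = solve-∀
    e₄ : ∀ a d → 1 + (3 * d + (3 + (1 + (1 + a)) + (2 + a)) * d) ≡ (1 + 10 * d) * 1 + 2 * d * a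
    e₄ = solve-∀
    e₅ : ∀ d h → (1 + 10 * d) * h + 2 * d * h ≡ (1 + 12 * d) * h
    e₅ = solve-∀
    ℓ-split : ℓ ≡ 2 ^ (3 + 7 * d) * 2 ^ (2 * (a * d) + a)
    ℓ-split = trans (power-eq ℓ-power) (trans (cong (2 ^_) (e₃ a d)) (^-distribˡ-+-* 2 (3 + 7 * d) (2 * (a * d) + a)))
    a≤h : a ≤ h
    a≤h = subst (a ≤_) (sym h≡) (<⇒≤ (n<2^n a))
    log-R≤ : log-R ≤ (1 + 12 * d) * h
    log-R≤ = begin
      log-R                             ≡⟨ e₄ a d ⟩
      (1 + 10 * d) * 1 + 2 * d * a      ≤⟨ +-mono-≤ (*-monoʳ-≤ (1 + 10 * d) 0<h) (*-monoʳ-≤ (2 * d) a≤h) ⟩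
      (1 + 10 * d) * h + 2 * d * h      ≡⟨ e₅ d h ⟩
      (1 + 12 * d) * h                  ∎

  -- Two terms dominate: n₀ g from the intersections and n₀ · log-R · ℓ from the tuples. All others
  -- are absorbed, the logarithms of parameters by the crude bound e < 2^e where needed. Note that
  -- n₀ g = n₀²/h, which is the gain over n₀².
  log-total≤ : ∀ q → log-R * ℓ ≤ q * g → (a + c) + log-M ≤ (14 + 5 * q) * (n₀ * g)
  log-total≤ q y≤qg = begin
    (a + c) + log-M                                                   ≡⟨ e₁ (a + c) g log-R n₀ ℓ log-ℓ ⟩
    3 + 2 * g + 2 * log-R + 5 * (a + c) + n₀ * (3 + y + g + log-R + log-ℓ)
      ≤⟨ +-mono-≤ (+-mono-≤ (+-mono-≤ (+-mono-≤ (*-monoʳ-≤ 3 1≤total) (*-monoʳ-≤ 2 g≤total)) (*-monoʳ-≤ 2 (≤-trans log-R≤y (grows y n₀ 0<n₀))))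
           (*-monoʳ-≤ 5 (≤-trans ν≤n₀ n₀≤total)))
         (*-monoʳ-≤ n₀ (+-mono-≤ (+-mono-≤ (+-monoˡ-≤ g (+-monoˡ-≤ y (*-monoʳ-≤ 3 0<g))) log-R≤y) log-ℓ≤y)) ⟩
    3 * total + 2 * total + 2 * (n₀ * y) + 5 * total + n₀ * (3 * g + y + g + y + y) ≡⟨ e₂ n₀ g y ⟩
    14 * total + 5 * (n₀ * y)                                             ≤⟨ +-monoʳ-≤ (14 * total) (*-monoʳ-≤ 5 (*-monoʳ-≤ n₀ y≤qg)) ⟩
    14 * total + 5 * (n₀ * (q * g))                                       ≡⟨ e₃ n₀ g q ⟩
    (14 + 5 * q) * total                                                  ∎
    where
    open ≤-Reasoning
    total = n₀ * g
    y = log-R * ℓ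
    0<g : 0 < g
    0<g = pos g≡ (1≤2^ c)
    1≤total : 1 * 1 ≤ total
    1≤total = *-mono-≤ 0<n₀ 0<g
    g≤total : g ≤ total
    g≤total = grows g n₀ 0<n₀
    n₀≤total : n₀ ≤ total
    n₀≤total = m≤m*n n₀ g {{>-nonZero 0<g}}
    ν≤n₀ : a + c ≤ n₀
    ν≤n₀ = subst (a + c ≤_) (sym n₀≡) (<⇒≤ (n<2^n (a + c)))
    log-R≤y : log-R ≤ y
    log-R≤y = m≤m*n log-R ℓ {{>-nonZero 0<ℓ}}
    log-ℓ≤y : log-ℓ ≤ y
    log-ℓ≤y = ≤-trans (subst (log-ℓ ≤_) (sym (power-eq ℓ-power)) (<⇒≤ (n<2^n log-ℓ))) (grows ℓ log-R (s≤s z≤n))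
    e₁ : ∀ v g r n l m →
      v + (g + ((2 + (g + r) + v + (1 + r * l) * n) + (v + v) + (1 + (2 + (g + r)) * n + m * n + v)) + r)
      ≡ 3 + 2 * g + 2 * r + 5 * v + n * (3 + r * l + g + r + m)
    e₁ = solve-∀
    e₂ : ∀ n g y → 3 * (n * g) + 2 * (n * g) + 2 * (n * y) + 5 * (n * g) + n * (3 * g + y + g + y + y)
      ≡ 14 * (n * g) + 5 * (n * y)
    e₂ = solve-∀
    e₃ : ∀ n g q → 14 * (n * g) + 5 * (n * (q * g)) ≡ (14 + 5 * q) * (n * g)
    e₃ = solve-∀

  vertices≤ : ∀ {n} → n ≤ n₀ → 2 * (a * d) + 2 * a ≤ c →
    n * M ≤ 2 ^ ((14 + 5 * ((1 + 12 * d) * 2 ^ (3 + 7 * d))) * (n₀ * g))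
  vertices≤ {n} n≤n₀ c-large = begin
    n * M                    ≤⟨ *-monoˡ-≤ M n≤n₀ ⟩
    n₀ * M                   ≡⟨ power-eq (n₀-power ⊗ M-power) ⟩
    2 ^ ((a + c) + log-M)    ≤⟨ ^-monoʳ-≤ 2 (log-total≤ ((1 + 12 * d) * 2 ^ (3 + 7 * d)) (log-R*ℓ≤ c-large)) ⟩
    2 ^ ((14 + 5 * ((1 + 12 * d) * 2 ^ (3 + 7 * d))) * (n₀ * g)) ∎
    where open ≤-Reasoning

-- The bound on the Ramsey number

open import Data.Integer as ℤ using (+_)
import Data.Integer.Properties as ℤ
open import Data.Rational.Unnormalised as ℚ using (ℚᵘ; mkℚᵘ; Positive; _/_; _-_)
import Data.Rational.Unnormalised.Properties as ℚ

private
  module Q = RawSemiring ℚ.+-*-rawSemiring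

constant : ℕ → ℕ
constant d = 14 + 5 * ((1 + 12 * d) * 2 ^ (3 + 7 * d))

-- With D = suc x, a is the integer part of the logarithm of n to base 2^D, and c is chosen such
-- that a + c = D (a + 1). So n₀ is the next power of 2^D above n, at most 2^D n, and 2^a is n^(1/D)
-- up to a factor 2. The bound 2d + 2 ≤ x provides the balance condition for every a.
ramsey-bound : ∀ d x {n} → 2 * d + 2 ≤ x → 1 ≤ n → (H : OrderedGraph 3 n) → WeaklyDegenerate d H →
  ∀ {m} → m ≤ 3 → IntervalColourable H m →
  ∃[ a ] ∃[ N ] (2 ^ suc x) ^ a ≤ n × Arrows H H N
    × N ≤ 2 ^ (constant d * (2 ^ (a + (1 + suc a * x)) * 2 ^ (1 + suc a * x)))
ramsey-bound d x {n} x-large 1≤n H degenerate m≤3 colouring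
  with a , a-low , a-high ← logarithm (2 ^ suc x) n (*-mono-≤ (≤-refl {2}) (1≤2^ x)) 1≤n =
  a , at a (1 + suc a * x) (2 ^ (a + (1 + suc a * x))) (2 ^ a) (2 ^ (1 + suc a * x)) refl refl refl a-low (n≤n₀ a a-high) (c-large a)
  where
  n≤n₀ : ∀ a → n < (2 ^ suc x) ^ suc a → n ≤ 2 ^ (a + (1 + suc a * x))
  n≤n₀ a a-high = ≤-trans (<⇒≤ a-high) (≤-reflexive (trans (^-*-assoc 2 (suc x) (suc a)) (cong (2 ^_) (e₁ a x))))
    where
    e₁ : ∀ a x → suc x * suc a ≡ a + (1 + suc a * x)
    e₁ = solve-∀
  c-large : ∀ a → 2 * (a * d) + 2 * a ≤ 1 + suc a * x
  c-large a = ≤-trans (≤-reflexive (e₂ a d)) (≤-trans (*-monoʳ-≤ a x-large) (≤-trans (m≤n+m (a * x) x) (n≤1+n _)))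
    where
    e₂ : ∀ a d → 2 * (a * d) + 2 * a ≡ a * (2 * d + 2)
    e₂ = solve-∀
  at : ∀ a c n₀ h g → n₀ ≡ 2 ^ (a + c) → h ≡ 2 ^ a → g ≡ 2 ^ c → (2 ^ suc x) ^ a ≤ n → n ≤ n₀ → 2 * (a * d) + 2 * a ≤ c →
    ∃[ N ] (2 ^ suc x) ^ a ≤ n × Arrows H H N × N ≤ 2 ^ (constant d * (n₀ * g))
  at a c n₀ h g n₀≡ h≡ g≡ a-low n≤n₀ c-large = _ , a-low
    , Parameters.arrows d a c n₀ h g (2 * h ∸ 1) _ _ _ _ _ _ _ _ _ _ _ n₀≡ h≡ g≡ sucμ refl refl refl refl refl refl refl refl refl refl refl
        H n≤n₀ degenerate m≤3 colouring
    , Parameters.vertices≤ d a c n₀ h g (2 * h ∸ 1) _ _ _ _ _ _ _ _ _ _ _ n₀≡ h≡ g≡ sucμ refl refl refl refl refl refl refl refl refl refl refl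
        n≤n₀ c-large
    where
    sucμ : suc (2 * h ∸ 1) ≡ 2 * h
    sucμ = suc-pred (2 * h) {{>-nonZero (*-mono-≤ (s≤s {n = 1} z≤n) (subst (1 ≤_) (sym h≡) (1≤2^ a)))}}

-- With D = suc x, the two powers of 2 on the left have product 2^(2 (a + 1) D - a), whose D-th
-- power is 4^(D D) (2^(D a))^(2 D - 1).
exponent-bound : ∀ x a n C → (2 ^ suc x) ^ a ≤ n →
  (C * (2 ^ (a + (1 + suc a * x)) * 2 ^ (1 + suc a * x))) ^ suc x
    ≤ (C * 2 ^ (2 * suc x)) ^ suc x * n ^ (x + suc x)
exponent-bound x a n C low = begin
  (C * (2 ^ (a + c) * 2 ^ c)) ^ D          ≡⟨ ^-distribʳ-* C (2 ^ (a + c) * 2 ^ c) D ⟩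
  C ^ D * (2 ^ (a + c) * 2 ^ c) ^ D        ≡⟨ cong (λ y → C ^ D * y) shape ⟩
  C ^ D * ((2 ^ (2 * D)) ^ D * q ^ (x + D)) ≡⟨ sym (*-assoc (C ^ D) ((2 ^ (2 * D)) ^ D) (q ^ (x + D))) ⟩
  C ^ D * (2 ^ (2 * D)) ^ D * q ^ (x + D)  ≡⟨ cong (λ y → y * q ^ (x + D)) (sym (^-distribʳ-* C (2 ^ (2 * D)) D)) ⟩
  (C * 2 ^ (2 * D)) ^ D * q ^ (x + D)      ≤⟨ *-monoʳ-≤ ((C * 2 ^ (2 * D)) ^ D) (^-monoˡ-≤ (x + D) low) ⟩
  (C * 2 ^ (2 * D)) ^ D * n ^ (x + D)      ∎
  where
  open ≤-Reasoning
  D = suc x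
  c = 1 + suc a * x
  q = (2 ^ D) ^ a
  e₁ : ∀ x a → (a + (1 + suc a * x) + (1 + suc a * x)) * suc x ≡ 2 * suc x * suc x + suc x * a * (x + suc x)
  e₁ = solve-∀
  lhs : ((2 ^ (a + c) * 2 ^ c) ^ D) ≡2^ ((a + c + c) * D)
  lhs = (2^ᵖ (a + c) ⊗ 2^ᵖ c) ↑ D
  rhs : ((2 ^ (2 * D)) ^ D * q ^ (x + D)) ≡2^ (2 * D * D + D * a * (x + D))
  rhs = (2^ᵖ (2 * D) ↑ D) ⊗ ((2^ᵖ D ↑ a) ↑ (x + D))
  shape : (2 ^ (a + c) * 2 ^ c) ^ D ≡ (2 ^ (2 * D)) ^ D * q ^ (x + D)
  shape = trans (_≡2^_.power-eq lhs) (trans (cong (2 ^_) (e₁ x a)) (sym (_≡2^_.power-eq rhs)))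

-- From integer powers to rational exponents

power-reflects-≤ : ∀ {x y} k → x ^ suc k ≤ y ^ suc k → x ≤ y
power-reflects-≤ k h = ≮⇒≥ λ y<x → n≮n _ (≤-trans (^-monoˡ-< (suc k) y<x) h)

fraction-power : ∀ x y k → mkℚᵘ (+ x) y Q.^ k ≡ mkℚᵘ (+ (x ^ k)) (pred (suc y ^ k))
fraction-power x y zero    = refl
fraction-power x y (suc k) rewrite fraction-power x y k = cong₂ mkℚᵘ (sym (ℤ.pos-* x (x ^ k)))
  (cong (λ z → pred (suc y * z)) (suc-pred (suc y ^ k) {{>-nonZero (^-pos k (s≤s z≤n))}}))

clear-denominators : ∀ c n s t x A →
  mkℚᵘ (+ c) 0 Q.^ suc x ℚ.* mkℚᵘ (+ n) 0 Q.^ A ℚ.≤ mkℚᵘ (+ s) t Q.^ suc x →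
  c ^ suc x * n ^ A * suc t ^ suc x ≤ s ^ suc x
clear-denominators c n s t x A h
  rewrite fraction-power c 0 (suc x) | fraction-power n 0 A | fraction-power s t (suc x)
        | ^-zeroˡ x | ^-zeroˡ A = ℤ.drop‿+≤+ (subst₂ ℤ._≤_ left right (ℚ.drop-*≤* h))
  where
  left : + (c ^ suc x) ℤ.* + (n ^ A) ℤ.* + suc (pred (suc t ^ suc x)) ≡ + (c ^ suc x * n ^ A * suc t ^ suc x)
  left rewrite suc-pred (suc t ^ suc x) {{>-nonZero (^-pos (suc x) (s≤s z≤n))}} =
    trans (cong (ℤ._* + (suc t ^ suc x)) (sym (ℤ.pos-* (c ^ suc x) (n ^ A)))) (sym (ℤ.pos-* (c ^ suc x * n ^ A) (suc t ^ suc x)))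
  right : + (s ^ suc x) ℤ.* + 1 ≡ + (s ^ suc x)
  right = ℤ.*-identityʳ _

-- The exponent c n^(2 - 1/D), with D = suc x, need not be rational, so the integer L is compared
-- with it through D-th powers. Any s/t above that exponent is then above L, which gives r^t ≤ 2^(L
-- t) ≤ 2^s.
≤2^-intro : ∀ x n c L r → r ≤ 2 ^ L → L ^ suc x ≤ c ^ suc x * n ^ (x + suc x) →
  ∀ s t .{{_ : NonZero t}} → mkℚᵘ (+ c) 0 Q.^ suc x ℚ.* mkℚᵘ (+ n) 0 Q.^ (x + suc x) ℚ.≤ (+ s / t) Q.^ suc x →
  r ^ t ≤ 2 ^ s
≤2^-intro x n c L r r≤ L≤ s (suc t) h = begin
  r ^ suc t           ≤⟨ ^-monoˡ-≤ (suc t) r≤ ⟩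
  (2 ^ L) ^ suc t     ≡⟨ ^-*-assoc 2 L (suc t) ⟩
  2 ^ (L * suc t)     ≤⟨ ^-monoʳ-≤ 2 (power-reflects-≤ {L * suc t} {s} x (begin
    (L * suc t) ^ suc x            ≡⟨ ^-distribʳ-* L (suc t) (suc x) ⟩
    L ^ suc x * suc t ^ suc x      ≤⟨ *-monoˡ-≤ (suc t ^ suc x) L≤ ⟩
    c ^ suc x * n ^ (x + suc x) * suc t ^ suc x ≤⟨ clear-denominators c n s t x (x + suc x) h ⟩
    s ^ suc x                      ∎)) ⟩
  2 ^ s               ∎
  where open ≤-Reasoning

empty-arrows : (H : OrderedGraph 3 0) → Arrows H H 0
empty-arrows H χ = inj₁ ((λ ()) , (λ { {()} }) , (λ { {()} }) , λ { [] e∈ → contradiction (OrderedGraph.uniform H [] e∈) λ () })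

RamseyBound : ℕ → ℚᵘ → Set
RamseyBound d α = ∃[ C ] Positive C × (∀ (n : ℕ) (H : OrderedGraph 3 n) → WeaklyDegenerate d H →
  (∀ χ → IsIntervalChromaticNumber H χ → χ ≤ 3 → ∃[ r ] IsRamseyNumber H H r × r ≤2^[ C · n ^ α ]))

ramsey-power-bound : ∀ d x → 2 * d + 2 ≤ x → RamseyBound d (mkℚᵘ (+ (x + suc x)) x)
ramsey-power-bound d x x-large = from (constant d) (constant d * 2 ^ (2 * suc x)) refl (s≤s z≤n) (ramsey-bound d x x-large)
  where
  from : ∀ C₁ C → C ≡ C₁ * 2 ^ (2 * suc x) → 0 < C₁ →
    (∀ {n} → 1 ≤ n → (H : OrderedGraph 3 n) → WeaklyDegenerate d H → ∀ {m} → m ≤ 3 → IntervalColourable H m →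
      ∃[ a ] ∃[ N ] (2 ^ suc x) ^ a ≤ n × Arrows H H N
        × N ≤ 2 ^ (C₁ * (2 ^ (a + (1 + suc a * x)) * 2 ^ (1 + suc a * x)))) →
    RamseyBound d (mkℚᵘ (+ (x + suc x)) x)
  from C₁ C C≡ 0<C₁ arrowing = mkℚᵘ (+ C) 0 , ℤ.positive (ℤ.+<+ 0<C) , ramsey
    where
    0<C : 0 < C
    0<C = subst (0 <_) (sym C≡) (*-mono-≤ 0<C₁ (1≤2^ (2 * suc x)))
    bound : ∀ {n N L} (H : OrderedGraph 3 n) → Arrows H H N → N ≤ 2 ^ L → L ^ suc x ≤ C ^ suc x * n ^ (x + suc x) →
      ∃[ r ] IsRamseyNumber H H r × r ≤2^[ mkℚᵘ (+ C) 0 · n ^ mkℚᵘ (+ (x + suc x)) x ]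
    bound {n} {N} {L} H arrows N≤ L≤ = result (least (arrows? H H) arrows)
      where
      result : ∃[ r ] IsRamseyNumber H H r × r ≤ N → _
      result (r , isLeast , r≤N) = r , isLeast , ≤2^-intro x n C L r (≤-trans r≤N N≤) L≤
    ramsey : ∀ n (H : OrderedGraph 3 n) → WeaklyDegenerate d H → ∀ χ → IsIntervalChromaticNumber H χ → χ ≤ 3 →
      ∃[ r ] IsRamseyNumber H H r × r ≤2^[ mkℚᵘ (+ C) 0 · n ^ mkℚᵘ (+ (x + suc x)) x ]
    -- The logarithm of n requires n ≥ 1; for the empty graph 0 vertices already suffice.
    ramsey zero H _ _ _ _ = bound {L = 0} H (empty-arrows H) z≤n z≤n
    ramsey (suc n) H degenerate χ (colourable , _) χ≤3
      with a , N , low , arrows , N≤ ← arrowing (s≤s z≤n) H degenerate χ≤3 colourable =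
      bound {L = C₁ * (2 ^ (a + (1 + suc a * x)) * 2 ^ (1 + suc a * x))} H arrows N≤
        (subst (λ C → (C₁ * (2 ^ (a + (1 + suc a * x)) * 2 ^ (1 + suc a * x))) ^ suc x ≤ C ^ suc x * suc n ^ (x + suc x))
          (sym C≡) (exponent-bound x a (suc n) C₁ low))

corollary1p5 : ∃[ c ] Positive c × (∀ (d : ℕ) .{{_ : NonZero d}} →
    ∃[ C ] Positive C × (∀ (n : ℕ) (H : OrderedGraph 3 n) →
    WeaklyDegenerate d H →
    (∀ χ → IsIntervalChromaticNumber H χ → χ ≤ 3 →
    ∃[ r ] IsRamseyNumber H H r
    × r ≤2^[ C · n ^ ((+ 2 / 1) - c ℚ.* (+ 1 / d)) ])))
corollary1p5 = (+ 1 / 5) , _ , bound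
  where
  bound : ∀ (d : ℕ) .{{_ : NonZero d}} → RamseyBound d ((+ 2 / 1) - (+ 1 / 5) ℚ.* (+ 1 / d))
  bound (suc e) = subst (RamseyBound (suc e)) exponent (ramsey-power-bound (suc e) x x-large)
    where
    -- With d = suc e this is D = suc x = 5d. The factor 5 is the least k with 2d + 2 ≤ k d - 1 for
    -- all d ≥ 1; equality holds at d = 1. This is the origin of the constant 1/5.
    x = e + 4 * suc e
    -- The bound is defined by matching on numerator and denominator, so the fractions must be
    -- identical and not merely equal in value. The unnormalised difference is (10d - 1)/(5d), with
    -- exactly these components.
    exponent : mkℚᵘ (+ (x + suc x)) x ≡ (+ 2 / 1) - (+ 1 / 5) ℚ.* (+ 1 / suc e)
    exponent = cong₂ (λ i j → mkℚᵘ (+ (x + i)) j) (sym (+-identityʳ (suc x))) (sym (+-identityʳ x))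
    x-large : 2 * suc e + 2 ≤ x
    x-large = ≤-trans (m≤m+n _ (3 * e)) (≤-reflexive (e₁ e))
      where
      e₁ : ∀ e → 2 * suc e + 2 + 3 * e ≡ e + 4 * suc e
      e₁ = solve-∀
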